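{- Let $B\subseteq[m]\times[n]$ be a board and $d\ge 0$ an integer. Then for every prime power $q$, $$M_d(B,q)\equiv r_d(B)+(q-1)\bigl(r_{\mathsf{ZG},d-2}(B)-r_{\mathsf{SG},d-2}(B)+r_{\mathsf{WRG},d-1}(B)+r_{\mathsf{WCG},d-1}(B)\bigr)\pmod{(q-1)^2}.$$
   Context: Notation: $[n]=\{1,\dots,n\}$. A board is a subset $B\subseteq[m]\times[n]$. The rook number $r_d(B)$ is the number of ways to choose $d$ cells of $B$ with no two in the same row or column. For a prime power $q>1$, $\mathfrak m_d(B,q)$ is the number of $m\times n$ matrices over $\mathbb F_q$ of rank $d$ whose support (set of positions of nonzero entries) is contained in $B$; $M_d(B,q)=\mathfrak m_d(B,q)/(q-1)^d$, which is known to be an integer. A bi-colored graph is a graph whose vertices are partitioned into row vertices and column vertices, every edge joining a row vertex to a column vertex; isomorphisms must preserve the two classes. For a board $B\subseteq[m]\times[n]$, $G(B)$ is the bi-colored graph with row vertices $[m]$, column vertices $[n]$, and edge set $B$. Let $\mathsf E$ be the graph with one row vertex, one column vertex and one edge, and $\mathsf E^i$ the disjoint union of $i$ copies of it. For a bi-colored graph $F$ and integer $i\ge0$, $r_{F,i}(B)$ is the number of boards $\sigma\subseteq B$ with $G(\sigma)\cong F\sqcup\mathsf E^i\sqcup R$, where $R$ is the edgeless bi-colored graph with the number of row and column vertices needed so that the totals are $m$ and $n$ ($r_{F,i}(B)=0$ if this is impossible). By convention $r_{F,i}(B)=0$ for $i<0$. The four graphs are: $\mathsf{ZG}$, with 2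 row and 2 column vertices, forming a path with 3 edges; $\mathsf{SG}$, with 2 row and 2 column vertices, forming $K_{2,2}$; $\mathsf{WCG}$, with 1 row vertex adjacent to each of 2 column vertices; $\mathsf{WRG}$, with 1 column vertex adjacent to each of 2 row vertices. -}

module Defs where

open import Algebra.Core using (Op₁; Op₂)
open import Algebra.Bundles using (CommutativeRing)
open import Algebra.Structures using (IsCommutativeRing)
import Algebra.Properties.Semiring.Sum as SemiringSum
open import Data.Fin.Base using (Fin)
import Data.Fin.Properties as Fin
open import Data.Fin.Permutation using (Permutation; permutation; _⟨$⟩ʳ_; _⟨$⟩ˡ_; _≈_; inverseˡ; inverseʳ)
open import Data.Fin.Subset using (Subset; _∈_; _∉_; ∣_∣; ⊥; inside; outside)
open import Data.Fin.Subset.Properties using (_∈?_)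
open import Data.Integer.Base as ℤ using (ℤ; +_; -[1+_])
open import Data.Integer.Divisibility as ℤ∣ using ()
open import Data.List.Base as List using (List; []; _∷_; length; filter; allFin; cartesianProductWith)
open import Data.List.Extrema.Nat using (max)
open import Data.List.Membership.Propositional as ListMem using (lose; find)
open import Data.List.Membership.Propositional.Properties using (∈-cartesianProductWith⁺; ∈-tabulate⁺; ∈-allFin)
open import Data.List.Relation.Unary.All as All using ()
open import Data.List.Relation.Unary.Any as Any using (here)
open import Data.Nat.Base using (ℕ; zero; suc; _+_; _∸_; _^_; _≥_)
import Data.Nat.Properties as ℕ
open import Data.Nat.Primality using (Prime)
open import Data.Product.Base using (∃; ∃₂; _×_; _,_; proj₁; proj₂)
open import Data.Product.Properties using (≡-dec)
open import Data.Vec.Base as Vec using (Vec; []; _∷_; lookup; _++_)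
open import Data.Vec.Properties using (lookup∘tabulate)
open import Function.Base using (_∘_)
open import Function.Bundles using (_↔_; _⇔_; Inverse; mk⇔; Equivalence)
open import Function.Properties.Inverse using (↔⇒↣)
open import Level using (0ℓ)
open import Relation.Binary.Definitions using (DecidableEquality)
open import Relation.Binary.PropositionalEquality using (_≡_; _≢_; refl; sym; trans; cong; subst)
open import Relation.Nullary.Decidable using (Dec; yes; no; ¬?; map′; _×-dec_; _→-dec_; via-injection)
open import Relation.Unary using (Pred; Decidable)

private
  variable
    a b m n q : ℕ

Complete : {A : Set} → List A → Set
Complete xs = ∀ x → x ListMem.∈ xs

module _ {A : Set} {xs : List A} (complete : Complete xs) {P : Pred A 0ℓ} (P? : Decidable P) where

  all-dec : Dec (∀ x → P x)
  all-dec = map′ (λ ps x → All.lookup ps (complete x)) (λ f → All.tabulate (λ {x} _ → f x))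
                 (All.all? P? xs)

  any-dec : Dec (∃ P)
  any-dec = map′ (λ p → let (x , _ , px) = find p in x , px) (λ (x , px) → lose (complete x) px)
                 (Any.any? P? xs)

-- If xs lists every element of A exactly once, then vectors xs n lists
-- every element of Vec A n exactly once.
vectors : {A : Set} → List A → ∀ n → List (Vec A n)
vectors xs zero    = [] ∷ []
vectors xs (suc n) = cartesianProductWith _∷_ xs (vectors xs n)

vectors-complete : {A : Set} {xs : List A} → Complete xs → ∀ n → Complete (vectors xs n)
vectors-complete c zero    []       = here refl
vectors-complete c (suc n) (x ∷ xs) = ∈-cartesianProductWith⁺ _∷_ (c x) (vectors-complete c n xs)

-- A board in [m] × [n], given by its rows: row i is the set of columns j
-- such that the cell (i , j) belongs to the board.
Board : ℕ → ℕ → Set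
Board m n = Vec (Subset n) m

Cell : ℕ → ℕ → Set
Cell m n = Fin m × Fin n

infix 4 _∈ᴮ_ _∈ᴮ?_ _⊆ᴮ_ _⊆ᴮ?_

_∈ᴮ_ : Cell m n → Board m n → Set
(i , j) ∈ᴮ B = j ∈ lookup B i

_∈ᴮ?_ : (c : Cell m n) (B : Board m n) → Dec (c ∈ᴮ B)
(i , j) ∈ᴮ? B = j ∈? lookup B i

_⊆ᴮ_ : Board m n → Board m n → Set
σ ⊆ᴮ B = ∀ i j → (i , j) ∈ᴮ σ → (i , j) ∈ᴮ B

_⊆ᴮ?_ : (σ B : Board m n) → Dec (σ ⊆ᴮ B)
σ ⊆ᴮ? B = Fin.all? λ i → Fin.all? λ j → ((i , j) ∈ᴮ? σ) →-dec ((i , j) ∈ᴮ? B)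

size : Board m n → ℕ
size B = Vec.sum (Vec.map ∣_∣ B)

subsets : ∀ n → List (Subset n)
subsets = vectors (inside ∷ outside ∷ [])

boards : ∀ m n → List (Board m n)
boards m n = vectors (subsets n) m

NonAttacking : Board m n → Set
NonAttacking σ = ∀ i j i′ j′ → (i , j) ∈ᴮ σ → (i′ , j′) ∈ᴮ σ →
                 (i , j) ≢ (i′ , j′) → i ≢ i′ × j ≢ j′

nonAttacking? : Decidable (NonAttacking {m} {n})
nonAttacking? σ =
  Fin.all? λ i → Fin.all? λ j → Fin.all? λ i′ → Fin.all? λ j′ →
  ((i , j) ∈ᴮ? σ) →-dec ((i′ , j′) ∈ᴮ? σ) →-dec
  ¬? (≡-dec Fin._≟_ Fin._≟_ (i , j) (i′ , j′)) →-dec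
  (¬? (i Fin.≟ i′) ×-dec ¬? (j Fin.≟ j′))

rookNumber : ℕ → Board m n → ℕ
rookNumber {m} {n} d B =
  length (filter (λ σ → (σ ⊆ᴮ? B) ×-dec ((size σ ℕ.≟ d) ×-dec nonAttacking? σ)) (boards m n))

record BiGraph : Set where
  constructor biGraph
  field
    {rows cols} : ℕ
    edges       : Board rows cols

open BiGraph public

G : Board m n → BiGraph
G B = biGraph B

EdgesMatch : (X Y : BiGraph) → Permutation (rows X) (rows Y) → Permutation (cols X) (cols Y) → Set
EdgesMatch X Y ρ κ = ∀ i j → (i , j) ∈ᴮ edges X ⇔ (ρ ⟨$⟩ʳ i , κ ⟨$⟩ʳ j) ∈ᴮ edges Y

infix 4 _≅_ _≅?_

_≅_ : BiGraph → BiGraph → Set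
X ≅ Y = ∃₂ λ (ρ : Permutation (rows X) (rows Y)) (κ : Permutation (cols X) (cols Y)) →
        EdgesMatch X Y ρ κ

infixr 5 _⊔ᴳ_

_⊔ᴳ_ : BiGraph → BiGraph → BiGraph
X ⊔ᴳ Y = biGraph (Vec.map (_++ ⊥ {cols Y}) (edges X) ++ Vec.map (⊥ {cols X} ++_) (edges Y))

edgeless : ℕ → ℕ → BiGraph
edgeless a b = biGraph (Vec.replicate a (⊥ {b}))

E : BiGraph
E = biGraph {1} {1} ((inside ∷ []) ∷ [])

E^ : ℕ → BiGraph
E^ zero    = edgeless 0 0
E^ (suc i) = E ⊔ᴳ E^ i

ZG SG WCG WRG : BiGraph
ZG  = biGraph {2} {2} ((inside ∷ outside ∷ []) ∷ (inside ∷ inside ∷ []) ∷ [])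
SG  = biGraph {2} {2} ((inside ∷ inside ∷ []) ∷ (inside ∷ inside ∷ []) ∷ [])
WCG = biGraph {1} {2} ((inside ∷ inside ∷ []) ∷ [])
WRG = biGraph {2} {1} ((inside ∷ []) ∷ (inside ∷ []) ∷ [])

module _ {P : Permutation a b → Set} (resp : ∀ {ρ ρ′} → ρ ≈ ρ′ → P ρ → P ρ′) (P? : Decidable P) where

  private
    Graph : Vec (Fin b) a → Vec (Fin a) b → Set
    Graph f g = (∀ j → lookup f (lookup g j) ≡ j) × (∀ i → lookup g (lookup f i) ≡ i)

    graph? : ∀ f g → Dec (Graph f g)
    graph? f g = Fin.all? (λ j → lookup f (lookup g j) Fin.≟ j)
           ×-dec Fin.all? (λ i → lookup g (lookup f i) Fin.≟ i)

    toPerm : ∀ f g → Graph f g → Permutation a b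
    toPerm f g (l , r) = permutation (lookup f) (lookup g) l r

    Q : Vec (Fin b) a → Vec (Fin a) b → Set
    Q f g = ∃ λ (inv : Graph f g) → P (toPerm f g inv)

    Q? : ∀ f g → Dec (Q f g)
    Q? f g with graph? f g
    ... | no ¬inv = no (¬inv ∘ proj₁)
    ... | yes inv = map′ (inv ,_) (λ (_ , p) → resp (λ _ → refl) p) (P? (toPerm f g inv))

    fromPerm : ∃ P → ∃₂ Q
    fromPerm (ρ , p) = f , g , (l , r) , resp (λ i → sym (lookup∘tabulate (ρ ⟨$⟩ʳ_) i)) p
      where
      f = Vec.tabulate (ρ ⟨$⟩ʳ_)
      g = Vec.tabulate (ρ ⟨$⟩ˡ_)
      l : ∀ j → lookup f (lookup g j) ≡ j
      l j = trans (lookup∘tabulate (ρ ⟨$⟩ʳ_) (lookup g j))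
                  (trans (cong (ρ ⟨$⟩ʳ_) (lookup∘tabulate (ρ ⟨$⟩ˡ_) j)) (inverseʳ ρ))
      r : ∀ i → lookup g (lookup f i) ≡ i
      r i = trans (lookup∘tabulate (ρ ⟨$⟩ˡ_) (lookup f i))
                  (trans (cong (ρ ⟨$⟩ˡ_) (lookup∘tabulate (ρ ⟨$⟩ʳ_) i)) (inverseˡ ρ))

  anyPermutation? : Dec (∃ P)
  anyPermutation? = map′ (λ (f , g , inv , p) → toPerm f g inv , p) fromPerm
    (any-dec (vectors-complete ∈-allFin a) λ f →
     any-dec (vectors-complete ∈-allFin b) λ g → Q? f g)

edgesMatch? : ∀ X Y ρ κ → Dec (EdgesMatch X Y ρ κ)
edgesMatch? X Y ρ κ = Fin.all? λ i → Fin.all? λ j →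
  map′ (λ (f , g) → mk⇔ f g) (λ e → Equivalence.to e , Equivalence.from e)
    ((((i , j) ∈ᴮ? edges X) →-dec ((ρ ⟨$⟩ʳ i , κ ⟨$⟩ʳ j) ∈ᴮ? edges Y)) ×-dec
     (((ρ ⟨$⟩ʳ i , κ ⟨$⟩ʳ j) ∈ᴮ? edges Y) →-dec ((i , j) ∈ᴮ? edges X)))

_≅?_ : ∀ X Y → Dec (X ≅ Y)
X ≅? Y =
  anyPermutation? (λ ρ≈ρ′ (κ , e) → κ , λ i j → subst (λ k → _ ⇔ (k , _) ∈ᴮ edges Y) (ρ≈ρ′ i) (e i j)) λ ρ →
  anyPermutation? (λ κ≈κ′ e i j → subst (λ k → _ ⇔ (_ , k) ∈ᴮ edges Y) (κ≈κ′ j) (e i j)) λ κ →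
  edgesMatch? X Y ρ κ

-- If F ⊔ Eⁱ has more than m rows or more than n columns, then the truncated
-- subtraction adds no rows or no columns, respectively, and the result is not isomorphic to
-- any G σ with σ : Board m n because the numbers of vertices differ.
padded : (m n : ℕ) → BiGraph → ℕ → BiGraph
padded m n F i = F ⊔ᴳ E^ i ⊔ᴳ edgeless (m ∸ (rows F + i)) (n ∸ (cols F + i))

r[_,_] : BiGraph → ℤ → Board m n → ℕ
r[_,_] {m} {n} F (+ i) B =
  length (filter (λ σ → (σ ⊆ᴮ? B) ×-dec (G σ ≅? padded m n F i)) (boards m n))
r[ F , -[1+ _ ] ] B = 0

IsPrimePower : ℕ → Set
IsPrimePower q = ∃₂ λ p k → Prime p × k ≥ 1 × q ≡ p ^ k

record FiniteField (q : ℕ) : Set₁ where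
  infixl 7 _*ᶠ_
  infixl 6 _+ᶠ_
  field
    Carrier           : Set
    _+ᶠ_ _*ᶠ_         : Op₂ Carrier
    -ᶠ_               : Op₁ Carrier
    0# 1#             : Carrier
    isCommutativeRing : IsCommutativeRing _≡_ _+ᶠ_ _*ᶠ_ -ᶠ_ 0# 1#
    1≢0               : 1# ≢ 0#
    invertible        : ∀ x → x ≢ 0# → ∃ λ y → x *ᶠ y ≡ 1#
    enumeration       : Carrier ↔ Fin q

  commutativeRing : CommutativeRing 0ℓ 0ℓ
  commutativeRing = record { isCommutativeRing = isCommutativeRing }

  open SemiringSum (CommutativeRing.semiring commutativeRing) public using (sum)

  _≟_ : DecidableEquality Carrier
  _≟_ = via-injection (↔⇒↣ enumeration) Fin._≟_

  elements : List Carrier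
  elements = List.tabulate (Inverse.from enumeration)

  elements-complete : Complete elements
  elements-complete x = subst (ListMem._∈ elements) (Inverse.strictlyInverseʳ enumeration x)
                              (∈-tabulate⁺ (Inverse.to enumeration x))

module _ (F : FiniteField q) where
  open FiniteField F

  Matrix : ℕ → ℕ → Set
  Matrix m n = Vec (Vec Carrier n) m

  matrices : ∀ m n → List (Matrix m n)
  matrices m n = vectors (vectors elements n) m

  entry : Matrix m n → Fin m → Fin n → Carrier
  entry A i j = lookup (lookup A i) j

  SupportedIn : Board m n → Matrix m n → Set
  SupportedIn B A = ∀ i j → entry A i j ≢ 0# → (i , j) ∈ᴮ B

  supportedIn? : (B : Board m n) → Decidable (SupportedIn B)
  supportedIn? B A = Fin.all? λ i → Fin.all? λ j → ¬? (entry A i j ≟ 0#) →-dec ((i , j) ∈ᴮ? B)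

  IndependentRows : Matrix m n → Subset m → Set
  IndependentRows {m} A S =
    (c : Vec Carrier m) → (∀ i → i ∉ S → lookup c i ≡ 0#) →
    (∀ j → sum (λ i → lookup c i *ᶠ entry A i j) ≡ 0#) →
    ∀ i → lookup c i ≡ 0#

  independentRows? : (A : Matrix m n) → Decidable (IndependentRows A)
  independentRows? {m} A S = all-dec (vectors-complete elements-complete m) λ c →
    Fin.all? (λ i → ¬? (i ∈? S) →-dec (lookup c i ≟ 0#)) →-dec
    Fin.all? (λ j → sum (λ i → lookup c i *ᶠ entry A i j) ≟ 0#) →-dec
    Fin.all? (λ i → lookup c i ≟ 0#)

  rank : Matrix m n → ℕ
  rank {m} A = max 0 (List.map ∣_∣ (filter (independentRows? A) (subsets m)))

  𝔪 : ℕ → Board m n → ℕ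
  𝔪 {m} {n} d B =
    length (filter (λ A → (rank A ℕ.≟ d) ×-dec supportedIn? B A) (matrices m n))

  -- N = 𝔪_d(B,q)/(q-1)^d.  As q > 1, at most one integer N satisfies this.
  IsM : ℕ → Board m n → ℤ → Set
  IsM d B N = + 𝔪 d B ≡ N ℤ.* (+ q ℤ.- ℤ.1ℤ) ℤ.^ d

infix 4 _≡_[mod_]

_≡_[mod_] : ℤ → ℤ → ℤ → Set
x ≡ y [mod k ] = k ℤ∣.∣ (x ℤ.- y)

-- Matrices are sorted by their exact support σ; let N_σ be the number of those of rank d. A rank d
-- matrix has a transversal of d nonzero entries, i.e. σ contains a matching of size d. Scaling the
-- rows and columns on one side of a cut of K_{m,n} by λ and λ⁻¹ preserves rank and support, so for every
-- forest in σ with e edges N_σ is (q-1)^e times the number of matrices equal to 1 on the forest.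
-- Contract the matching: if σ has two further edges that are not parallel after contraction,
-- they extend the matching to a forest of size d + 2 and (q-1)^(d+2) divides N_σ. Otherwise all the
-- further edges are parallel, and σ is the disjoint union of copies of E with one of
-- ∅, ZG, SG, WRG, WCG (or is a matching of size d + 1, which only supports matrices of rank d + 1).
-- The forest then covers σ, and N_σ is (q-1)^d or (q-1)^(d+1), except for SG, where one entry remains
-- free and must differ from 0 and 1, so that N_σ = (q-1)^(d+1) (q-2).

module Submission where

open import Defs
open import Algebra.Bundles using (CommutativeRing)
import Algebra.Properties.CommutativeSemigroup as CommutativeSemigroupProperties
import Algebra.Properties.Ring as RingProperties
import Algebra.Properties.Semiring.Sum as SemiringSum
open import Data.Bool.Base using (Bool; true; false; not; if_then_else_)
import Data.Bool.Properties as Bool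
open import Data.Empty using () renaming (⊥ to Empty)
open import Data.Fin.Base using (Fin; zero; suc; toℕ; punchIn; punchOut; splitAt; join; _↑ˡ_; _↑ʳ_; _>_)
open import Data.Fin.Induction using (>-wellFounded)
open import Data.Fin.Permutation using (_⟨$⟩ʳ_; _⟨$⟩ˡ_; ↔⇒≡)
import Data.Fin.Properties as Fin
open import Data.Fin.Subset using (Subset; ∣_∣; ⊥; inside; outside; _∈_; _∉_)
import Data.Fin.Subset.Properties as Subset
open import Data.Fin.Subset.Properties using (_∈?_)
open import Data.Integer.Base using (ℤ; +_; -[1+_]; _+_; _-_; _*_; _^_; 1ℤ)
open import Data.Integer.Divisibility.Signed using (divides; ∣⇒∣ᵤ)
import Data.Integer.Properties as ℤ
open import Data.Integer.Solver using (module +-*-Solver)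
open import Data.List.Base as List using (List; []; _∷_; length; filter; map; allFin; cartesianProduct)
open import Data.List.Extrema.Nat using (argmax-sel; v≤max⁺)
open import Data.List.Membership.Propositional using () renaming (_∈_ to _∈ˡ_; _∉_ to _∉ˡ_)
open import Data.List.Membership.Propositional.Properties using (∈-lookup; ∈-filter⁺; ∈-filter⁻; ∈-map⁺; ∈-map⁻; ∈-allFin; ∈-tabulate⁺; ∈-tabulate⁻; ∈-cartesianProduct⁺; ∈-cartesianProduct⁻)
open import Data.List.Properties using (length-++; length-map; length-tabulate)
open import Data.List.Relation.Unary.All as All using (All; []; _∷_)
import Data.List.Relation.Unary.All.Properties as All
open import Data.List.Relation.Unary.AllPairs using ([]; _∷_)
open import Data.List.Relation.Unary.Any as Any using (here; there)
open import Data.List.Relation.Unary.Any.Properties using (lookup-index)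
open import Data.List.Relation.Unary.Unique.Propositional using (Unique)
import Data.List.Relation.Unary.Unique.Propositional.Properties as Unique
open import Data.Nat.Base as ℕ using (ℕ; zero; suc; _≤_; z≤n; s≤s; _∸_)
import Data.Nat.ListAction as ℕ
import Data.Nat.Properties as ℕ
import Algebra.Properties.CommutativeSemigroup ℕ.+-commutativeSemigroup as ℕ+
open import Data.Product.Base using (∃; ∃₂; _×_; _,_; proj₁; proj₂)
open import Data.Product.Properties using (≡-dec)
open import Data.Sum.Algebra using (⊎-assoc)
open import Data.Sum.Base as Sum using (_⊎_; inj₁; inj₂)
open import Data.Sum.Function.Propositional using (_⊎-↔_)
open import Data.Sum.Properties using (inj₁-injective; inj₂-injective)
open import Data.Unit.Base using (⊤; tt)
open import Data.Vec.Base as Vec using (Vec; []; _∷_; lookup; _++_)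
import Data.Vec.Properties as Vec
open import Data.Vec.Properties using (lookup∘tabulate; lookup⇒[]=; []=⇒lookup; tabulate∘lookup; tabulate-cong; lookup-map; lookup-++ˡ; lookup-++ʳ; lookup-replicate)
open import Function.Base using (_∘_; id)
open import Function.Bundles using (_↔_; _⇔_; mk⇔; mk↔ₛ′; Equivalence; Inverse; Injection)
open import Function.Definitions using (Injective)
open import Function.Properties.Inverse using (↔-refl; ↔-sym; ↔-trans; ↔⇒↣)
open import Induction.WellFounded using (Acc; acc)
open import Level using (0ℓ)
open import Relation.Binary.Definitions using (DecidableEquality)
open import Relation.Binary.PropositionalEquality using (_≡_; _≢_; refl; sym; trans; cong; cong₂; subst; subst₂; module ≡-Reasoning)
open import Relation.Nullary using (Dec; yes; no; does; ¬_; contradiction)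
open import Relation.Nullary.Decidable using (_×-dec_; _→-dec_; _⊎-dec_; ¬?; map′; dec-true; dec-false; does-⇔; decidable-stable)
open import Relation.Unary using (Pred; Decidable)
open Equivalence using (to; from)

-- The claim is proved multiplied by $(q-1)^d$, one support at a time: each $N_σ$ is written as
-- $(h+t(q-1)^2)(q-1)^d$ with an explicit integer $t$. Such expressions add up over all supports,
-- nothing is ever divided, and the integrality of $M_d$ comes out together with the congruence. The
-- shapes have to be recognised in both directions. A rank d matrix yields a matching and hence a
-- place in the classification; conversely every board of a given shape must have the stated $N_σ$,
-- and no board may have two shapes, since it would then enter two coefficients. Determinants do not
-- appear. The transversal comes from an exchange argument on independent rows instead of a nonzero
-- minor. Ranks are bounded from above by covering all cells with d rows or d columns, and from
-- below by a triangular ordering of the matching; the square is the one shape whose support does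
-- not decide the rank. Contraction is not carried out on graphs either: a contracted vertex appears
-- only as the cut around a row together with its partner column.

private
  variable
    A C : Set
    P Q : Set
    m n k d i a : ℕ
    σ : Board m n

-- Counting with lists and finite sets

lookup-injective : {xs : List A} → Unique xs → Injective _≡_ _≡_ (List.lookup xs)
lookup-injective (x∉ ∷ u) {zero}  {zero}  _  = refl
lookup-injective (x∉ ∷ u) {zero}  {suc j} eq = contradiction eq (All.lookup x∉ (∈-lookup j))
lookup-injective (x∉ ∷ u) {suc i} {zero}  eq = contradiction (sym eq) (All.lookup x∉ (∈-lookup i))
lookup-injective (x∉ ∷ u) {suc i} {suc j} eq = cong suc (lookup-injective u eq)

-- Positions replace elements: sending a position in `xs` to the position of the image in `ys` is an
-- injection of finite index sets.
length-≤ : {xs : List A} {ys : List C} (f : A → C) → Unique xs →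
           (∀ {x} → x ∈ˡ xs → f x ∈ˡ ys) →
           (∀ {x y} → x ∈ˡ xs → y ∈ˡ xs → f x ≡ f y → x ≡ y) →
           length xs ≤ length ys
length-≤ {xs = xs} {ys} f uniq into inj = Fin.injective⇒≤ {f = g} g-injective
  where
  g : Fin (length xs) → Fin (length ys)
  g i = Any.index (into (∈-lookup {xs = xs} i))
  g-lookup : ∀ i → f (List.lookup xs i) ≡ List.lookup ys (g i)
  g-lookup i = lookup-index (into (∈-lookup {xs = xs} i))
  g-injective : Injective _≡_ _≡_ g
  g-injective {i} {j} gi≡gj = lookup-injective uniq
    (inj (∈-lookup i) (∈-lookup j)
      (trans (g-lookup i) (trans (cong (List.lookup ys) gi≡gj) (sym (g-lookup j)))))

length-≡ : {xs : List A} {ys : List C} (f : A → C) (g : C → A) → Unique xs → Unique ys →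
           (∀ {x} → x ∈ˡ xs → f x ∈ˡ ys) → (∀ {y} → y ∈ˡ ys → g y ∈ˡ xs) →
           (∀ {x} → x ∈ˡ xs → g (f x) ≡ x) → (∀ {y} → y ∈ˡ ys → f (g y) ≡ y) →
           length xs ≡ length ys
length-≡ f g uxs uys f-into g-into gf fg = ℕ.≤-antisym
  (length-≤ f uxs f-into (λ x y eq → trans (sym (gf x)) (trans (cong g eq) (gf y))))
  (length-≤ g uys g-into (λ x y eq → trans (sym (fg x)) (trans (cong f eq) (fg y))))

length-empty : (xs : List A) → (∀ {x} → x ∉ˡ xs) → length xs ≡ 0
length-empty []       _     = refl
length-empty (x ∷ xs) empty = contradiction (here refl) empty

length-cartesianProduct : (xs : List A) (ys : List C) →
                          length (cartesianProduct xs ys) ≡ length xs ℕ.* length ys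
length-cartesianProduct []       ys = refl
length-cartesianProduct (x ∷ xs) ys =
  trans (length-++ (map (x ,_) ys)) (cong₂ ℕ._+_ (length-map (x ,_) ys) (length-cartesianProduct xs ys))

abstract

  -- The Iverson bracket. It is opaque and used only through the laws of this block, so that the
  -- bulky decision procedures for isomorphism are never evaluated.
  ⟦_⟧ : Dec P → ℕ
  ⟦ p? ⟧ = if does p? then 1 else 0

  ⟦⟧-cong : P ⇔ Q → (p? : Dec P) (q? : Dec Q) → ⟦ p? ⟧ ≡ ⟦ q? ⟧
  ⟦⟧-cong P⇔Q p? q? = cong (if_then 1 else 0) (does-⇔ P⇔Q p? q?)

  ⟦⟧-yes : (p? : Dec P) → P → ⟦ p? ⟧ ≡ 1
  ⟦⟧-yes p? p = cong (if_then 1 else 0) (dec-true p? p)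

  ⟦⟧-no : (p? : Dec P) → ¬ P → ⟦ p? ⟧ ≡ 0
  ⟦⟧-no p? ¬p = cong (if_then 1 else 0) (dec-false p? ¬p)

  length-filter-∷ : {P : Pred A 0ℓ} (P? : Decidable P) → ∀ x xs →
                    length (filter P? (x ∷ xs)) ≡ ⟦ P? x ⟧ ℕ.+ length (filter P? xs)
  length-filter-∷ P? x xs with does (P? x)
  ... | true  = refl
  ... | false = refl

does-true : (p? : Dec P) → does p? ≡ true → P
does-true (yes p) _ = p

module _ {Y : Set} (_≟_ : DecidableEquality Y) where

  private
    sum-map-+ : (f g : Y → ℕ) (ys : List Y) →
                ℕ.sum (map (λ y → f y ℕ.+ g y) ys) ≡ ℕ.sum (map f ys) ℕ.+ ℕ.sum (map g ys)
    sum-map-+ f g []       = refl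
    sum-map-+ f g (y ∷ ys) = trans (cong (f y ℕ.+ g y ℕ.+_) (sum-map-+ f g ys))
                                   (ℕ+.interchange (f y) (g y) (ℕ.sum (map f ys)) (ℕ.sum (map g ys)))

    sum-map-0 : (ys : List Y) → ℕ.sum (map (λ _ → 0) ys) ≡ 0
    sum-map-0 []       = refl
    sum-map-0 (y ∷ ys) = sum-map-0 ys

    sum-map-cong : {f g : Y → ℕ} → (∀ y → f y ≡ g y) → (ys : List Y) → ℕ.sum (map f ys) ≡ ℕ.sum (map g ys)
    sum-map-cong f≗g []       = refl
    sum-map-cong f≗g (y ∷ ys) = cong₂ ℕ._+_ (f≗g y) (sum-map-cong f≗g ys)

    sum-⟦≟⟧-∉ : ∀ z ys → z ∉ˡ ys → ℕ.sum (map (λ y → ⟦ z ≟ y ⟧) ys) ≡ 0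
    sum-⟦≟⟧-∉ z []       _    = refl
    sum-⟦≟⟧-∉ z (y ∷ ys) z∉ys =
      cong₂ ℕ._+_ (⟦⟧-no (z ≟ y) (z∉ys ∘ here)) (sum-⟦≟⟧-∉ z ys (z∉ys ∘ there))

    sum-⟦≟⟧ : ∀ z {ys} → Unique ys → z ∈ˡ ys → ℕ.sum (map (λ y → ⟦ z ≟ y ⟧) ys) ≡ 1
    sum-⟦≟⟧ z {y ∷ ys} (y∉ys ∷ _) (here refl) =
      cong₂ ℕ._+_ (⟦⟧-yes (z ≟ z) refl) (sum-⟦≟⟧-∉ z ys (λ z∈ys → All.lookup y∉ys z∈ys refl))
    sum-⟦≟⟧ z {y ∷ ys} (y∉ys ∷ u) (there z∈ys) =
      cong₂ ℕ._+_ (⟦⟧-no (z ≟ y) (λ z≡y → All.lookup y∉ys z∈ys (sym z≡y))) (sum-⟦≟⟧ z u z∈ys)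

  -- Double counting: the value of each element occurs exactly once in `ys`, so the element adds 1
  -- to exactly one summand. This is the sorting of matrices by support.
  length-by-fibres : (f : A → Y) (xs : List A) {ys : List Y} → Unique ys → Complete ys →
                     length xs ≡ ℕ.sum (map (λ y → length (filter (λ x → f x ≟ y) xs)) ys)
  length-by-fibres f []       {ys} u c = sym (sum-map-0 ys)
  length-by-fibres f (x ∷ xs) {ys} u c = sym (trans
    (sum-map-cong (λ y → length-filter-∷ (λ x → f x ≟ y) x xs) ys)
    (trans (sum-map-+ _ _ ys)
           (cong₂ ℕ._+_ (sum-⟦≟⟧ (f x) u (c (f x))) (sym (length-by-fibres f xs u c)))))

vectors-unique : {xs : List A} → Unique xs → ∀ n → Unique (vectors xs n)
vectors-unique u zero    = [] ∷ []
vectors-unique u (suc n) = Unique.cartesianProductWith⁺ _∷_ Vec.∷-injective u (vectors-unique u n)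

subsets-complete : ∀ n → Complete (subsets n)
subsets-complete = vectors-complete λ where
  true  → here refl
  false → there (here refl)

subsets-unique : ∀ n → Unique (subsets n)
subsets-unique = vectors-unique (((λ ()) ∷ []) ∷ [] ∷ [])

boards-complete : ∀ m n → Complete (boards m n)
boards-complete m n = vectors-complete (subsets-complete n) m

boards-unique : ∀ m n → Unique (boards m n)
boards-unique m n = vectors-unique (subsets-unique n) m

vec-ext : {xs ys : Vec A n} → (∀ i → lookup xs i ≡ lookup ys i) → xs ≡ ys
vec-ext {xs = xs} {ys} eq =
  trans (sym (tabulate∘lookup xs)) (trans (tabulate-cong eq) (tabulate∘lookup ys))

subsetOf : {P : Pred (Fin n) 0ℓ} → Decidable P → Subset n
subsetOf P? = Vec.tabulate (λ i → does (P? i))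

∈-subsetOf : {P : Pred (Fin n) 0ℓ} (P? : Decidable P) → ∀ i → i ∈ subsetOf P? ⇔ P i
∈-subsetOf P? i = mk⇔
  (λ i∈ → does-true (P? i) (trans (sym (lookup∘tabulate _ i)) ([]=⇒lookup i∈)))
  (λ p → lookup⇒[]= i _ (trans (lookup∘tabulate _ i) (dec-true (P? i) p)))

-- The increasing enumeration of `S`. It turns a set of rows into a family indexed by `Fin`, on
-- which the induction of `transversal` can run.
enum : (S : Subset n) → Fin ∣ S ∣ → Fin n
enum (inside  ∷ S) zero    = zero
enum (inside  ∷ S) (suc t) = suc (enum S t)
enum (outside ∷ S) t       = suc (enum S t)

enum-∈ : (S : Subset n) → ∀ t → enum S t ∈ S
enum-∈ (inside  ∷ S) zero    = Vec.here
enum-∈ (inside  ∷ S) (suc t) = Vec.there (enum-∈ S t)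
enum-∈ (outside ∷ S) t       = Vec.there (enum-∈ S t)

enum-injective : (S : Subset n) → Injective _≡_ _≡_ (enum S)
enum-injective (inside  ∷ S) {zero}  {zero}  _  = refl
enum-injective (inside  ∷ S) {suc s} {suc t} eq = cong suc (enum-injective S (Fin.suc-injective eq))
enum-injective (outside ∷ S) eq = enum-injective S (Fin.suc-injective eq)

enum-surjective : (S : Subset n) → ∀ {i} → i ∈ S → ∃ λ t → enum S t ≡ i
enum-surjective (inside  ∷ S) Vec.here        = zero , refl
enum-surjective (inside  ∷ S) (Vec.there i∈S) = let (t , eq) = enum-surjective S i∈S in suc t , cong suc eq
enum-surjective (outside ∷ S) (Vec.there i∈S) = let (t , eq) = enum-surjective S i∈S in t , cong suc eq

∣∣≤ : (S : Subset n) (f : Fin k → Fin n) → (∀ {i} → i ∈ S → ∃ λ t → f t ≡ i) → ∣ S ∣ ≤ k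
∣∣≤ S f onto = Fin.injective⇒≤ {f = λ t → proj₁ (onto (enum-∈ S t))} λ {s} {t} eq →
  enum-injective S (trans (sym (proj₂ (onto (enum-∈ S s))))
                          (trans (cong f eq) (proj₂ (onto (enum-∈ S t)))))

≤∣∣ : (S : Subset n) (f : Fin k → Fin n) → Injective _≡_ _≡_ f → (∀ t → f t ∈ S) → k ≤ ∣ S ∣
≤∣∣ S f inj into = Fin.injective⇒≤ {f = λ t → proj₁ (enum-surjective S (into t))} λ {s} {t} eq →
  inj (trans (sym (proj₂ (enum-surjective S (into s))))
             (trans (cong (enum S) eq) (proj₂ (enum-surjective S (into t)))))

image? : (f : Fin k → Fin n) → Decidable (λ i → ∃ λ t → f t ≡ i)
image? f i = Fin.any? (λ t → f t Fin.≟ i)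

∣image∣ : (f : Fin k → Fin n) → Injective _≡_ _≡_ f → ∣ subsetOf (image? f) ∣ ≡ k
∣image∣ f inj = ℕ.≤-antisym
  (∣∣≤ _ f (λ {i} → to (∈-subsetOf (image? f) i)))
  (≤∣∣ _ f inj (λ t → from (∈-subsetOf (image? f) (f t)) (t , refl)))

-- Transversals of independent rows

module LinearAlgebra {q : ℕ} (F : FiniteField q) where

  open FiniteField F
  private
    module R = CommutativeRing commutativeRing
    module Σ = SemiringSum R.semiring
    module RP = RingProperties R.ring
  open ≡-Reasoning

  inv : ∀ {x} → x ≢ 0# → Carrier
  inv {x} x≢0 = proj₁ (invertible x x≢0)

  *-inv : ∀ {x} (x≢0 : x ≢ 0#) → x *ᶠ inv x≢0 ≡ 1#
  *-inv {x} x≢0 = proj₂ (invertible x x≢0)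

  *≡0⇒ : ∀ {x y} → x ≢ 0# → x *ᶠ y ≡ 0# → y ≡ 0#
  *≡0⇒ {x} {y} x≢0 xy≡0 = begin
    y                      ≡⟨ sym (R.*-identityˡ y) ⟩
    1# *ᶠ y                ≡⟨ cong (_*ᶠ y) (sym (trans (R.*-comm _ x) (*-inv x≢0))) ⟩
    (inv x≢0 *ᶠ x) *ᶠ y    ≡⟨ R.*-assoc _ x y ⟩
    inv x≢0 *ᶠ (x *ᶠ y)    ≡⟨ cong (inv x≢0 *ᶠ_) xy≡0 ⟩
    inv x≢0 *ᶠ 0#          ≡⟨ R.zeroʳ _ ⟩
    0#                     ∎

  sum-zero : (f : Fin n → Carrier) → (∀ i → f i ≡ 0#) → sum f ≡ 0#
  sum-zero {n} f f≡0 = trans (Σ.sum-cong-≗ f≡0) (Σ.sum-replicate-zero n)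

  sum-single : (f : Fin n → Carrier) (t : Fin n) → (∀ i → i ≢ t → f i ≡ 0#) → sum f ≡ f t
  sum-single f zero    rest≡0 =
    trans (cong (f zero +ᶠ_) (sum-zero (f ∘ suc) (λ i → rest≡0 (suc i) λ ()))) (R.+-identityʳ _)
  sum-single f (suc t) rest≡0 =
    trans (cong₂ _+ᶠ_ (rest≡0 zero λ ()) (sum-single (f ∘ suc) t (λ i i≢t → rest≡0 (suc i) (i≢t ∘ Fin.suc-injective))))
          (R.+-identityˡ _)

  combo : (Fin k → Carrier) → (Fin k → Fin n → Carrier) → Fin n → Carrier
  combo c v j = sum (λ t → c t *ᶠ v t j)

  combo-+* : (c b : Fin k → Carrier) (β : Carrier) (v : Fin k → Fin n → Carrier) → ∀ j →
             combo (λ t → c t +ᶠ β *ᶠ b t) v j ≡ combo c v j +ᶠ β *ᶠ combo b v j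
  combo-+* c b β v j = begin
    combo (λ t → c t +ᶠ β *ᶠ b t) v j
      ≡⟨ Σ.sum-cong-≗ (λ t → trans (R.distribʳ (v t j) (c t) (β *ᶠ b t))
                                   (cong (c t *ᶠ v t j +ᶠ_) (R.*-assoc β (b t) (v t j)))) ⟩
    sum (λ t → c t *ᶠ v t j +ᶠ β *ᶠ (b t *ᶠ v t j))
      ≡⟨ Σ.∑-distrib-+ (λ t → c t *ᶠ v t j) (λ t → β *ᶠ (b t *ᶠ v t j)) ⟩
    combo c v j +ᶠ sum (λ t → β *ᶠ (b t *ᶠ v t j))
      ≡⟨ cong (combo c v j +ᶠ_) (sym (Σ.*-distribˡ-sum β (λ t → b t *ᶠ v t j))) ⟩
    combo c v j +ᶠ β *ᶠ combo b v j ∎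

  Relation : (Fin k → Fin n → Carrier) → Pred (Fin n) 0ℓ → (Fin k → Carrier) → Set
  Relation v J c = (∀ j → J j → combo c v j ≡ 0#) × ∃ λ t → c t ≢ 0#

  -- Linear independence of the vectors restricted to the coordinates in `J`. The set shrinks as
  -- columns are used up by the transversal.
  Independent : (Fin k → Fin n → Carrier) → Pred (Fin n) 0ℓ → Set
  Independent v J = ∀ c → (∀ j → J j → combo c v j ≡ 0#) → ∀ t → c t ≡ 0#

  -- There are finitely many coefficient families, so all can be tried. The second alternative hands
  -- over an actual relation, which the argument by contradiction in `exchange` needs as data.
  independent⊎relation : (v : Fin k → Fin n → Carrier) {J : Pred (Fin n) 0ℓ} → Decidable J →
                         Independent v J ⊎ ∃ (Relation v J)
  independent⊎relation {k} v {J} J?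
    with any-dec (vectors-complete elements-complete k) {P = λ c → Relation v J (lookup c)}
                 (λ c → Fin.all? (λ j → J? j →-dec (combo (lookup c) v j ≟ 0#))
                        ×-dec Fin.any? (λ t → ¬? (lookup c t ≟ 0#)))
  ... | yes (c , rel) = inj₂ (lookup c , rel)
  ... | no  ¬rel      = inj₁ λ c cv≡0 t → decidable-stable (c t ≟ 0#) λ ct≢0 →
    ¬rel (Vec.tabulate c
         , (λ j Jj → trans (Σ.sum-cong-≗ (λ s → cong (_*ᶠ v s j) (lookup∘tabulate c s))) (cv≡0 j Jj))
         , t , λ eq → ct≢0 (trans (sym (lookup∘tabulate c t)) eq))

  _∖_ : Pred (Fin n) 0ℓ → Fin n → Pred (Fin n) 0ℓ
  (J ∖ j) i = J i × i ≢ j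

  -- If there were no such j, every j ∈ J with v₀ j ≢ 0 would carry a combination of v₁, v₂, …
  -- vanishing on J except at j, and these would clear all the entries of v₀.
  exchange : (v : Fin (suc k) → Fin n → Carrier) {J : Pred (Fin n) 0ℓ} → Decidable J → Independent v J →
             ∃ λ j → J j × v zero j ≢ 0# × Independent (v ∘ suc) (J ∖ j)
  exchange {k} {n} v {J} J? ind = conclude (Fin.any? good?)
    where
    Good : Fin n → Set
    Good j = J j × v zero j ≢ 0# × Independent (v ∘ suc) (J ∖ j)

    J∖? : ∀ j → Decidable (J ∖ j)
    J∖? j i = J? i ×-dec ¬? (i Fin.≟ j)

    independent? : ∀ j → Dec (Independent (v ∘ suc) (J ∖ j))
    independent? j with independent⊎relation (v ∘ suc) (J∖? j)
    ... | inj₁ indep             = yes indep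
    ... | inj₂ (c , c≡0 , t , c≢0) = no λ indep → c≢0 (indep c c≡0 t)

    good? : Decidable Good
    good? j = J? j ×-dec (¬? (v zero j ≟ 0#) ×-dec independent? j)

    module _ (¬good : ∀ j → ¬ Good j) where

      w : (Fin k → Carrier) → Fin n → Carrier
      w c j = v zero j +ᶠ combo c (v ∘ suc) j

      clearing : ∀ j → J j → v zero j ≢ 0# →
                 ∃ λ b → (∀ i → (J ∖ j) i → combo b (v ∘ suc) i ≡ 0#) × combo b (v ∘ suc) j ≢ 0#
      clearing j Jj v≢0 with independent⊎relation (v ∘ suc) (J∖? j)
      ... | inj₁ indep = contradiction (Jj , v≢0 , indep) (¬good j)
      -- If the combination `b` also vanished at `j`, the coefficient 0 for `v zero` put in front of
      -- it would give a nontrivial relation on all of `J`, against `ind`.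
      ... | inj₂ (b , b≡0 , t , bt≢0) = b , b≡0 , λ bj≡0 → bt≢0 (ind b⁺ (b⁺≡0 bj≡0) (suc t))
        where
        b⁺ : Fin (suc k) → Carrier
        b⁺ zero    = 0#
        b⁺ (suc t) = b t
        b⁺≡b : ∀ i → combo b⁺ v i ≡ combo b (v ∘ suc) i
        b⁺≡b i = trans (cong (_+ᶠ combo b (v ∘ suc) i) (R.zeroˡ _)) (R.+-identityˡ _)
        b⁺≡0 : combo b (v ∘ suc) j ≡ 0# → ∀ i → J i → combo b⁺ v i ≡ 0#
        b⁺≡0 bj≡0 i Ji with i Fin.≟ j
        ... | yes refl = trans (b⁺≡b i) bj≡0
        ... | no  i≢j  = trans (b⁺≡b i) (b≡0 i (Ji , i≢j))

      -- The second half says that an entry which is not yet zero is still the original one. So a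
      -- nonzero entry at `j` implies `v zero j ≢ 0#`, which is what `clearing` asks for.
      Clear : List (Fin n) → (Fin k → Carrier) → Set
      Clear js c = (∀ i → i ∈ˡ js → J i → w c i ≡ 0#) × (∀ i → J i → w c i ≡ v zero i ⊎ w c i ≡ 0#)

      w-+* : ∀ c b β i → w (λ t → c t +ᶠ β *ᶠ b t) i ≡ w c i +ᶠ β *ᶠ combo b (v ∘ suc) i
      w-+* c b β i = trans (cong (v zero i +ᶠ_) (combo-+* c b β (v ∘ suc) i)) (sym (R.+-assoc _ _ _))

      clear : ∀ js → ∃ (Clear js)
      clear [] = (λ _ → 0#) , (λ _ ()) , λ i _ → inj₁
        (trans (cong (v zero i +ᶠ_) (sum-zero (λ t → 0# *ᶠ v (suc t) i) (λ t → R.zeroˡ _))) (R.+-identityʳ _))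
      clear (j ∷ js) with clear js
      ... | c , c≡0 , old with J? j | w c j ≟ 0#
      ... | no ¬Jj | _     = c , (λ { i (here refl) Ji → contradiction Ji ¬Jj ; i (there i∈) → c≡0 i i∈ }) , old
      ... | yes _  | yes z = c , (λ { i (here refl) _ → z ; i (there i∈) → c≡0 i i∈ }) , old
      ... | yes Jj | no nz with old j Jj
      ...   | inj₂ z  = contradiction z nz
      ...   | inj₁ eq with clearing j Jj (λ v≡0 → nz (trans eq v≡0))
      ...     | b , b≡0 , bj≢0 = c′ , cleared , old′
        where
        β = -ᶠ (w c j *ᶠ inv bj≢0)
        c′ = λ t → c t +ᶠ β *ᶠ b t
        at-j : w c′ j ≡ 0#
        at-j = begin
          w c′ j                                       ≡⟨ w-+* c b β j ⟩
          w c j +ᶠ β *ᶠ combo b (v ∘ suc) j             ≡⟨ cong (w c j +ᶠ_) (sym (RP.-‿distribˡ-* _ _)) ⟩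
          w c j +ᶠ -ᶠ (w c j *ᶠ inv bj≢0 *ᶠ combo b (v ∘ suc) j)
            ≡⟨ cong (λ z → w c j +ᶠ -ᶠ z) (trans (R.*-assoc _ _ _)
                 (trans (cong (w c j *ᶠ_) (trans (R.*-comm _ _) (*-inv bj≢0))) (R.*-identityʳ _))) ⟩
          w c j +ᶠ -ᶠ w c j                             ≡⟨ R.-‿inverseʳ _ ⟩
          0#                                            ∎
        elsewhere : ∀ i → J i → i ≢ j → w c′ i ≡ w c i
        elsewhere i Ji i≢j = trans (w-+* c b β i)
          (trans (cong (λ z → w c i +ᶠ β *ᶠ z) (b≡0 i (Ji , i≢j)))
                 (trans (cong (w c i +ᶠ_) (R.zeroʳ β)) (R.+-identityʳ _)))
        cleared : ∀ i → i ∈ˡ j ∷ js → J i → w c′ i ≡ 0#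
        cleared i i∈ Ji with i Fin.≟ j | i∈
        ... | yes refl | _          = at-j
        ... | no  i≢j  | here i≡j   = contradiction i≡j i≢j
        ... | no  i≢j  | there i∈js = trans (elsewhere i Ji i≢j) (c≡0 i i∈js Ji)
        old′ : ∀ i → J i → w c′ i ≡ v zero i ⊎ w c′ i ≡ 0#
        old′ i Ji with i Fin.≟ j | old i Ji
        ... | yes refl | _       = inj₂ at-j
        ... | no  i≢j  | inj₁ o  = inj₁ (trans (elsewhere i Ji i≢j) o)
        ... | no  i≢j  | inj₂ o  = inj₂ (trans (elsewhere i Ji i≢j) o)

      absurd : 1# ≡ 0#
      absurd with clear (allFin n)
      -- With all columns of `J` cleared, the coefficient 1 followed by `c` is a relation, and
      -- independence equates its first coefficient with 0.
      ... | c , c≡0 , _ = ind c⁺ (λ j Jj → trans (cong (_+ᶠ combo c (v ∘ suc) j) (R.*-identityˡ _))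
                                                 (c≡0 j (∈-allFin j) Jj)) zero
        where
        c⁺ : Fin (suc k) → Carrier
        c⁺ zero    = 1#
        c⁺ (suc t) = c t

    conclude : Dec (∃ Good) → ∃ Good
    conclude (yes good) = good
    conclude (no ¬good) = contradiction (absurd (λ j g → ¬good (j , g))) 1≢0

  -- By `exchange` the first vector takes a column where it is nonzero while the others stay
  -- independent without that column, so the choice can be repeated.
  transversal : (v : Fin k → Fin n → Carrier) {J : Pred (Fin n) 0ℓ} → Decidable J → Independent v J →
                ∃ λ (κ : Fin k → Fin n) → Injective _≡_ _≡_ κ × (∀ t → J (κ t)) × ∀ t → v t (κ t) ≢ 0#
  transversal {zero}          v     J? ind = (λ ()) , (λ { {()} }) , (λ ()) , λ ()
  transversal {suc k} {n = n} v {J} J? ind with exchange v J? ind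
  ... | j , Jj , vj≢0 , ind′
    with transversal (v ∘ suc) (λ i → J? i ×-dec ¬? (i Fin.≟ j)) ind′
  ... | κ , κ-inj , Jκ , vκ≢0 = κ⁺ , κ⁺-inj , Jκ⁺ , vκ⁺≢0
    where
    κ⁺ : Fin (suc k) → Fin n
    κ⁺ zero    = j
    κ⁺ (suc t) = κ t
    κ⁺-inj : Injective _≡_ _≡_ κ⁺
    κ⁺-inj {zero}  {zero}  _  = refl
    κ⁺-inj {zero}  {suc t} eq = contradiction (sym eq) (proj₂ (Jκ t))
    κ⁺-inj {suc s} {zero}  eq = contradiction eq (proj₂ (Jκ s))
    κ⁺-inj {suc s} {suc t} eq = cong suc (κ-inj eq)
    Jκ⁺ : ∀ t → J (κ⁺ t)
    Jκ⁺ zero    = Jj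
    Jκ⁺ (suc t) = proj₁ (Jκ t)
    vκ⁺≢0 : ∀ t → v t (κ⁺ t) ≢ 0#
    vκ⁺≢0 zero    = vj≢0
    vκ⁺≢0 (suc t) = vκ≢0 t

  extend : (S : Subset n) → (Fin ∣ S ∣ → Carrier) → Fin n → Carrier
  extend (inside  ∷ S) c zero    = c zero
  extend (inside  ∷ S) c (suc i) = extend S (c ∘ suc) i
  extend (outside ∷ S) c zero    = 0#
  extend (outside ∷ S) c (suc i) = extend S c i

  extend-enum : (S : Subset n) (c : Fin ∣ S ∣ → Carrier) → ∀ t → extend S c (enum S t) ≡ c t
  extend-enum (inside  ∷ S) c zero    = refl
  extend-enum (inside  ∷ S) c (suc t) = extend-enum S (c ∘ suc) t
  extend-enum (outside ∷ S) c t       = extend-enum S c t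

  extend-∉ : (S : Subset n) (c : Fin ∣ S ∣ → Carrier) → ∀ i → i ∉ S → extend S c i ≡ 0#
  extend-∉ (inside  ∷ S) c zero    i∉ = contradiction Vec.here i∉
  extend-∉ (inside  ∷ S) c (suc i) i∉ = extend-∉ S (c ∘ suc) i (i∉ ∘ Vec.there)
  extend-∉ (outside ∷ S) c zero    i∉ = refl
  extend-∉ (outside ∷ S) c (suc i) i∉ = extend-∉ S c i (i∉ ∘ Vec.there)

  sum-extend : (S : Subset n) (c : Fin ∣ S ∣ → Carrier) (a : Fin n → Carrier) →
               sum (λ i → extend S c i *ᶠ a i) ≡ sum (λ t → c t *ᶠ a (enum S t))
  sum-extend []            c a = refl
  sum-extend (inside  ∷ S) c a = cong (c zero *ᶠ a zero +ᶠ_) (sum-extend S (c ∘ suc) (a ∘ suc))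
  sum-extend (outside ∷ S) c a =
    trans (cong₂ _+ᶠ_ (R.zeroˡ _) (sum-extend S c (a ∘ suc))) (R.+-identityˡ _)

  module _ (A : Matrix F m n) where

    independentRows⇒independent : ∀ S → IndependentRows F A S →
                                  Independent (λ t → entry F A (enum S t)) (λ _ → ⊤)
    independentRows⇒independent S ind c cv≡0 t = trans (sym (c⁺-enum t)) (ind c⁺ c⁺-∉ c⁺≡0 (enum S t))
      where
      c⁺ = Vec.tabulate (extend S c)
      c⁺-enum : ∀ t → lookup c⁺ (enum S t) ≡ c t
      c⁺-enum t = trans (lookup∘tabulate _ (enum S t)) (extend-enum S c t)
      c⁺-∉ : ∀ i → i ∉ S → lookup c⁺ i ≡ 0#
      c⁺-∉ i i∉S = trans (lookup∘tabulate _ i) (extend-∉ S c i i∉S)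
      c⁺≡0 : ∀ j → sum (λ i → lookup c⁺ i *ᶠ entry F A i j) ≡ 0#
      c⁺≡0 j = trans (Σ.sum-cong-≗ (λ i → cong (_*ᶠ entry F A i j) (lookup∘tabulate (extend S c) i)))
                     (trans (sum-extend S c (λ i → entry F A i j)) (cv≡0 j tt))

    private
      sizes = List.map ∣_∣ (filter (independentRows? F A) (subsets m))

    ∣S∣≤rank : ∀ S → IndependentRows F A S → ∣ S ∣ ≤ rank F A
    ∣S∣≤rank S ind = v≤max⁺ 0 sizes (inj₂ (Any.map ℕ.≤-reflexive
      (∈-map⁺ ∣_∣ (∈-filter⁺ (independentRows? F A) (subsets-complete m S) ind))))

    rank-attained : ∃ λ S → IndependentRows F A S × ∣ S ∣ ≡ rank F A
    rank-attained with argmax-sel (λ x → x) 0 sizes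
    -- The default value 0 of the maximum is attained too, by the empty set of rows.
    ... | inj₁ rank≡0 = ⊥ , (λ c c≡0 _ i → c≡0 i Subset.∉⊥) , trans (Subset.∣⊥∣≡0 m) (sym rank≡0)
    ... | inj₂ rank∈ with ∈-map⁻ ∣_∣ rank∈
    ...   | S , S∈ , eq = S , proj₂ (∈-filter⁻ (independentRows? F A) {xs = subsets m} S∈) , sym eq

-- Cuts and scaling

board-ext : {σ τ : Board m n} → (∀ i j → (i , j) ∈ᴮ σ ⇔ (i , j) ∈ᴮ τ) → σ ≡ τ
board-ext eq = vec-ext λ i → Subset.⊆-antisym (λ {j} → to (eq i j)) (λ {j} → from (eq i j))

infix 4 _≟ᴮ_

_≟ᴮ_ : DecidableEquality (Board m n)
_≟ᴮ_ = Vec.≡-dec (Vec.≡-dec Bool._≟_)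

-- In a list of cells satisfying Forest, each cell is separated from all the later ones by a
-- cut (R , C) of the vertices of the complete bipartite graph; the list is thus a forest.
data Forest {m n : ℕ} : List (Cell m n) → Set where
  []  : Forest []
  cut : ∀ {i j es} (R : Fin m → Bool) (C : Fin n → Bool) → R i ≢ C j →
        All (λ (i′ , j′) → R i′ ≡ C j′) es → Forest es → Forest ((i , j) ∷ es)

module Scaling {q : ℕ} (F : FiniteField q) where

  open FiniteField F
  open LinearAlgebra F public
  private
    module R = CommutativeRing commutativeRing
    module Σ = SemiringSum R.semiring
    module *P = CommutativeSemigroupProperties R.*-commutativeSemigroup
  open ≡-Reasoning

  elements-unique : Unique elements
  elements-unique = Unique.tabulate⁺ (Injection.injective (↔⇒↣ (↔-sym enumeration)))

  matrices-complete : ∀ m n → Complete (matrices F m n)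
  matrices-complete m n = vectors-complete (vectors-complete elements-complete n) m

  matrices-unique : ∀ m n → Unique (matrices F m n)
  matrices-unique m n = vectors-unique (vectors-unique elements-unique n) m

  nonzero? : Decidable (_≢ 0#)
  nonzero? x = ¬? (x ≟ 0#)

  nonzeros : List Carrier
  nonzeros = filter nonzero? elements

  -- This identifies `length nonzeros` with the q - 1 of the theorem; the form with `suc` avoids
  -- truncated subtraction.
  suc-length-nonzeros : suc (length nonzeros) ≡ q
  suc-length-nonzeros = trans
    (length-≡ {xs = 0# ∷ nonzeros} id id
      (All.tabulate (λ x∈ 0≡x → proj₂ (∈-filter⁻ nonzero? {xs = elements} x∈) (sym 0≡x))
        ∷ Unique.filter⁺ nonzero? elements-unique)
      elements-unique (λ _ → elements-complete _) back (λ _ → refl) (λ _ → refl))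
    (length-tabulate (Inverse.from enumeration))
    where
    back : ∀ {x} → x ∈ˡ elements → x ∈ˡ 0# ∷ nonzeros
    back {x} _ with x ≟ 0#
    ... | yes x≡0 = here x≡0
    ... | no  x≢0 = there (∈-filter⁺ nonzero? (elements-complete x) x≢0)

  matrix-ext : (A A′ : Matrix F m n) → (∀ i j → entry F A i j ≡ entry F A′ i j) → A ≡ A′
  matrix-ext A A′ eq = vec-ext (λ i → vec-ext (eq i))

  matrix : (Fin m → Fin n → Carrier) → Matrix F m n
  matrix f = Vec.tabulate (λ i → Vec.tabulate (f i))

  entry-matrix : (f : Fin m → Fin n → Carrier) → ∀ i j → entry F (matrix f) i j ≡ f i j
  entry-matrix f i j = trans (cong (λ r → lookup r j) (lookup∘tabulate _ i)) (lookup∘tabulate (f i) j)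

  support : Matrix F m n → Board m n
  support A = Vec.tabulate (λ i → subsetOf (λ j → nonzero? (entry F A i j)))

  ∈-support : (A : Matrix F m n) → ∀ i j → (i , j) ∈ᴮ support A ⇔ entry F A i j ≢ 0#
  ∈-support A i j = subst (λ S → j ∈ S ⇔ entry F A i j ≢ 0#)
    (sym (lookup∘tabulate (λ i → subsetOf (λ j → nonzero? (entry F A i j))) i))
    (∈-subsetOf (λ j → nonzero? (entry F A i j)) j)

  support-≡ : (A A′ : Matrix F m n) → (∀ i j → entry F A i j ≡ 0# ⇔ entry F A′ i j ≡ 0#) →
              support A ≡ support A′
  support-≡ A A′ eq = board-ext λ i j → mk⇔
    (λ e → from (∈-support A′ i j) (to (∈-support A i j) e ∘ from (eq i j)))
    (λ e → from (∈-support A i j) (to (∈-support A′ i j) e ∘ to (eq i j)))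

  scale : (Fin m → Carrier) → (Fin n → Carrier) → Matrix F m n → Matrix F m n
  scale u v A = matrix (λ i j → u i *ᶠ entry F A i j *ᶠ v j)

  entry-scale : ∀ (u : Fin m → Carrier) (v : Fin n → Carrier) A i j →
                entry F (scale u v A) i j ≡ u i *ᶠ entry F A i j *ᶠ v j
  entry-scale u v A = entry-matrix _

  scale-inverse : ∀ {u u′ : Fin m → Carrier} {v v′ : Fin n → Carrier} →
                  (∀ i → u i *ᶠ u′ i ≡ 1#) → (∀ j → v j *ᶠ v′ j ≡ 1#) →
                  ∀ A → scale u v (scale u′ v′ A) ≡ A
  scale-inverse {u = u} {u′} {v} {v′} uu′ vv′ A = matrix-ext _ A λ i j → begin
    entry F (scale u v (scale u′ v′ A)) i j
      ≡⟨ entry-scale u v (scale u′ v′ A) i j ⟩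
    u i *ᶠ entry F (scale u′ v′ A) i j *ᶠ v j
      ≡⟨ cong (λ z → u i *ᶠ z *ᶠ v j) (entry-scale u′ v′ A i j) ⟩
    u i *ᶠ (u′ i *ᶠ entry F A i j *ᶠ v′ j) *ᶠ v j
      ≡⟨ cong (_*ᶠ v j) (sym (R.*-assoc (u i) _ _)) ⟩
    u i *ᶠ (u′ i *ᶠ entry F A i j) *ᶠ v′ j *ᶠ v j
      ≡⟨ R.*-assoc _ (v′ j) (v j) ⟩
    u i *ᶠ (u′ i *ᶠ entry F A i j) *ᶠ (v′ j *ᶠ v j)
      ≡⟨ cong₂ _*ᶠ_ (sym (R.*-assoc (u i) (u′ i) _)) (trans (R.*-comm _ _) (vv′ j)) ⟩
    u i *ᶠ u′ i *ᶠ entry F A i j *ᶠ 1#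
      ≡⟨ R.*-identityʳ _ ⟩
    u i *ᶠ u′ i *ᶠ entry F A i j
      ≡⟨ cong (_*ᶠ entry F A i j) (uu′ i) ⟩
    1# *ᶠ entry F A i j
      ≡⟨ R.*-identityˡ _ ⟩
    entry F A i j ∎

  -- A relation `c` among rows of the scaled matrix becomes the relation with coefficients
  -- `u i *ᶠ lookup c i` among rows of `A`, once column `j` is freed of its factor `v j`. So
  -- independent sets of rows stay independent. The opposite inequality is this one for the inverse
  -- scaling.
  rank-≤-scale : (u : Fin m → Carrier) (v : Fin n → Carrier) → (∀ i → u i ≢ 0#) → (∀ j → v j ≢ 0#) →
                 ∀ A → rank F A ≤ rank F (scale u v A)
  rank-≤-scale {m} u v u≢0 v≢0 A with rank-attained A
  ... | S , ind , ∣S∣≡ = subst (_≤ rank F (scale u v A)) ∣S∣≡ (∣S∣≤rank (scale u v A) S ind′)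
    where
    ind′ : IndependentRows F (scale u v A) S
    ind′ c c∉ cA≡0 i = *≡0⇒ (u≢0 i) (trans (sym (c′≡ i)) (ind c′ c′∉ c′A≡0 i))
      where
      c′ = Vec.tabulate (λ i → u i *ᶠ lookup c i)
      c′≡ : ∀ i → lookup c′ i ≡ u i *ᶠ lookup c i
      c′≡ = lookup∘tabulate _
      c′∉ : ∀ i → i ∉ S → lookup c′ i ≡ 0#
      c′∉ i i∉S = trans (c′≡ i) (trans (cong (u i *ᶠ_) (c∉ i i∉S)) (R.zeroʳ _))
      c′A≡0 : ∀ j → sum (λ i → lookup c′ i *ᶠ entry F A i j) ≡ 0#
      c′A≡0 j = *≡0⇒ (v≢0 j) (begin
        v j *ᶠ sum (λ i → lookup c′ i *ᶠ entry F A i j)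
          ≡⟨ Σ.*-distribˡ-sum (v j) (λ i → lookup c′ i *ᶠ entry F A i j) ⟩
        sum (λ i → v j *ᶠ (lookup c′ i *ᶠ entry F A i j))
          ≡⟨ Σ.sum-cong-≗ (λ i → begin
               v j *ᶠ (lookup c′ i *ᶠ entry F A i j)
                 ≡⟨ cong (λ z → v j *ᶠ (z *ᶠ entry F A i j)) (trans (c′≡ i) (R.*-comm _ _)) ⟩
               v j *ᶠ (lookup c i *ᶠ u i *ᶠ entry F A i j)
                 ≡⟨ R.*-comm _ _ ⟩
               lookup c i *ᶠ u i *ᶠ entry F A i j *ᶠ v j
                 ≡⟨ cong (_*ᶠ v j) (R.*-assoc _ _ _) ⟩
               lookup c i *ᶠ (u i *ᶠ entry F A i j) *ᶠ v j
                 ≡⟨ R.*-assoc _ _ _ ⟩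
               lookup c i *ᶠ (u i *ᶠ entry F A i j *ᶠ v j)
                 ≡⟨ cong (lookup c i *ᶠ_) (sym (entry-scale u v A i j)) ⟩
               lookup c i *ᶠ entry F (scale u v A) i j ∎) ⟩
        sum (λ i → lookup c i *ᶠ entry F (scale u v A) i j)
          ≡⟨ cA≡0 j ⟩
        0# ∎)

  module Cut (R : Fin m → Bool) (C : Fin n → Bool) where

    -- The two scalars are separate parameters, tied only by the equation `x *ᶠ y ≡ 1#` in the
    -- lemmas below; the inverse of `act x y` is then simply `act y x`.
    act : Carrier → Carrier → Matrix F m n → Matrix F m n
    act x y = scale (λ i → if R i then x else 1#) (λ j → if C j then y else 1#)

    private
      if-inverse : ∀ {x y} → x *ᶠ y ≡ 1# → ∀ b → (if b then x else 1#) *ᶠ (if b then y else 1#) ≡ 1#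
      if-inverse xy≡1 true  = xy≡1
      if-inverse xy≡1 false = R.*-identityˡ 1#

      swap : ∀ {x y} → x *ᶠ y ≡ 1# → y *ᶠ x ≡ 1#
      swap xy≡1 = trans (R.*-comm _ _) xy≡1

      unit≢0 : ∀ {x y} → x *ᶠ y ≡ 1# → x ≢ 0#
      unit≢0 xy≡1 refl = 1≢0 (trans (sym xy≡1) (R.zeroˡ _))

      if≢0 : ∀ {x} → x ≢ 0# → ∀ b → (if b then x else 1#) ≢ 0#
      if≢0 x≢0 true  = x≢0
      if≢0 x≢0 false = 1≢0

    act-inverse : ∀ {x y} → x *ᶠ y ≡ 1# → ∀ A → act x y (act y x A) ≡ A
    act-inverse xy≡1 = scale-inverse (if-inverse xy≡1 ∘ R) (if-inverse (swap xy≡1) ∘ C)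

    rank-act : ∀ {x y} → x *ᶠ y ≡ 1# → ∀ A → rank F (act x y A) ≡ rank F A
    rank-act {x} {y} xy≡1 A = ℕ.≤-antisym
      (subst (λ B → rank F (act x y A) ≤ rank F B) (act-inverse (swap xy≡1) A)
             (≤-act (swap xy≡1) (act x y A)))
      (≤-act xy≡1 A)
      where
      ≤-act : ∀ {x y} → x *ᶠ y ≡ 1# → ∀ A → rank F A ≤ rank F (act x y A)
      ≤-act xy≡1 A = rank-≤-scale _ _ (λ i → if≢0 (unit≢0 xy≡1) (R i))
                                      (λ j → if≢0 (unit≢0 (swap xy≡1)) (C j)) A

    support-act : ∀ {x y} → x *ᶠ y ≡ 1# → ∀ A → support (act x y A) ≡ support A
    support-act {x} {y} xy≡1 A = support-≡ (act x y A) A λ i j → mk⇔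
      (λ eq → *≡0⇒ (if≢0 (unit≢0 xy≡1) (R i))
                (*≡0⇒ (if≢0 (unit≢0 (swap xy≡1)) (C j)) (trans (R.*-comm _ _) (trans (sym (entry-scale _ _ A i j)) eq))))
      (λ eq → trans (entry-scale _ _ A i j)
                (trans (cong (λ z → (if R i then x else 1#) *ᶠ z *ᶠ (if C j then y else 1#)) eq)
                       (trans (cong (_*ᶠ (if C j then y else 1#)) (R.zeroʳ _)) (R.zeroˡ _))))

    entry-uncut : ∀ {x y} → x *ᶠ y ≡ 1# → ∀ A i j → R i ≡ C j → entry F (act x y A) i j ≡ entry F A i j
    entry-uncut {x} {y} xy≡1 A i j Ri≡Cj = trans (entry-scale _ _ A i j) (uncut (R i) (C j) Ri≡Cj)
      where
      α = entry F A i j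
      uncut : ∀ b c → b ≡ c → (if b then x else 1#) *ᶠ α *ᶠ (if c then y else 1#) ≡ α
      uncut true  _ refl = begin
        x *ᶠ α *ᶠ y   ≡⟨ *P.xy∙z≈y∙xz x α y ⟩
        α *ᶠ (x *ᶠ y) ≡⟨ cong (α *ᶠ_) xy≡1 ⟩
        α *ᶠ 1#       ≡⟨ R.*-identityʳ α ⟩
        α             ∎
      uncut false _ refl = trans (R.*-identityʳ _) (R.*-identityˡ α)

    entry-cut : ∀ x y A i j → R i ≡ true → C j ≡ false → entry F (act x y A) i j ≡ x *ᶠ entry F A i j
    entry-cut x y A i j Ri Cj = trans (entry-scale _ _ A i j) (trans
      (cong₂ (λ b c → (if b then x else 1#) *ᶠ entry F A i j *ᶠ (if c then y else 1#)) Ri Cj)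
      (R.*-identityʳ _))

  -- Inversion made total by the value 0 at 0, so that the maps `f` and `g` of `normalise` take no
  -- proofs as arguments.
  recip : Carrier → Carrier
  recip x with x ≟ 0#
  ... | yes _  = 0#
  ... | no x≢0 = inv x≢0

  *-recip : ∀ {x} → x ≢ 0# → x *ᶠ recip x ≡ 1#
  *-recip {x} x≢0 with x ≟ 0#
  ... | yes x≡0 = contradiction x≡0 x≢0
  ... | no x≢0′ = *-inv x≢0′

  module Count {m n : ℕ} (d : ℕ) (σ : Board m n) where

    record Normal (es : List (Cell m n)) (A : Matrix F m n) : Set where
      constructor normal
      field
        rank≡    : rank F A ≡ d
        support≡ : support A ≡ σ
        ones     : All (λ (i , j) → entry F A i j ≡ 1#) es

    open Normal public

    normal? : ∀ es → Decidable (Normal es)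
    normal? es A = map′ (λ (r , s , o) → normal r s o) (λ ν → rank≡ ν , support≡ ν , ones ν)
      ((rank F A ℕ.≟ d) ×-dec ((support A ≟ᴮ σ) ×-dec All.all? (λ (i , j) → entry F A i j ≟ 1#) es))

    abstract

      normals : List (Cell m n) → List (Matrix F m n)
      normals es = filter (normal? es) (matrices F m n)

      normals-unique : ∀ es → Unique (normals es)
      normals-unique es = Unique.filter⁺ (normal? es) (matrices-unique m n)

      normal⇒∈ : ∀ {es A} → Normal es A → A ∈ˡ normals es
      normal⇒∈ {es} {A} = ∈-filter⁺ (normal? es) (matrices-complete m n A)

      ∈⇒normal : ∀ {es A} → A ∈ˡ normals es → Normal es A
      ∈⇒normal {es} = proj₂ ∘ ∈-filter⁻ (normal? es) {xs = matrices F m n}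

    -- A matrix corresponds to the pair of its entry at `(i , j)` and the matrix rescaled along the
    -- cut so that this entry becomes 1. Scaling by the stored entry recovers it. Cells of `es` have
    -- both ends on one side of the cut and keep their value 1.
    normalise : ∀ {i j es} (R : Fin m → Bool) (C : Fin n → Bool) → R i ≡ true → C j ≡ false →
                All (λ (i′ , j′) → R i′ ≡ C j′) es → (i , j) ∈ᴮ σ →
                length (normals es) ≡ length nonzeros ℕ.* length (normals ((i , j) ∷ es))
    normalise {i} {j} {es} R C Ri Cj uncut e∈σ = trans
      (length-≡ f g (normals-unique es)
        (Unique.cartesianProduct⁺ (Unique.filter⁺ nonzero? elements-unique) (normals-unique (e ∷ es)))
        f-into (λ {y} → g-into {y})
        (λ A∈ → act-inverse (*-recip (entry≢0 (∈⇒normal A∈))) _)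
        fg)
      (length-cartesianProduct nonzeros (normals (e ∷ es)))
      where
      open Cut R C
      e = (i , j)
      f : Matrix F m n → Carrier × Matrix F m n
      f A = entry F A i j , act (recip (entry F A i j)) (entry F A i j) A
      g : Carrier × Matrix F m n → Matrix F m n
      g (x , A) = act x (recip x) A

      entry≢0 : ∀ {A} → Normal es A → entry F A i j ≢ 0#
      entry≢0 {A} ν = to (∈-support A i j) (subst ((i , j) ∈ᴮ_) (sym (support≡ ν)) e∈σ)

      swap : ∀ {x y} → x *ᶠ y ≡ 1# → y *ᶠ x ≡ 1#
      swap xy≡1 = trans (R.*-comm _ _) xy≡1

      act-normal : ∀ {x y A} → x *ᶠ y ≡ 1# → Normal es A → Normal es (act x y A)
      act-normal {A = A} xy≡1 ν = normal
        (trans (rank-act xy≡1 A) (rank≡ ν))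
        (trans (support-act xy≡1 A) (support≡ ν))
        (All.zipWith (λ { {i , j} (unc , one) → trans (entry-uncut xy≡1 A i j unc) one }) (uncut , ones ν))

      f-into : ∀ {A} → A ∈ˡ normals es → f A ∈ˡ cartesianProduct nonzeros (normals (e ∷ es))
      f-into {A} A∈ = ∈-cartesianProduct⁺
        (∈-filter⁺ nonzero? (elements-complete _) a≢0)
        (normal⇒∈ (normal (rank≡ ν) (support≡ ν) (trans (entry-cut _ _ A i j Ri Cj) (swap (*-recip a≢0)) ∷ ones ν)))
        where
        a≢0 = entry≢0 (∈⇒normal A∈)
        ν   = act-normal (swap (*-recip a≢0)) (∈⇒normal A∈)

      ∈-product : ∀ {x A} → (x , A) ∈ˡ cartesianProduct nonzeros (normals (e ∷ es)) →
                  x ≢ 0# × Normal (e ∷ es) A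
      ∈-product xA∈ with ∈-cartesianProduct⁻ nonzeros (normals (e ∷ es)) xA∈
      ... | x∈ , A∈ = proj₂ (∈-filter⁻ nonzero? {xs = elements} x∈) , ∈⇒normal A∈

      g-into : ∀ {xA} → xA ∈ˡ cartesianProduct nonzeros (normals (e ∷ es)) → g xA ∈ˡ normals es
      g-into {x , A} xA∈ with ∈-product xA∈
      ... | x≢0 , normal r s (_ ∷ o) = normal⇒∈ (act-normal {A = A} (*-recip x≢0) (normal r s o))

      fg : ∀ {xA} → xA ∈ˡ cartesianProduct nonzeros (normals (e ∷ es)) → f (g xA) ≡ xA
      fg {x , A} xA∈ with ∈-product xA∈
      ... | x≢0 , normal _ _ (one ∷ _) = cong₂ _,_ entry≡x
        (trans (cong (λ a → act (recip a) a (g (x , A))) entry≡x) (act-inverse (swap (*-recip x≢0)) A))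
        where
        entry≡x : entry F (g (x , A)) i j ≡ x
        entry≡x = trans (entry-cut _ _ A i j Ri Cj) (trans (cong (x *ᶠ_) one) (R.*-identityʳ x))

    -- The tail is normalised before the head: only the cut of the head is known to leave all the
    -- other cells alone.
    normalise-forest : ∀ {es} → Forest es → All (_∈ᴮ σ) es →
                       length (normals []) ≡ length nonzeros ℕ.^ length es ℕ.* length (normals es)
    normalise-forest []                                      _           = sym (ℕ.+-identityʳ _)
    normalise-forest (cut {i} {j} {es} R C Ri≢Cj uncut forest) (e∈σ ∷ es⊆σ) = begin
      length (normals [])
        ≡⟨ normalise-forest forest es⊆σ ⟩
      w ℕ.^ length es ℕ.* length (normals es)
        ≡⟨ cong (w ℕ.^ length es ℕ.*_) (step (R i) (C j) refl refl Ri≢Cj) ⟩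
      w ℕ.^ length es ℕ.* (w ℕ.* length (normals ((i , j) ∷ es)))
        ≡⟨ sym (ℕ.*-assoc (w ℕ.^ length es) w _) ⟩
      w ℕ.^ length es ℕ.* w ℕ.* length (normals ((i , j) ∷ es))
        ≡⟨ cong (ℕ._* length (normals ((i , j) ∷ es))) (ℕ.*-comm (w ℕ.^ length es) w) ⟩
      w ℕ.^ length ((i , j) ∷ es) ℕ.* length (normals ((i , j) ∷ es)) ∎
      where
      w = length nonzeros
      step : ∀ b c → R i ≡ b → C j ≡ c → b ≢ c → length (normals es) ≡ w ℕ.* length (normals ((i , j) ∷ es))
      step true  true  _  _  b≢c = contradiction refl b≢c
      step false false _  _  b≢c = contradiction refl b≢c
      step true  false Ri Cj _   = normalise R C Ri Cj uncut e∈σ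
      -- Complementing the cut on rows and columns reverses its orientation and leaves uncut cells
      -- uncut.
      step false true  Ri Cj _   = normalise (not ∘ R) (not ∘ C) (cong not Ri) (cong not Cj)
                                             (All.map (cong not) uncut) e∈σ

-- Isomorphism with F ⊔ Eⁱ ⊔ R

∈ᴮ⇔lookup : (B : Board m n) → ∀ x y → (x , y) ∈ᴮ B ⇔ lookup (lookup B x) y ≡ inside
∈ᴮ⇔lookup B x y = mk⇔ []=⇒lookup (lookup⇒[]= y (lookup B x))

-- This is `E^ i` with vertex sets that are `Fin i` by definition, whereas `rows (E^ i)` equals `i`
-- only by induction.
diagonal : ∀ i → Board i i
diagonal zero    = []
diagonal (suc i) = (inside ∷ ⊥) ∷ Vec.map (outside ∷_) (diagonal i)

E^≡diagonal : ∀ i → E^ i ≡ biGraph (diagonal i)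
E^≡diagonal zero    = refl
E^≡diagonal (suc i) = cong (E ⊔ᴳ_) (E^≡diagonal i)

∈-diagonal : ∀ {i} (s t : Fin i) → (s , t) ∈ᴮ diagonal i ⇔ s ≡ t
∈-diagonal s t = mk⇔ (sound s t ∘ to (∈ᴮ⇔lookup (diagonal _) s t))
  λ { refl → from (∈ᴮ⇔lookup (diagonal _) s s) (complete s) }
  where
  lookup-suc : ∀ {i} (s : Fin i) t → lookup (lookup (diagonal (suc i)) (suc s)) t ≡
                                     lookup (outside ∷ lookup (diagonal i) s) t
  lookup-suc s t = cong (λ v → lookup v t) (lookup-map s (outside ∷_) (diagonal _))
  sound : ∀ {i} (s t : Fin i) → lookup (lookup (diagonal i) s) t ≡ inside → s ≡ t
  sound zero    zero    _  = refl
  sound {suc i} zero (suc t) eq = contradiction (trans (sym eq) (lookup-replicate t outside)) λ ()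
  sound (suc s) zero    eq = contradiction (trans (sym eq) (lookup-suc s zero)) λ ()
  sound (suc s) (suc t) eq = cong suc (sound s t (trans (sym (lookup-suc s (suc t))) eq))
  complete : ∀ {i} (s : Fin i) → lookup (lookup (diagonal i) s) s ≡ inside
  complete zero    = refl
  complete (suc s) = trans (lookup-suc s (suc s)) (complete s)

module _ (X Y : BiGraph) where

  private
    XY = edges (X ⊔ᴳ Y)

    row-ˡ : ∀ s → lookup XY (s ↑ˡ rows Y) ≡ lookup (edges X) s ++ ⊥ {cols Y}
    row-ˡ s = trans (lookup-++ˡ (Vec.map (_++ ⊥) (edges X)) _ s) (lookup-map s _ (edges X))

    row-ʳ : ∀ s → lookup XY (rows X ↑ʳ s) ≡ ⊥ {cols X} ++ lookup (edges Y) s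
    row-ʳ s = trans (lookup-++ʳ (Vec.map (_++ ⊥) (edges X)) _ s) (lookup-map s _ (edges Y))

    by-lookup : ∀ {m n m′ n′} (B : Board m n) (B′ : Board m′ n′) {x y x′ y′} →
                lookup (lookup B x) y ≡ lookup (lookup B′ x′) y′ → (x , y) ∈ᴮ B ⇔ (x′ , y′) ∈ᴮ B′
    by-lookup B B′ eq = mk⇔
      (λ e → from (∈ᴮ⇔lookup B′ _ _) (trans (sym eq) (to (∈ᴮ⇔lookup B _ _) e)))
      (λ e → from (∈ᴮ⇔lookup B _ _) (trans eq (to (∈ᴮ⇔lookup B′ _ _) e)))

    absent : ∀ {m n} (B : Board m n) {x y} → lookup (lookup B x) y ≡ outside → ¬ (x , y) ∈ᴮ B
    absent B eq e = contradiction (trans (sym eq) (to (∈ᴮ⇔lookup B _ _) e)) λ ()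

  ∈-⊔ˡˡ : ∀ s t → (s ↑ˡ rows Y , t ↑ˡ cols Y) ∈ᴮ XY ⇔ (s , t) ∈ᴮ edges X
  ∈-⊔ˡˡ s t = by-lookup XY (edges X)
    (trans (cong (λ v → lookup v (t ↑ˡ cols Y)) (row-ˡ s)) (lookup-++ˡ (lookup (edges X) s) ⊥ t))

  ∉-⊔ˡʳ : ∀ s t → ¬ (s ↑ˡ rows Y , cols X ↑ʳ t) ∈ᴮ XY
  ∉-⊔ˡʳ s t = absent XY (trans (cong (λ v → lookup v (cols X ↑ʳ t)) (row-ˡ s))
    (trans (lookup-++ʳ (lookup (edges X) s) ⊥ t) (lookup-replicate t outside)))

  ∉-⊔ʳˡ : ∀ s t → ¬ (rows X ↑ʳ s , t ↑ˡ cols Y) ∈ᴮ XY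
  ∉-⊔ʳˡ s t = absent XY (trans (cong (λ v → lookup v (t ↑ˡ cols Y)) (row-ʳ s))
    (trans (lookup-++ˡ ⊥ _ t) (lookup-replicate t outside)))

  ∈-⊔ʳʳ : ∀ s t → (rows X ↑ʳ s , cols X ↑ʳ t) ∈ᴮ XY ⇔ (s , t) ∈ᴮ edges Y
  ∈-⊔ʳʳ s t = by-lookup XY (edges Y)
    (trans (cong (λ v → lookup v (cols X ↑ʳ t)) (row-ʳ s)) (lookup-++ʳ (⊥ {cols X}) (lookup (edges Y) s) t))

-- Adjacency in F ⊔ Eⁱ, with the vertices of Eⁱ in the second summands.
Adj : (F : BiGraph) (i : ℕ) → Fin (rows F) ⊎ Fin i → Fin (cols F) ⊎ Fin i → Set
Adj F i (inj₁ s) (inj₁ t) = (s , t) ∈ᴮ edges F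
Adj F i (inj₂ s) (inj₂ t) = s ≡ t
Adj F i _        _        = Empty

-- An embedding of the part with `F` and the copies of `E` alone. Isolated vertices are implicit:
-- `complete` places every cell of `σ` in the image, so vertices outside have no edges, and no
-- subtraction of vertex numbers enters.
record Copy (F : BiGraph) (i : ℕ) (σ : Board m n) : Set where
  field
    ρ          : Fin (rows F) ⊎ Fin i → Fin m
    κ          : Fin (cols F) ⊎ Fin i → Fin n
    ρ-inj      : Injective _≡_ _≡_ ρ
    κ-inj      : Injective _≡_ _≡_ κ
    sound      : ∀ s t → Adj F i s t → (ρ s , κ t) ∈ᴮ σ
    complete   : ∀ x y → (x , y) ∈ᴮ σ → ∃₂ λ s t → ρ s ≡ x × κ t ≡ y × Adj F i s t

-- Reassociated so that the vertices a `Copy` speaks about form one summand and the isolated ones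
-- the other.
vertices↔ : ∀ a i r → Fin (a ℕ.+ (i ℕ.+ r)) ↔ ((Fin a ⊎ Fin i) ⊎ Fin r)
vertices↔ a i r = ↔-trans Fin.+↔⊎ (↔-trans (↔-refl ⊎-↔ Fin.+↔⊎) (↔-sym (⊎-assoc 0ℓ (Fin a) (Fin i) (Fin r))))

Adj⁺ : (F : BiGraph) (i r c : ℕ) → (Fin (rows F) ⊎ Fin i) ⊎ Fin r → (Fin (cols F) ⊎ Fin i) ⊎ Fin c → Set
Adj⁺ F i r c (inj₁ s) (inj₁ t) = Adj F i s t
Adj⁺ F i r c _        _        = Empty

withDiagonal : BiGraph → (i r c : ℕ) → BiGraph
withDiagonal F i r c = F ⊔ᴳ biGraph (diagonal i) ⊔ᴳ edgeless r c

∉-edgeless : ∀ {r c} s t → ¬ (s , t) ∈ᴮ edges (edgeless r c)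
∉-edgeless {r} {c} s t e = contradiction
  (trans (sym (trans (cong (λ v → lookup v t) (lookup-replicate s (⊥ {c}))) (lookup-replicate t outside)))
         (to (∈ᴮ⇔lookup (edges (edgeless r c)) s t) e)) λ ()

∈-withDiagonal : ∀ F i r c s t →
  (Inverse.from (vertices↔ (rows F) i r) s , Inverse.from (vertices↔ (cols F) i c) t) ∈ᴮ edges (withDiagonal F i r c)
  ⇔ Adj⁺ F i r c s t
∈-withDiagonal F i r c = go
  where
  D = biGraph (diagonal i)
  O = edgeless r c
  none : ∀ {P : Set} → ¬ P → P ⇔ Empty
  none ¬p = mk⇔ ¬p λ ()
  _∙_ : ∀ {P Q R : Set} → P ⇔ Q → Q ⇔ R → P ⇔ R
  p ∙ q = mk⇔ (to q ∘ to p) (from p ∘ from q)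
  go : ∀ s t → (Inverse.from (vertices↔ (rows F) i r) s , Inverse.from (vertices↔ (cols F) i c) t)
               ∈ᴮ edges (withDiagonal F i r c) ⇔ Adj⁺ F i r c s t
  go (inj₁ (inj₁ s)) (inj₁ (inj₁ t)) = ∈-⊔ˡˡ F (D ⊔ᴳ O) s t
  go (inj₁ (inj₁ s)) (inj₁ (inj₂ t)) = none (∉-⊔ˡʳ F (D ⊔ᴳ O) s _)
  go (inj₁ (inj₁ s)) (inj₂ t)        = none (∉-⊔ˡʳ F (D ⊔ᴳ O) s _)
  go (inj₁ (inj₂ s)) (inj₁ (inj₁ t)) = none (∉-⊔ʳˡ F (D ⊔ᴳ O) _ t)
  go (inj₁ (inj₂ s)) (inj₁ (inj₂ t)) = ∈-⊔ʳʳ F (D ⊔ᴳ O) _ _ ∙ (∈-⊔ˡˡ D O s t ∙ ∈-diagonal s t)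
  go (inj₁ (inj₂ s)) (inj₂ t)        = none (∉-⊔ˡʳ D O s t ∘ to (∈-⊔ʳʳ F (D ⊔ᴳ O) _ _))
  go (inj₂ s)        (inj₁ (inj₁ t)) = none (∉-⊔ʳˡ F (D ⊔ᴳ O) _ t)
  go (inj₂ s)        (inj₁ (inj₂ t)) = none (∉-⊔ʳˡ D O s t ∘ to (∈-⊔ʳʳ F (D ⊔ᴳ O) _ _))
  go (inj₂ s)        (inj₂ t)        = none (∉-edgeless s t ∘ to (∈-⊔ʳʳ D O s t) ∘ to (∈-⊔ʳʳ F (D ⊔ᴳ O) _ _))

inverse-injective : {A B : Set} (f : A ↔ B) → Injective _≡_ _≡_ (Inverse.from f)
inverse-injective f = Injection.injective (↔⇒↣ (↔-sym f))

≅⇒Copy : ∀ {F i r c} {σ : Board m n} → G σ ≅ withDiagonal F i r c → Copy F i σ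
≅⇒Copy {m = m} {n = n} {F = F} {i} {r} {c} {σ} (π , ψ , match) = record
  { ρ        = ρ
  ; κ        = κ
  ; ρ-inj    = inj₁-injective ∘ inverse-injective (vertices↔ (rows F) i r) ∘ inverse-injective π
  ; κ-inj    = inj₁-injective ∘ inverse-injective (vertices↔ (cols F) i c) ∘ inverse-injective ψ
  ; sound    = λ s t adj → from (match (ρ s) (κ t))
      (subst₂ (λ x y → (x , y) ∈ᴮ Y) (sym (Inverse.strictlyInverseˡ π _)) (sym (Inverse.strictlyInverseˡ ψ _))
        (from (∈-withDiagonal F i r c (inj₁ s) (inj₁ t)) adj))
  ; complete = λ x y e → complete x y (Inverse.to v (π ⟨$⟩ʳ x)) (Inverse.to v′ (ψ ⟨$⟩ʳ y))
      (sym (Inverse.strictlyInverseʳ v _)) (sym (Inverse.strictlyInverseʳ v′ _)) (to (match x y) e)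
  }
  where
  Y  = edges (withDiagonal F i r c)
  v  = vertices↔ (rows F) i r
  v′ = vertices↔ (cols F) i c
  ρ : Fin (rows F) ⊎ Fin i → Fin m
  ρ s = π ⟨$⟩ˡ Inverse.from v (inj₁ s)
  κ : Fin (cols F) ⊎ Fin i → Fin n
  κ t = ψ ⟨$⟩ˡ Inverse.from v′ (inj₁ t)
  complete : ∀ x y s t → π ⟨$⟩ʳ x ≡ Inverse.from v s → ψ ⟨$⟩ʳ y ≡ Inverse.from v′ t →
             (π ⟨$⟩ʳ x , ψ ⟨$⟩ʳ y) ∈ᴮ Y → ∃₂ λ s t → ρ s ≡ x × κ t ≡ y × Adj F i s t
  complete x y s t eqs eqt e = present s t eqs eqt
    (to (∈-withDiagonal F i r c s t) (subst₂ (λ x y → (x , y) ∈ᴮ Y) eqs eqt e))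
    where
    present : ∀ s t → π ⟨$⟩ʳ x ≡ Inverse.from v s → ψ ⟨$⟩ʳ y ≡ Inverse.from v′ t →
              Adj⁺ F i r c s t → ∃₂ λ s t → ρ s ≡ x × κ t ≡ y × Adj F i s t
    present (inj₁ s) (inj₁ t) eqs eqt adj = s , t
      , trans (cong (π ⟨$⟩ˡ_) (sym eqs)) (Inverse.strictlyInverseʳ π x)
      , trans (cong (ψ ⟨$⟩ˡ_) (sym eqt)) (Inverse.strictlyInverseʳ ψ y)
      , adj

record Extension {A : Set} (k : ℕ) (f : A → Fin m) : Set where
  field
    rest      : ℕ
    bijection : Fin m ↔ (A ⊎ Fin rest)
    extends   : ∀ s → Inverse.from bijection (inj₁ s) ≡ f s
    rest≡     : rest ≡ m ∸ k

-- The complement of the image is the second summand. Comparing cardinalities gives m as `k` plus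
-- its size, so the truncated subtraction in `padded` is a true one here.
extension : {A : Set} → A ↔ Fin k → (f : A → Fin m) → Injective _≡_ _≡_ f → Extension k f
extension {k} {m} {A} A↔k f f-inj = record
  { rest = ∣ S ∣ ; bijection = bij ; extends = λ _ → refl
  ; rest≡ = trans (sym (ℕ.m+n∸m≡n k ∣ S ∣)) (cong (_∸ k)
      (sym (↔⇒≡ (↔-trans bij (↔-trans (A↔k ⊎-↔ ↔-refl) (↔-sym Fin.+↔⊎))))))
  }
  where
  g : Fin k → Fin m
  g = f ∘ Inverse.from A↔k
  outside? = λ x → ¬? (image? g x)
  S = subsetOf outside?

  into : A ⊎ Fin ∣ S ∣ → Fin m
  into (inj₁ s) = f s
  into (inj₂ t) = enum S t

  f∉S : ∀ s → f s ∉ S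
  f∉S s fs∈S = to (∈-subsetOf outside? (f s)) fs∈S
    (Inverse.to A↔k s , cong f (Inverse.strictlyInverseʳ A↔k s))

  into-inj : Injective _≡_ _≡_ into
  into-inj {inj₁ s} {inj₁ t} eq = cong inj₁ (f-inj eq)
  into-inj {inj₁ s} {inj₂ t} eq = contradiction (subst (_∈ S) (sym eq) (enum-∈ S t)) (f∉S s)
  into-inj {inj₂ s} {inj₁ t} eq = contradiction (subst (_∈ S) eq (enum-∈ S s)) (f∉S t)
  into-inj {inj₂ s} {inj₂ t} eq = cong inj₂ (enum-injective S eq)

  into-surj : ∀ x → ∃ λ s → into s ≡ x
  into-surj x with image? g x
  ... | yes (t , gt≡x) = inj₁ (Inverse.from A↔k t) , gt≡x
  ... | no  x∉        = let (t , eq) = enum-surjective S (from (∈-subsetOf outside? x) x∉) in inj₂ t , eq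

  bij : Fin m ↔ (A ⊎ Fin ∣ S ∣)
  bij = mk↔ₛ′ (proj₁ ∘ into-surj) into (λ s → into-inj (proj₂ (into-surj (into s)))) (proj₂ ∘ into-surj)

-- Rows and columns missed by the copy become the edgeless part; by `complete` no cell of `σ` meets
-- them.
Copy⇒≅ : ∀ {F i} {σ : Board m n} → Copy F i σ →
         G σ ≅ withDiagonal F i (m ∸ (rows F ℕ.+ i)) (n ∸ (cols F ℕ.+ i))
Copy⇒≅ {m = m} {n = n} {F = F} {i} {σ} C = subst₂ (λ r c → G σ ≅ withDiagonal F i r c) Xρ.rest≡ Xκ.rest≡ iso
  where
  open Copy C
  module Xρ = Extension (extension (↔-sym Fin.+↔⊎) ρ ρ-inj)
  module Xκ = Extension (extension (↔-sym Fin.+↔⊎) κ κ-inj)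
  v  = vertices↔ (rows F) i Xρ.rest
  v′ = vertices↔ (cols F) i Xκ.rest
  adj⇔ : ∀ s t → (Inverse.from Xρ.bijection s , Inverse.from Xκ.bijection t) ∈ᴮ σ ⇔ Adj⁺ F i Xρ.rest Xκ.rest s t
  adj⇔ s t = mk⇔ (λ e → adj s t (complete _ _ e)) (cell s t)
    where
    adj : ∀ s t → (∃₂ λ s′ t′ → ρ s′ ≡ Inverse.from Xρ.bijection s × κ t′ ≡ Inverse.from Xκ.bijection t × Adj F i s′ t′) →
          Adj⁺ F i Xρ.rest Xκ.rest s t
    adj s t (s′ , t′ , eqs , eqt , a)
      with refl ← inverse-injective Xρ.bijection {inj₁ s′} {s} (trans (Xρ.extends s′) eqs)
         | refl ← inverse-injective Xκ.bijection {inj₁ t′} {t} (trans (Xκ.extends t′) eqt) = a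
    cell : ∀ s t → Adj⁺ F i Xρ.rest Xκ.rest s t → (Inverse.from Xρ.bijection s , Inverse.from Xκ.bijection t) ∈ᴮ σ
    cell (inj₁ s) (inj₁ t) a = subst₂ (λ x y → (x , y) ∈ᴮ σ) (sym (Xρ.extends s)) (sym (Xκ.extends t)) (sound s t a)
  iso : G σ ≅ withDiagonal F i Xρ.rest Xκ.rest
  iso = ↔-trans Xρ.bijection (↔-sym v) , ↔-trans Xκ.bijection (↔-sym v′) , λ x y → mk⇔
    (λ e → from (∈-withDiagonal F i _ _ (Inverse.to Xρ.bijection x) (Inverse.to Xκ.bijection y))
      (to (adj⇔ (Inverse.to Xρ.bijection x) (Inverse.to Xκ.bijection y)) (subst₂ (λ x y → (x , y) ∈ᴮ σ) (sym (Inverse.strictlyInverseʳ Xρ.bijection x))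
                                                     (sym (Inverse.strictlyInverseʳ Xκ.bijection y)) e)))
    (λ e → subst₂ (λ x y → (x , y) ∈ᴮ σ) (Inverse.strictlyInverseʳ Xρ.bijection x)
                                          (Inverse.strictlyInverseʳ Xκ.bijection y)
      (from (adj⇔ (Inverse.to Xρ.bijection x) (Inverse.to Xκ.bijection y)) (to (∈-withDiagonal F i _ _ (Inverse.to Xρ.bijection x) (Inverse.to Xκ.bijection y)) e)))

≅padded⇔Copy : ∀ F i (σ : Board m n) → G σ ≅ padded m n F i ⇔ Copy F i σ
≅padded⇔Copy {m} {n} F i σ = mk⇔
  (≅⇒Copy ∘ subst (λ X → G σ ≅ F ⊔ᴳ X ⊔ᴳ O) (E^≡diagonal i))
  (subst (λ X → G σ ≅ F ⊔ᴳ X ⊔ᴳ O) (sym (E^≡diagonal i)) ∘ Copy⇒≅)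
  where
  O = edgeless (m ∸ (rows F ℕ.+ i)) (n ∸ (cols F ℕ.+ i))

-- Edges outside a maximum matching

-- With this graph in the role of `F`, rook placements are copies as well, and all five coefficients
-- of the theorem are treated alike.
∅ : BiGraph
∅ = edgeless 0 0

record Matching (d : ℕ) (σ : Board m n) : Set where
  field
    row     : Fin d → Fin m
    col     : Fin d → Fin n
    row-inj : Injective _≡_ _≡_ row
    col-inj : Injective _≡_ _≡_ col
    edge    : ∀ t → (row t , col t) ∈ᴮ σ

  cells : List (Cell m n)
  cells = List.tabulate (λ t → row t , col t)

  Matched : Fin m → Fin n → Set
  Matched x y = ∃ λ t → row t ≡ x × col t ≡ y

  matched? : ∀ x y → Dec (Matched x y)
  matched? x y = Fin.any? (λ t → (row t Fin.≟ x) ×-dec (col t Fin.≟ y))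

  Extra : Fin m → Fin n → Set
  Extra x y = (x , y) ∈ᴮ σ × ¬ Matched x y

  extra? : ∀ x y → Dec (Extra x y)
  extra? x y = ((x , y) ∈ᴮ? σ) ×-dec ¬? (matched? x y)

  -- The cells become parallel edges when the matching is contracted.
  Parallel : Fin m → Fin n → Fin m → Fin n → Set
  Parallel x y x′ y′ = (x ≡ x′ × y ≡ y′) ⊎ (Matched x y′ × Matched x′ y)

  parallel? : ∀ x y x′ y′ → Dec (Parallel x y x′ y′)
  parallel? x y x′ y′ = ((x Fin.≟ x′) ×-dec (y Fin.≟ y′)) ⊎-dec (matched? x y′ ×-dec matched? x′ y)

-- A single row is one side of a cut: it is left by the cell in that row and not by the later cells,
-- which lie in other rows.
matching-forest : (f : Fin d → Fin m) (g : Fin d → Fin n) → Injective _≡_ _≡_ f →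
                  Forest (List.tabulate (λ t → f t , g t))
matching-forest {zero}  f g f-inj = []
matching-forest {suc d} f g f-inj = cut (λ x → does (x Fin.≟ f zero)) (λ _ → false)
  (λ eq → contradiction (trans (sym (dec-true (f zero Fin.≟ f zero) refl)) eq) λ ())
  (All.tabulate⁺ (λ t → dec-false (f (suc t) Fin.≟ f zero) (λ eq → contradiction (f-inj eq) λ ())))
  (matching-forest (f ∘ suc) (g ∘ suc) (Fin.suc-injective ∘ f-inj))

module _ (M : Matching {m} {n} d σ) where

  open Matching M

  cells⊆ : All (_∈ᴮ σ) cells
  cells⊆ = All.tabulate⁺ edge

  cells-forest : Forest cells
  cells-forest = matching-forest row col row-inj

  private
    true≢false : ∀ {b c} → b ≡ true → c ≡ false → b ≢ c
    true≢false refl refl ()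

    -- The cut around the vertex that row x becomes when the matching is contracted.
    rowᴿ : Fin m → Fin m → Bool
    rowᴿ x x′ = does (x′ Fin.≟ x)
    rowᶜ : Fin m → Fin n → Bool
    rowᶜ x y′ = does (matched? x y′)

    colᴿ : Fin n → Fin m → Bool
    colᴿ y x′ = does (matched? x′ y)
    colᶜ : Fin n → Fin n → Bool
    colᶜ y y′ = does (y′ Fin.≟ y)

    row-uncut : ∀ x → All (λ (x′ , y′) → rowᴿ x x′ ≡ rowᶜ x y′) cells
    row-uncut x = All.tabulate⁺ λ t → does-⇔
      (mk⇔ (λ eq → t , eq , refl)
           (λ (s , rs≡x , cs≡ct) → trans (cong row (sym (col-inj cs≡ct))) rs≡x))
      (row t Fin.≟ x) (matched? x (col t))

    col-uncut : ∀ y → All (λ (x′ , y′) → colᴿ y x′ ≡ colᶜ y y′) cells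
    col-uncut y = All.tabulate⁺ λ t → does-⇔
      (mk⇔ (λ (s , rs≡rt , cs≡y) → trans (cong col (sym (row-inj rs≡rt))) cs≡y)
           (λ eq → t , refl , eq))
      (matched? (row t) y) (col t Fin.≟ y)

  -- The cell is not matched, so `y` is not the partner of `x`, and the cut around the contracted
  -- vertex of `x` separates the two ends.
  extra-forest : ∀ {x y} → Extra x y → Forest ((x , y) ∷ cells)
  extra-forest {x} {y} (_ , ¬xy) = cut (rowᴿ x) (rowᶜ x)
    (true≢false (dec-true (x Fin.≟ x) refl) (dec-false (matched? x y) ¬xy)) (row-uncut x) cells-forest

  -- Two edges that share both ends after contraction are parallel. Otherwise some end of the first
  -- is not an end of the second, and the cut around that contracted vertex meets the first edge
  -- only.
  two-extras-forest : ∀ {x y x′ y′} → Extra x y → Extra x′ y′ → ¬ Parallel x y x′ y′ →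
                      Forest ((x , y) ∷ (x′ , y′) ∷ cells)
  two-extras-forest {x} {y} {x′} {y′} (_ , ¬xy) e′ ¬par
    with x′ Fin.≟ x | matched? x y′ | y′ Fin.≟ y | matched? x′ y
  ... | no x′≢x  | no ¬xy′ | _        | _        = cut (rowᴿ x) (rowᶜ x)
    (true≢false (dec-true (x Fin.≟ x) refl) (dec-false (matched? x y) ¬xy))
    (trans (dec-false (x′ Fin.≟ x) x′≢x) (sym (dec-false (matched? x y′) ¬xy′)) ∷ row-uncut x)
    (extra-forest e′)
  ... | _        | _       | no y′≢y  | no ¬x′y  = cut (colᴿ y) (colᶜ y)
    (true≢false (dec-true (y Fin.≟ y) refl) (dec-false (matched? x y) ¬xy) ∘ sym)
    (trans (dec-false (matched? x′ y) ¬x′y) (sym (dec-false (y′ Fin.≟ y) y′≢y)) ∷ col-uncut y)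
    (extra-forest e′)
  ... | yes refl | _       | yes refl | _        = contradiction (inj₁ (refl , refl)) ¬par
  ... | yes refl | _       | _        | yes xy   = contradiction xy ¬xy
  ... | _        | yes xy  | yes refl | _        = contradiction xy ¬xy
  ... | _        | yes xy′ | _        | yes x′y  = contradiction (inj₂ (xy′ , x′y)) ¬par

-- A renumbering of the matching that sets apart the `a` edges which are to lie in `F`; the
-- remaining `i` edges become the copies of `E`.
record Selection (a i d : ℕ) : Set where
  field
    select     : Fin a ⊎ Fin i → Fin d
    injective  : Injective _≡_ _≡_ select
    surjective : ∀ t → ∃ λ s → select s ≡ t

select₁ : Fin (suc i) → Selection 1 i (suc i)
select₁ t = record { select = f ; injective = f-inj ; surjective = f-surj }
  where
  f : Fin 1 ⊎ Fin _ → Fin _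
  f (inj₁ _) = t
  f (inj₂ s) = punchIn t s
  f-inj : Injective _≡_ _≡_ f
  f-inj {inj₁ zero} {inj₁ zero} _  = refl
  f-inj {inj₁ _}    {inj₂ s}    eq = contradiction (sym eq) (Fin.punchInᵢ≢i t s)
  f-inj {inj₂ s}    {inj₁ _}    eq = contradiction eq (Fin.punchInᵢ≢i t s)
  f-inj {inj₂ s}    {inj₂ s′}   eq = cong inj₂ (Fin.punchIn-injective t s s′ eq)
  f-surj : ∀ u → ∃ λ s → f s ≡ u
  f-surj u with t Fin.≟ u
  ... | yes t≡u = inj₁ zero , t≡u
  ... | no  t≢u = inj₂ (punchOut t≢u) , Fin.punchIn-punchOut t≢u

-- Once `t` is removed, choosing `t′` among the remaining edges is an instance of `select₁`.
select₂ : (t t′ : Fin (2 ℕ.+ i)) → t ≢ t′ → ∃ λ (S : Selection 2 i (2 ℕ.+ i)) →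
          Selection.select S (inj₁ zero) ≡ t × Selection.select S (inj₁ (suc zero)) ≡ t′
select₂ t t′ t≢t′ = record { select = f ; injective = f-inj ; surjective = f-surj } , refl , Fin.punchIn-punchOut t≢t′
  where
  open Selection (select₁ (punchOut t≢t′)) using () renaming (select to g; injective to g-inj; surjective to g-surj)
  f : Fin 2 ⊎ Fin _ → Fin _
  f (inj₁ zero)    = t
  f (inj₁ (suc u)) = punchIn t (g (inj₁ u))
  f (inj₂ s)       = punchIn t (g (inj₂ s))
  g-inj′ : ∀ s s′ → punchIn t (g s) ≡ punchIn t (g s′) → s ≡ s′
  g-inj′ s s′ eq = g-inj (Fin.punchIn-injective t _ _ eq)
  f-inj : Injective _≡_ _≡_ f
  f-inj {inj₁ zero}    {inj₁ zero}    _  = refl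
  f-inj {inj₁ zero}    {inj₁ (suc _)} eq = contradiction (sym eq) (Fin.punchInᵢ≢i t _)
  f-inj {inj₁ zero}    {inj₂ _}       eq = contradiction (sym eq) (Fin.punchInᵢ≢i t _)
  f-inj {inj₁ (suc _)} {inj₁ zero}    eq = contradiction eq (Fin.punchInᵢ≢i t _)
  f-inj {inj₂ _}       {inj₁ zero}    eq = contradiction eq (Fin.punchInᵢ≢i t _)
  f-inj {inj₁ (suc u)} {inj₁ (suc v)} eq = cong (inj₁ ∘ suc) (inj₁-injective (g-inj′ (inj₁ u) (inj₁ v) eq))
  f-inj {inj₁ (suc u)} {inj₂ v}       eq = contradiction (g-inj′ (inj₁ u) (inj₂ v) eq) λ ()
  f-inj {inj₂ u}       {inj₁ (suc v)} eq = contradiction (g-inj′ (inj₂ u) (inj₁ v) eq) λ ()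
  f-inj {inj₂ u}       {inj₂ v}       eq = cong inj₂ (inj₂-injective (g-inj′ (inj₂ u) (inj₂ v) eq))
  f-surj : ∀ u → ∃ λ s → f s ≡ u
  f-surj u with t Fin.≟ u
  ... | yes t≡u = inj₁ zero , t≡u
  ... | no  t≢u with g-surj (punchOut t≢u)
  ...   | inj₁ v , eq = inj₁ (suc v) , trans (cong (punchIn t) eq) (Fin.punchIn-punchOut t≢u)
  ...   | inj₂ v , eq = inj₂ v , trans (cong (punchIn t) eq) (Fin.punchIn-punchOut t≢u)

data Kind : Set where
  rook zg sg wrg wcg : Kind

graph : Kind → BiGraph
graph rook = ∅
graph zg   = ZG
graph sg   = SG
graph wrg  = WRG
graph wcg  = WCG

matchingNumber : Kind → ℕ
matchingNumber rook = 0
matchingNumber zg   = 2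
matchingNumber sg   = 2
matchingNumber wrg  = 1
matchingNumber wcg  = 1

-- The equation for `d` is the index shift in the theorem: `i` is d, d - 1 or d - 2, and a negative
-- index leaves no `i` at all, in agreement with the convention for `r[_,_]`.
Shape : Kind → (d : ℕ) → Board m n → Set
Shape k d σ = ∃ λ i → d ≡ matchingNumber k ℕ.+ i × Copy (graph k) i σ

data Classification (d : ℕ) (σ : Board m n) : Set where
  shape : ∀ k → Shape k d σ → Classification d σ
  wider : Copy ∅ (suc d) σ → Classification d σ
  large : ∀ {es} → Forest es → All (_∈ᴮ σ) es → length es ≡ 2 ℕ.+ d → Classification d σ

module _ (M : Matching {m} {n} d σ) where

  open Matching M

  private
    extra-or-matched : ∀ {x y} → (x , y) ∈ᴮ σ → Matched x y ⊎ Extra x y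
    extra-or-matched {x} {y} e with matched? x y
    ... | yes xy = inj₁ xy
    ... | no ¬xy = inj₂ (e , ¬xy)

  rook-copy : (∀ x y → ¬ Extra x y) → Copy ∅ d σ
  rook-copy none = record
    { ρ     = λ { (inj₂ t) → row t }
    ; κ     = λ { (inj₂ t) → col t }
    ; ρ-inj = λ { {inj₂ s} {inj₂ t} eq → cong inj₂ (row-inj eq) }
    ; κ-inj = λ { {inj₂ s} {inj₂ t} eq → cong inj₂ (col-inj eq) }
    ; sound = λ { (inj₂ s) (inj₂ t) refl → edge s }
    ; complete = λ x y e → complete (extra-or-matched e)
    }
    where
    complete : ∀ {x y} → Matched x y ⊎ Extra x y → _
    complete (inj₁ (t , rt≡x , ct≡y)) = inj₂ t , inj₂ t , rt≡x , ct≡y , refl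
    complete (inj₂ e)                 = contradiction e (none _ _)

  module _ {x : Fin m} {y : Fin n} (e : Extra x y) (unique : ∀ x′ y′ → Extra x′ y′ → Parallel x y x′ y′) where

    wider-copy : (∀ t → row t ≢ x) → (∀ t → col t ≢ y) → Copy ∅ (suc d) σ
    wider-copy x∉ y∉ = record
      { ρ = ρ ; κ = κ ; ρ-inj = ρ-inj ; κ-inj = κ-inj
      ; sound = λ { (inj₂ zero) (inj₂ _) refl → proj₁ e ; (inj₂ (suc t)) (inj₂ _) refl → edge t }
      ; complete = λ x′ y′ e′ → complete (extra-or-matched e′)
      }
      where
      ρ : Fin 0 ⊎ Fin (suc d) → Fin m
      ρ (inj₂ zero)    = x
      ρ (inj₂ (suc t)) = row t
      κ : Fin 0 ⊎ Fin (suc d) → Fin n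
      κ (inj₂ zero)    = y
      κ (inj₂ (suc t)) = col t
      ρ-inj : Injective _≡_ _≡_ ρ
      ρ-inj {inj₂ zero}    {inj₂ zero}    _  = refl
      ρ-inj {inj₂ zero}    {inj₂ (suc t)} eq = contradiction (sym eq) (x∉ t)
      ρ-inj {inj₂ (suc s)} {inj₂ zero}    eq = contradiction eq (x∉ s)
      ρ-inj {inj₂ (suc s)} {inj₂ (suc t)} eq = cong (inj₂ ∘ suc) (row-inj eq)
      κ-inj : Injective _≡_ _≡_ κ
      κ-inj {inj₂ zero}    {inj₂ zero}    _  = refl
      κ-inj {inj₂ zero}    {inj₂ (suc t)} eq = contradiction (sym eq) (y∉ t)
      κ-inj {inj₂ (suc s)} {inj₂ zero}    eq = contradiction eq (y∉ s)
      κ-inj {inj₂ (suc s)} {inj₂ (suc t)} eq = cong (inj₂ ∘ suc) (col-inj eq)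
      complete : ∀ {x′ y′} → Matched x′ y′ ⊎ Extra x′ y′ → ∃₂ λ s t → ρ s ≡ x′ × κ t ≡ y′ × Adj ∅ (suc d) s t
      complete (inj₁ (t , rt≡ , ct≡)) = inj₂ (suc t) , inj₂ (suc t) , rt≡ , ct≡ , refl
      complete (inj₂ e′) with unique _ _ e′
      ... | inj₁ (x≡x′ , y≡y′)          = inj₂ zero , inj₂ zero , x≡x′ , y≡y′ , refl
      ... | inj₂ ((t , rt≡x , _) , _)   = contradiction rt≡x (x∉ t)

    module _ {a i} (Sel : Selection a i d) where

      open Selection Sel

      selected-row-inj : ∀ {s s′} → row (select s) ≡ row (select s′) → s ≡ s′
      selected-row-inj = injective ∘ row-inj

      selected-col-inj : ∀ {s s′} → col (select s) ≡ col (select s′) → s ≡ s′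
      selected-col-inj = injective ∘ col-inj

    -- The extra edge hangs at a matched row and has a free column as its other end. A parallel edge
    -- in a different cell would require a matching edge at `y`, so there is no further extra edge.
    wcg-copy : (S : Selection 1 i d) → row (Selection.select S (inj₁ zero)) ≡ x → (∀ t → col t ≢ y) → Copy WCG i σ
    wcg-copy {i} S t≡x y∉ = record
      { ρ = row ∘ select ; κ = κ ; ρ-inj = selected-row-inj S ; κ-inj = κ-inj
      ; sound = sound
      ; complete = λ x′ y′ e′ → complete (extra-or-matched e′)
      }
      where
      open Selection S
      κ : Fin 2 ⊎ Fin i → Fin n
      κ (inj₁ zero)       = col (select (inj₁ zero))
      κ (inj₁ (suc zero)) = y
      κ (inj₂ s)          = col (select (inj₂ s))
      κ-inj : Injective _≡_ _≡_ κ
      κ-inj {inj₁ zero}       {inj₁ zero}       _  = refl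
      κ-inj {inj₁ zero}       {inj₁ (suc zero)} eq = contradiction eq (y∉ _)
      κ-inj {inj₁ zero}       {inj₂ _}          eq = contradiction (selected-col-inj S eq) λ ()
      κ-inj {inj₁ (suc zero)} {inj₁ zero}       eq = contradiction (sym eq) (y∉ _)
      κ-inj {inj₁ (suc zero)} {inj₁ (suc zero)} eq = refl
      κ-inj {inj₁ (suc zero)} {inj₂ _}          eq = contradiction (sym eq) (y∉ _)
      κ-inj {inj₂ _}          {inj₁ zero}       eq = contradiction (selected-col-inj S eq) λ ()
      κ-inj {inj₂ _}          {inj₁ (suc zero)} eq = contradiction eq (y∉ _)
      κ-inj {inj₂ s}          {inj₂ t}          eq = cong inj₂ (inj₂-injective (selected-col-inj S eq))
      sound : ∀ s t → Adj WCG i s t → (row (select s) , κ t) ∈ᴮ σ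
      sound (inj₁ zero) (inj₁ zero)       _    = edge _
      sound (inj₁ zero) (inj₁ (suc zero)) _    = subst (λ x → (x , y) ∈ᴮ σ) (sym t≡x) (proj₁ e)
      sound (inj₂ s)    (inj₂ .s)         refl = edge _
      complete : ∀ {x′ y′} → Matched x′ y′ ⊎ Extra x′ y′ →
                 ∃₂ λ s t → row (select s) ≡ x′ × κ t ≡ y′ × Adj WCG i s t
      complete (inj₁ (t , rt≡ , ct≡)) with surjective t
      ... | inj₁ zero , refl = inj₁ zero , inj₁ zero , rt≡ , ct≡ , Vec.here
      ... | inj₂ s    , refl = inj₂ s , inj₂ s , rt≡ , ct≡ , refl
      complete (inj₂ e′) with unique _ _ e′
      ... | inj₁ (x≡x′ , y≡y′)        = inj₁ zero , inj₁ (suc zero) , trans t≡x x≡x′ , y≡y′ , Vec.there Vec.here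
      ... | inj₂ (_ , (t , _ , ct≡y)) = contradiction ct≡y (y∉ t)

    wrg-copy : (S : Selection 1 i d) → col (Selection.select S (inj₁ zero)) ≡ y → (∀ t → row t ≢ x) → Copy WRG i σ
    wrg-copy {i} S t≡y x∉ = record
      { ρ = ρ ; κ = col ∘ select ; ρ-inj = ρ-inj ; κ-inj = selected-col-inj S
      ; sound = sound
      ; complete = λ x′ y′ e′ → complete (extra-or-matched e′)
      }
      where
      open Selection S
      ρ : Fin 2 ⊎ Fin i → Fin m
      ρ (inj₁ zero)       = row (select (inj₁ zero))
      ρ (inj₁ (suc zero)) = x
      ρ (inj₂ s)          = row (select (inj₂ s))
      ρ-inj : Injective _≡_ _≡_ ρ
      ρ-inj {inj₁ zero}       {inj₁ zero}       _  = refl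
      ρ-inj {inj₁ zero}       {inj₁ (suc zero)} eq = contradiction eq (x∉ _)
      ρ-inj {inj₁ zero}       {inj₂ _}          eq = contradiction (selected-row-inj S eq) λ ()
      ρ-inj {inj₁ (suc zero)} {inj₁ zero}       eq = contradiction (sym eq) (x∉ _)
      ρ-inj {inj₁ (suc zero)} {inj₁ (suc zero)} eq = refl
      ρ-inj {inj₁ (suc zero)} {inj₂ _}          eq = contradiction (sym eq) (x∉ _)
      ρ-inj {inj₂ _}          {inj₁ zero}       eq = contradiction (selected-row-inj S eq) λ ()
      ρ-inj {inj₂ _}          {inj₁ (suc zero)} eq = contradiction eq (x∉ _)
      ρ-inj {inj₂ s}          {inj₂ t}          eq = cong inj₂ (inj₂-injective (selected-row-inj S eq))
      sound : ∀ s t → Adj WRG i s t → (ρ s , col (select t)) ∈ᴮ σ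
      sound (inj₁ zero)       (inj₁ zero) _    = edge _
      sound (inj₁ (suc zero)) (inj₁ zero) _    = subst (λ y → (x , y) ∈ᴮ σ) (sym t≡y) (proj₁ e)
      sound (inj₂ s)          (inj₂ .s)   refl = edge _
      complete : ∀ {x′ y′} → Matched x′ y′ ⊎ Extra x′ y′ →
                 ∃₂ λ s t → ρ s ≡ x′ × col (select t) ≡ y′ × Adj WRG i s t
      complete (inj₁ (t , rt≡ , ct≡)) with surjective t
      ... | inj₁ zero , refl = inj₁ zero , inj₁ zero , rt≡ , ct≡ , Vec.here
      ... | inj₂ s    , refl = inj₂ s , inj₂ s , rt≡ , ct≡ , refl
      complete (inj₂ e′) with unique _ _ e′
      ... | inj₁ (x≡x′ , y≡y′)        = inj₁ (suc zero) , inj₁ zero , x≡x′ , trans t≡y y≡y′ , Vec.here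
      ... | inj₂ ((t , rt≡x , _) , _) = contradiction rt≡x (x∉ t)

    -- Both ends of the extra edge are matched, by two different matching edges. The only other cell
    -- parallel to it is the fourth corner of the rectangle, so `F` is left open in just that cell:
    -- it separates `SG` from `ZG`.
    square-copy : (S : Selection 2 i d) → let open Selection S in
                  row (select (inj₁ (suc zero))) ≡ x → col (select (inj₁ zero)) ≡ y →
                  (F : Board 2 2) → (zero , zero) ∈ᴮ F → (suc zero , suc zero) ∈ᴮ F → (suc zero , zero) ∈ᴮ F →
                  ((zero , suc zero) ∈ᴮ F ⇔ (row (select (inj₁ zero)) , col (select (inj₁ (suc zero)))) ∈ᴮ σ) →
                  Copy (biGraph F) i σ
    square-copy {i} S r₁≡x c₀≡y F ∈₀₀ ∈₁₁ ∈₁₀ ∈₀₁⇔ = record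
      { ρ = row ∘ select ; κ = col ∘ select ; ρ-inj = selected-row-inj S ; κ-inj = selected-col-inj S
      ; sound = sound
      ; complete = λ x′ y′ e′ → complete e′ (extra-or-matched e′)
      }
      where
      open Selection S
      sound : ∀ s t → Adj (biGraph F) i s t → (row (select s) , col (select t)) ∈ᴮ σ
      sound (inj₁ zero)       (inj₁ zero)       _    = edge _
      sound (inj₁ zero)       (inj₁ (suc zero)) f    = to ∈₀₁⇔ f
      sound (inj₁ (suc zero)) (inj₁ zero)       _    =
        subst₂ (λ x y → (x , y) ∈ᴮ σ) (sym r₁≡x) (sym c₀≡y) (proj₁ e)
      sound (inj₁ (suc zero)) (inj₁ (suc zero)) _    = edge _
      sound (inj₂ s)          (inj₂ .s)         refl = edge _
      complete : ∀ {x′ y′} → (x′ , y′) ∈ᴮ σ → Matched x′ y′ ⊎ Extra x′ y′ →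
                 ∃₂ λ s t → row (select s) ≡ x′ × col (select t) ≡ y′ × Adj (biGraph F) i s t
      complete _ (inj₁ (t , rt≡ , ct≡)) with surjective t
      ... | inj₁ zero       , refl = inj₁ zero , inj₁ zero , rt≡ , ct≡ , ∈₀₀
      ... | inj₁ (suc zero) , refl = inj₁ (suc zero) , inj₁ (suc zero) , rt≡ , ct≡ , ∈₁₁
      ... | inj₂ s          , refl = inj₂ s , inj₂ s , rt≡ , ct≡ , refl
      complete e∈ (inj₂ e′) with unique _ _ e′
      ... | inj₁ (x≡x′ , y≡y′) = inj₁ (suc zero) , inj₁ zero , trans r₁≡x x≡x′ , trans c₀≡y y≡y′ , ∈₁₀
      ... | inj₂ ((s , rs≡x , cs≡y′) , (t , rt≡x′ , ct≡y)) =
        inj₁ zero , inj₁ (suc zero) , r₀≡x′ , c₁≡y′ ,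
        from ∈₀₁⇔ (subst₂ (λ x y → (x , y) ∈ᴮ σ) (sym r₀≡x′) (sym c₁≡y′) e∈)
        where
        c₁≡y′ = trans (cong col (row-inj (trans r₁≡x (sym rs≡x)))) cs≡y′
        r₀≡x′ = trans (cong row (col-inj (trans c₀≡y (sym ct≡y)))) rt≡x′

classify : Matching d σ → Classification d σ
classify {d = d} {σ = σ} M with Fin.any? (λ x → Fin.any? (λ y → extra? x y))
  where open Matching M
... | no none = shape rook (d , refl , rook-copy M (λ x y e → none (x , y , e)))
... | yes (x , y , e) with Fin.any? (λ x′ → Fin.any? (λ y′ → extra? x′ y′ ×-dec ¬? (parallel? x y x′ y′)))
  where open Matching M
... | yes (x′ , y′ , e′ , ¬par) =
  large (two-extras-forest M e e′ ¬par) (proj₁ e ∷ proj₁ e′ ∷ cells⊆ M)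
        (cong (2 ℕ.+_) (length-tabulate (λ t → row t , col t)))
  where open Matching M
... | no none = go _ M e (λ x′ y′ e′ → decidable-stable (Matching.parallel? M x y x′ y′)
                                         (λ ¬par → none (x′ , y′ , e′ , ¬par)))
  where
  -- One matched end forces `d` to be at least 1, two ends matched by different edges force it to be
  -- at least 2; splitting `d` here produces the `i` of the copy.
  go : ∀ d (M : Matching d σ) → let open Matching M in
       Extra x y → (∀ x′ y′ → Extra x′ y′ → Parallel x y x′ y′) → Classification d σ
  go d M e unique with Fin.any? (λ t → Matching.row M t Fin.≟ x) | Fin.any? (λ t → Matching.col M t Fin.≟ y)
  go d M e unique | no x∉ | no y∉ = wider (wider-copy M e unique (λ t eq → x∉ (t , eq)) (λ t eq → y∉ (t , eq)))
  go (suc i) M e unique | yes (t , rt≡x) | no y∉ =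
    shape wcg (_ , refl , (wcg-copy M e unique (select₁ t) rt≡x (λ t eq → y∉ (t , eq))))
  go (suc i) M e unique | no x∉ | yes (t , ct≡y) =
    shape wrg (_ , refl , (wrg-copy M e unique (select₁ t) ct≡y (λ t eq → x∉ (t , eq))))
  go (suc zero) M e unique | yes (zero , rt≡x) | yes (zero , ct≡y) = contradiction (zero , rt≡x , ct≡y) (proj₂ e)
  go (suc (suc i)) M e unique | yes (t₁ , rt≡x) | yes (t₀ , ct≡y)
    with select₂ t₀ t₁ (λ { refl → proj₂ e (t₀ , rt≡x , ct≡y) })
  ... | S , S₀ , S₁ with (Matching.row M (Selection.select S (inj₁ zero)) ,
                          Matching.col M (Selection.select S (inj₁ (suc zero)))) ∈ᴮ? σ
  ...   | yes ∈₀₁ = shape sg (_ , refl , (square-copy M e unique S (trans (cong (Matching.row M) S₁) rt≡x)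
                      (trans (cong (Matching.col M) S₀) ct≡y) (edges SG)
                      Vec.here (Vec.there Vec.here) Vec.here (mk⇔ (λ _ → ∈₀₁) (λ _ → Vec.there Vec.here))))
  ...   | no ∉₀₁  = shape zg (_ , refl , (square-copy M e unique S (trans (cong (Matching.row M) S₁) rt≡x)
                      (trans (cong (Matching.col M) S₀) ct≡y) (edges ZG)
                      Vec.here (Vec.there Vec.here) Vec.here (mk⇔ (λ { (Vec.there ()) }) (λ e → contradiction e ∉₀₁))))

-- A spanning partial matching (p t , q t) of F, from which Copy F i σ inherits a matching of σ of size a + i.
record Frame (F : BiGraph) (a : ℕ) : Set where
  field
    p        : Fin a → Fin (rows F)
    q        : Fin a → Fin (cols F)
    p-inj    : Injective _≡_ _≡_ p
    q-inj    : Injective _≡_ _≡_ q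
    diagonal∈ : ∀ t → (p t , q t) ∈ᴮ edges F
    spanning : (∀ s → ∃ λ t → p t ≡ s) ⊎ (∀ s → ∃ λ t → q t ≡ s)

splitAt-injective : ∀ a {i} → Injective _≡_ _≡_ (splitAt a {i})
splitAt-injective a {i} {s} {t} eq =
  trans (sym (Fin.join-splitAt a i s)) (trans (cong (join a i) eq) (Fin.join-splitAt a i t))

map₁-injective : {A B C : Set} {f : A → B} → Injective _≡_ _≡_ f → Injective _≡_ _≡_ (Sum.map₁ {B = C} f)
map₁-injective f-inj {inj₁ x} {inj₁ y} eq   = cong inj₁ (f-inj (inj₁-injective eq))
map₁-injective f-inj {inj₂ x} {inj₂ y} refl = refl

module _ {F : BiGraph} (C : Copy {m} {n} F i σ) where

  open Copy C

  cell⇒adj : ∀ {s t} → (ρ s , κ t) ∈ᴮ σ → Adj F i s t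
  cell⇒adj {s} {t} e with complete _ _ e
  ... | s′ , t′ , ρ≡ , κ≡ , adj with refl ← ρ-inj {s′} {s} ρ≡ | refl ← κ-inj {t′} {t} κ≡ = adj

  module _ (Fr : Frame F a) where

    open Frame Fr

    frame-matching : Matching (a ℕ.+ i) σ
    frame-matching = record
      { row     = ρ ∘ Sum.map₁ p ∘ splitAt a
      ; col     = κ ∘ Sum.map₁ q ∘ splitAt a
      ; row-inj = splitAt-injective a ∘ map₁-injective p-inj ∘ ρ-inj
      ; col-inj = splitAt-injective a ∘ map₁-injective q-inj ∘ κ-inj
      ; edge    = λ t → edge (splitAt a t)
      }
      where
      edge : ∀ s → (ρ (Sum.map₁ p s) , κ (Sum.map₁ q s)) ∈ᴮ σ
      edge (inj₁ s) = sound _ _ (diagonal∈ s)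
      edge (inj₂ s) = sound _ _ refl

    open Matching frame-matching

    row-inj₁ : ∀ t → row (t ↑ˡ i) ≡ ρ (inj₁ (p t))
    row-inj₁ t = cong (ρ ∘ Sum.map₁ p) (Fin.splitAt-↑ˡ a t i)

    col-inj₁ : ∀ t → col (t ↑ˡ i) ≡ κ (inj₁ (q t))
    col-inj₁ t = cong (κ ∘ Sum.map₁ q) (Fin.splitAt-↑ˡ a t i)

    row-inj₂ : ∀ s → row (a ↑ʳ s) ≡ ρ (inj₂ s)
    row-inj₂ s = cong (ρ ∘ Sum.map₁ p) (Fin.splitAt-↑ʳ a i s)

    col-inj₂ : ∀ s → col (a ↑ʳ s) ≡ κ (inj₂ s)
    col-inj₂ s = cong (κ ∘ Sum.map₁ q) (Fin.splitAt-↑ʳ a i s)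

    -- The rows, or else the columns, of the matching contain every cell of `σ`; they are the cover
    -- behind the upper bound `rank-≤-frame`.
    matching-spans : (∀ x y → (x , y) ∈ᴮ σ → ∃ λ t → row t ≡ x) ⊎ (∀ x y → (x , y) ∈ᴮ σ → ∃ λ t → col t ≡ y)
    matching-spans = Sum.map rows-span cols-span spanning
      where
      rows-span : (∀ s → ∃ λ t → p t ≡ s) → ∀ x y → (x , y) ∈ᴮ σ → ∃ λ t → row t ≡ x
      rows-span p-surj x y e with complete x y e
      ... | inj₂ s , _ , ρ≡x , _ = a ↑ʳ s , trans (row-inj₂ s) ρ≡x
      ... | inj₁ s , _ , ρ≡x , _ with p-surj s
      ...   | t , refl = t ↑ˡ i , trans (row-inj₁ t) ρ≡x
      cols-span : (∀ s → ∃ λ t → q t ≡ s) → ∀ x y → (x , y) ∈ᴮ σ → ∃ λ t → col t ≡ y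
      cols-span q-surj x y e with complete x y e
      ... | _ , inj₂ s , _ , κ≡y , _ = a ↑ʳ s , trans (col-inj₂ s) κ≡y
      ... | _ , inj₁ s , _ , κ≡y , _ with q-surj s
      ...   | t , refl = t ↑ˡ i , trans (col-inj₁ t) κ≡y

    -- Only the frame has to be inspected: a copy of `E` meets neither the frame nor the other
    -- copies, so it adds nothing off the diagonal.
    matching-triangular : (∀ s t → (p s , q t) ∈ᴮ edges F → toℕ t ≤ toℕ s) →
                          ∀ s t → (row s , col t) ∈ᴮ σ → toℕ t ≤ toℕ s
    matching-triangular tri s t e = go (splitAt a s) (splitAt a t) refl refl (cell⇒adj e)
      where
      go : ∀ u v → splitAt a s ≡ u → splitAt a t ≡ v → Adj F i (Sum.map₁ p u) (Sum.map₁ q v) → toℕ t ≤ toℕ s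
      go (inj₁ u) (inj₁ v) s≡u t≡v adj = subst₂ _≤_
        (trans (sym (Fin.toℕ-↑ˡ v i)) (cong toℕ (Fin.splitAt⁻¹-↑ˡ t≡v)))
        (trans (sym (Fin.toℕ-↑ˡ u i)) (cong toℕ (Fin.splitAt⁻¹-↑ˡ s≡u)))
        (tri u v adj)
      go (inj₂ u) (inj₂ .u) s≡u t≡v refl =
        ℕ.≤-reflexive (cong toℕ (splitAt-injective a (trans t≡v (sym s≡u))))

    cells-cover : ∀ {x y} → (x , y) ∈ᴮ σ →
                  (x , y) ∈ˡ cells ⊎ ∃₂ λ s t → x ≡ ρ (inj₁ s) × y ≡ κ (inj₁ t) × (s , t) ∈ᴮ edges F × (∀ u → ¬ (p u ≡ s × q u ≡ t))
    cells-cover {x} {y} e with complete x y e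
    ... | inj₂ s , inj₂ .s , refl , refl , refl = inj₁ (subst (_∈ˡ cells) (cong₂ _,_ (row-inj₂ s) (col-inj₂ s))
                                                         (∈-tabulate⁺ {f = λ t → row t , col t} (a ↑ʳ s)))
    ... | inj₁ s , inj₁ t , refl , refl , f with Fin.any? (λ u → (p u Fin.≟ s) ×-dec (q u Fin.≟ t))
    ...   | yes (u , refl , refl) = inj₁ (subst (_∈ˡ cells) (cong₂ _,_ (row-inj₁ u) (col-inj₁ u))
                                            (∈-tabulate⁺ {f = λ t → row t , col t} (u ↑ˡ i)))
    ...   | no none = inj₂ (s , t , refl , refl , f , λ u pq → none (u , pq))

    extra : ∀ {s t} → (s , t) ∈ᴮ edges F → (∀ u → ¬ (p u ≡ s × q u ≡ t)) → Extra (ρ (inj₁ s)) (κ (inj₁ t))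
    extra {s} {t} f none = sound _ _ f , λ (v , rv≡ , cv≡) → go (splitAt a v) (ρ-inj rv≡) (κ-inj cv≡)
      where
      go : ∀ u → Sum.map₁ p u ≡ inj₁ s → Sum.map₁ q u ≡ inj₁ t → Empty
      go (inj₁ u) pu≡ qu≡ = none u (inj₁-injective pu≡ , inj₁-injective qu≡)

-- Rank bounds and supports that determine the rank

module Rank {order : ℕ} (F : FiniteField order) where

  open FiniteField F
  open Scaling F
  private
    module R = CommutativeRing commutativeRing
    module RP = RingProperties R.ring
  open ≡-Reasoning

  module _ (A : Matrix F m n) where

    independent-row≢0 : ∀ S → IndependentRows F A S → ∃ λ (κ : Fin ∣ S ∣ → Fin n) → Injective _≡_ _≡_ κ ×
                        ∀ t → (enum S t , κ t) ∈ᴮ support A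
    independent-row≢0 S ind with transversal _ (λ _ → yes tt) (independentRows⇒independent A S ind)
    ... | κ , κ-inj , _ , A≢0 = κ , κ-inj , λ t → from (∈-support A (enum S t) (κ t)) (A≢0 t)

    rank-matching : Matching (rank F A) (support A)
    rank-matching with rank-attained A
    ... | S , ind , ∣S∣≡rank with independent-row≢0 S ind
    ...   | κ , κ-inj , edge = subst (λ r → Matching r (support A)) ∣S∣≡rank record
      { row = enum S ; col = κ ; row-inj = enum-injective S ; col-inj = κ-inj ; edge = edge }

    private module M = Matching rank-matching

    -- The easy half of König duality: each of the `rank F A` edges of `rank-matching` uses up a
    -- covering row of its own.
    rank-≤-rows : (f : Fin k → Fin m) → (∀ x y → (x , y) ∈ᴮ support A → ∃ λ t → f t ≡ x) → rank F A ≤ k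
    rank-≤-rows f cover = Fin.injective⇒≤ {f = λ t → proj₁ (cover _ _ (M.edge t))} λ {s} {t} eq → M.row-inj
      (trans (sym (proj₂ (cover _ _ (M.edge s)))) (trans (cong f eq) (proj₂ (cover _ _ (M.edge t)))))

    rank-≤-cols : (f : Fin k → Fin n) → (∀ x y → (x , y) ∈ᴮ support A → ∃ λ t → f t ≡ y) → rank F A ≤ k
    rank-≤-cols f cover = Fin.injective⇒≤ {f = λ t → proj₁ (cover _ _ (M.edge t))} λ {s} {t} eq → M.col-inj
      (trans (sym (proj₂ (cover _ _ (M.edge s)))) (trans (cong f eq) (proj₂ (cover _ _ (M.edge t)))))

    ∉support⇒0 : ∀ {x y} → ¬ (x , y) ∈ᴮ support A → entry F A x y ≡ 0#
    ∉support⇒0 {x} {y} ∉ = decidable-stable (entry F A x y ≟ 0#) (∉ ∘ from (∈-support A x y))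

    ≤-rank-image : (f : Fin k → Fin m) → Injective _≡_ _≡_ f →
                   (∀ c → (∀ x → (∀ t → f t ≢ x) → lookup c x ≡ 0#) →
                          (∀ j → sum (λ x → lookup c x *ᶠ entry F A x j) ≡ 0#) → ∀ t → lookup c (f t) ≡ 0#) →
                   k ≤ rank F A
    ≤-rank-image {k} f f-inj ind = subst (_≤ rank F A) (∣image∣ f f-inj) (∣S∣≤rank A S λ c c∉ cA≡0 x → at c c∉ cA≡0 x (image? f x))
      where
      S = subsetOf (image? f)
      at : ∀ c → (∀ x → x ∉ S → lookup c x ≡ 0#) → (∀ j → sum (λ x → lookup c x *ᶠ entry F A x j) ≡ 0#) →
           ∀ x → Dec (∃ λ t → f t ≡ x) → lookup c x ≡ 0#
      at c c∉ cA≡0 x (no  x∉)         = c∉ x (x∉ ∘ to (∈-subsetOf (image? f) x))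
      at c c∉ cA≡0 x (yes (t , refl)) = ind c
        (λ x x∉ → c∉ x (λ x∈ → let (t , eq) = to (∈-subsetOf (image? f) x) x∈ in x∉ t eq)) cA≡0 t

    -- Back substitution, from the last matching edge to the first. In the column of edge `t` the
    -- only matched rows with nonzero entries are that of `t` and later ones; the coefficients of
    -- the later rows vanish already, so the column equation kills the coefficient of row `t`.
    ≤-rank-triangular : (M : Matching d (support A)) → let open Matching M in
                        (∀ s t → (row s , col t) ∈ᴮ support A → toℕ t ≤ toℕ s) → d ≤ rank F A
    ≤-rank-triangular {d} M tri = ≤-rank-image row row-inj λ c c∉ cA≡0 t → vanish c c∉ cA≡0 t (>-wellFounded t)
      where
      open Matching M
      vanish : ∀ c → (∀ x → (∀ t → row t ≢ x) → lookup c x ≡ 0#) →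
               (∀ j → sum (λ x → lookup c x *ᶠ entry F A x j) ≡ 0#) →
               ∀ t → Acc _>_ t → lookup c (row t) ≡ 0#
      vanish c c∉ cA≡0 t (acc later) = *≡0⇒ (to (∈-support A _ _) (edge t)) (trans (R.*-comm _ _)
        (trans (sym (sum-single (λ x → lookup c x *ᶠ entry F A x (col t)) (row t) others)) (cA≡0 (col t))))
        where
        others : ∀ x → x ≢ row t → lookup c x *ᶠ entry F A x (col t) ≡ 0#
        others x x≢ with image? row x
        ... | no  x∉ = trans (cong (_*ᶠ entry F A x (col t)) (c∉ x (λ s eq → x∉ (s , eq)))) (R.zeroˡ _)
        ... | yes (s , refl) with (row s , col t) ∈ᴮ? support A
        ...   | no  ∉ = trans (cong (lookup c (row s) *ᶠ_) (∉support⇒0 ∉)) (R.zeroʳ _)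
        ...   | yes e = trans (cong (_*ᶠ entry F A (row s) (col t)) (vanish c c∉ cA≡0 s (later
                          (ℕ.≤∧≢⇒< (tri s t e) λ eq → x≢ (cong row (sym (Fin.toℕ-injective eq))))))) (R.zeroˡ _)

  rank-≤-frame : ∀ {H} (C : Copy {m} {n} H i σ) (Fr : Frame H a) {A : Matrix F m n} → support A ≡ σ → rank F A ≤ a ℕ.+ i
  rank-≤-frame C Fr {A} refl with matching-spans C Fr
  ... | inj₁ rows-span = rank-≤-rows A _ rows-span
  ... | inj₂ cols-span = rank-≤-cols A _ cols-span

  -- The cover bounds the rank from above and back substitution from below, so the support alone
  -- decides it. Among the five frames only that of `SG` is not triangular.
  rank-frame : ∀ {H} (C : Copy {m} {n} H i σ) (Fr : Frame H a) → let open Frame Fr in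
               (∀ s t → (p s , q t) ∈ᴮ edges H → toℕ t ≤ toℕ s) →
               {A : Matrix F m n} → support A ≡ σ → rank F A ≡ a ℕ.+ i
  rank-frame C Fr tri {A} refl = ℕ.≤-antisym (rank-≤-frame C Fr {A} refl)
    (≤-rank-triangular A (frame-matching C Fr) (matching-triangular C Fr tri))

  w : ℕ
  w = length nonzeros

  N : (d : ℕ) (σ : Board m n) → ℕ
  N d σ = length (Count.normals d σ [])

  indicator : Board m n → Matrix F m n
  indicator σ = matrix (λ x y → if does ((x , y) ∈ᴮ? σ) then 1# else 0#)

  entry-indicator-∈ : (σ : Board m n) → ∀ {x y} → (x , y) ∈ᴮ σ → entry F (indicator σ) x y ≡ 1#
  entry-indicator-∈ σ {x} {y} e = trans (entry-matrix _ x y) (cong (if_then 1# else 0#) (dec-true ((x , y) ∈ᴮ? σ) e))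

  entry-indicator-∉ : (σ : Board m n) → ∀ {x y} → ¬ (x , y) ∈ᴮ σ → entry F (indicator σ) x y ≡ 0#
  entry-indicator-∉ σ {x} {y} e = trans (entry-matrix _ x y) (cong (if_then 1# else 0#) (dec-false ((x , y) ∈ᴮ? σ) e))

  support-unique : (A : Matrix F m n) → (∀ x y → (x , y) ∈ᴮ σ → entry F A x y ≢ 0#) →
                   (∀ x y → ¬ (x , y) ∈ᴮ σ → entry F A x y ≡ 0#) → support A ≡ σ
  support-unique {σ = σ} A ≢0 ≡0 = board-ext λ x y → mk⇔
    (λ e → decidable-stable ((x , y) ∈ᴮ? σ) λ ∉ → to (∈-support A x y) e (≡0 x y ∉))
    (λ e → from (∈-support A x y) (≢0 x y e))

  -- Normalised along a forest that contains every cell of `σ`, a matrix has no freedom left: it is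
  -- the 0/1 matrix of `σ`, and the last hypothesis guarantees that this one has rank `d`.
  count-rigid : ∀ d (σ : Board m n) {es} → Forest es → All (_∈ᴮ σ) es →
                (∀ {x y} → (x , y) ∈ᴮ σ → (x , y) ∈ˡ es) →
                (∀ {A : Matrix F m n} → support A ≡ σ → rank F A ≡ d) → N d σ ≡ w ℕ.^ length es
  count-rigid {m} {n} d σ {es} forest es⊆σ σ⊆es rank≡d = trans (normalise-forest forest es⊆σ)
    (trans (cong (w ℕ.^ length es ℕ.*_) only-one) (ℕ.*-identityʳ _))
    where
    open Count d σ
    1σ = indicator σ
    support-1σ : support 1σ ≡ σ
    support-1σ = support-unique 1σ (λ x y e → 1≢0 ∘ trans (sym (entry-indicator-∈ σ e)))
                                   (λ x y → entry-indicator-∉ σ)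
    is-1σ : ∀ {A} → Normal es A → 1σ ≡ A
    is-1σ {A} ν = matrix-ext 1σ A λ x y → eq x y ((x , y) ∈ᴮ? σ)
      where
      eq : ∀ x y → Dec ((x , y) ∈ᴮ σ) → entry F 1σ x y ≡ entry F A x y
      eq x y (yes e) = trans (entry-indicator-∈ σ e) (sym (All.lookup (ones ν) (σ⊆es e)))
      eq x y (no ∉)  = trans (entry-indicator-∉ σ ∉)
        (sym (∉support⇒0 A (∉ ∘ subst ((x , y) ∈ᴮ_) (support≡ ν))))
    only-one : length (normals es) ≡ 1
    only-one = length-≡ {ys = 1σ ∷ []} id id (normals-unique es) ([] ∷ [])
      (λ A∈ → here (sym (is-1σ (∈⇒normal A∈))))
      (λ { (here refl) → normal⇒∈ (normal (rank≡d {1σ} support-1σ) support-1σ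
                                          (All.map (entry-indicator-∈ σ) es⊆σ)) })
      (λ _ → refl) (λ _ → refl)

frame : ∀ k → Frame (graph k) (matchingNumber k)
frame rook = record
  { p = λ () ; q = λ () ; p-inj = λ { {()} } ; q-inj = λ { {()} } ; diagonal∈ = λ () ; spanning = inj₁ λ () }
frame zg = record
  { p = id ; q = id ; p-inj = id ; q-inj = id
  ; diagonal∈ = λ { zero → Vec.here ; (suc zero) → Vec.there Vec.here } ; spanning = inj₁ (_, refl) }
frame sg = record
  { p = id ; q = id ; p-inj = id ; q-inj = id
  ; diagonal∈ = λ { zero → Vec.here ; (suc zero) → Vec.there Vec.here } ; spanning = inj₁ (_, refl) }
frame wrg = record
  { p = λ _ → zero ; q = id ; p-inj = λ { {zero} {zero} _ → refl } ; q-inj = id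
  ; diagonal∈ = λ { zero → Vec.here } ; spanning = inj₂ (_, refl) }
frame wcg = record
  { p = id ; q = λ _ → zero ; p-inj = id ; q-inj = λ { {zero} {zero} _ → refl }
  ; diagonal∈ = λ { zero → Vec.here } ; spanning = inj₁ (_, refl) }

shape-matching : ∀ k → (C : Copy {m} {n} (graph k) i σ) → Matching (matchingNumber k ℕ.+ i) σ
shape-matching k C = frame-matching C (frame k)

-- The five shapes exclude each other

module Profile where

  TwoInRow TwoInCol Rectangle : Board m n → Set
  TwoInRow {m} {n} B = ∃ λ x → ∃₂ λ y y′ → y ≢ y′ × (x , y) ∈ᴮ B × (x , y′) ∈ᴮ B
  TwoInCol {m} {n} B = ∃ λ y → ∃₂ λ x x′ → x ≢ x′ × (x , y) ∈ᴮ B × (x′ , y) ∈ᴮ B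
  Rectangle {m} {n} B = ∃₂ λ x x′ → ∃₂ λ y y′ → x ≢ x′ × y ≢ y′ ×
    ((x , y) ∈ᴮ B × (x , y′) ∈ᴮ B) × ((x′ , y) ∈ᴮ B × (x′ , y′) ∈ᴮ B)

  twoInRow? : (B : Board m n) → Dec (TwoInRow B)
  twoInRow? B = Fin.any? λ x → Fin.any? λ y → Fin.any? λ y′ →
    ¬? (y Fin.≟ y′) ×-dec (((x , y) ∈ᴮ? B) ×-dec ((x , y′) ∈ᴮ? B))

  twoInCol? : (B : Board m n) → Dec (TwoInCol B)
  twoInCol? B = Fin.any? λ y → Fin.any? λ x → Fin.any? λ x′ →
    ¬? (x Fin.≟ x′) ×-dec (((x , y) ∈ᴮ? B) ×-dec ((x′ , y) ∈ᴮ? B))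

  rectangle? : (B : Board m n) → Dec (Rectangle B)
  rectangle? B = Fin.any? λ x → Fin.any? λ x′ → Fin.any? λ y → Fin.any? λ y′ →
    ¬? (x Fin.≟ x′) ×-dec (¬? (y Fin.≟ y′) ×-dec
    ((((x , y) ∈ᴮ? B) ×-dec ((x , y′) ∈ᴮ? B)) ×-dec (((x′ , y) ∈ᴮ? B) ×-dec ((x′ , y′) ∈ᴮ? B))))

  module _ {F : BiGraph} (C : Copy {m} {n} F i σ) where

    open Copy C

    private
      -- A vertex in a copy of `E` has only one neighbour, so a vertex with two of them lies in `F`.
      row-graph : ∀ s {t t′} → t ≢ t′ → Adj F i s t → Adj F i s t′ →
                  ∃ λ s₀ → ∃₂ λ t₀ t₀′ → s ≡ inj₁ s₀ × t ≡ inj₁ t₀ × t′ ≡ inj₁ t₀′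
      row-graph (inj₁ s) {inj₁ t} {inj₁ t′} _    _    _    = s , t , t′ , refl , refl , refl
      row-graph (inj₂ s) {inj₂ _} {inj₂ _}  t≢t′ refl refl = contradiction refl t≢t′

      col-graph : ∀ t {s s′} → s ≢ s′ → Adj F i s t → Adj F i s′ t →
                  ∃ λ t₀ → ∃₂ λ s₀ s₀′ → t ≡ inj₁ t₀ × s ≡ inj₁ s₀ × s′ ≡ inj₁ s₀′
      col-graph (inj₁ t) {inj₁ s} {inj₁ s′} _    _    _    = t , s , s′ , refl , refl , refl
      col-graph (inj₂ t) {inj₂ _} {inj₂ _}  s≢s′ refl refl = contradiction refl s≢s′

      cell : ∀ {x y} → (x , y) ∈ᴮ σ → ∃₂ λ s t → ρ s ≡ x × κ t ≡ y
      cell {x} {y} e with complete x y e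
      ... | s , t , eqs , eqt , _ = s , t , eqs , eqt

    twoInRow⇔ : TwoInRow σ ⇔ TwoInRow (edges F)
    twoInRow⇔ = mk⇔ into back
      where
      into : TwoInRow σ → TwoInRow (edges F)
      into (x , y , y′ , y≢y′ , e , e′) with cell e | cell e′
      ... | s , t , refl , refl | _ , t′ , _ , refl
        with row-graph s {t} {t′} (y≢y′ ∘ cong κ) (cell⇒adj C e) (cell⇒adj C e′)
      ...   | s₀ , t₀ , t₀′ , refl , refl , refl =
        s₀ , t₀ , t₀′ , y≢y′ ∘ cong (κ ∘ inj₁) , cell⇒adj C e , cell⇒adj C e′
      back : TwoInRow (edges F) → TwoInRow σ
      back (s , t , t′ , t≢t′ , e , e′) =
        _ , _ , _ , t≢t′ ∘ inj₁-injective ∘ κ-inj , sound (inj₁ s) (inj₁ t) e , sound (inj₁ s) (inj₁ t′) e′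

    twoInCol⇔ : TwoInCol σ ⇔ TwoInCol (edges F)
    twoInCol⇔ = mk⇔ into back
      where
      into : TwoInCol σ → TwoInCol (edges F)
      into (y , x , x′ , x≢x′ , e , e′) with cell e | cell e′
      ... | s , t , refl , refl | s′ , _ , refl , _
        with col-graph t {s} {s′} (x≢x′ ∘ cong ρ) (cell⇒adj C e) (cell⇒adj C e′)
      ...   | t₀ , s₀ , s₀′ , refl , refl , refl =
        t₀ , s₀ , s₀′ , x≢x′ ∘ cong (ρ ∘ inj₁) , cell⇒adj C e , cell⇒adj C e′
      back : TwoInCol (edges F) → TwoInCol σ
      back (t , s , s′ , s≢s′ , e , e′) =
        _ , _ , _ , s≢s′ ∘ inj₁-injective ∘ ρ-inj , sound (inj₁ s) (inj₁ t) e , sound (inj₁ s′) (inj₁ t) e′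

    rectangle⇔ : Rectangle σ ⇔ Rectangle (edges F)
    rectangle⇔ = mk⇔ into back
      where
      into : Rectangle σ → Rectangle (edges F)
      into (x , x′ , y , y′ , x≢x′ , y≢y′ , (e₁ , e₂) , (e₃ , e₄)) with cell e₁ | cell e₄
      ... | s , t , refl , refl | s′ , t′ , refl , refl
        with row-graph s {t} {t′} (y≢y′ ∘ cong κ) (cell⇒adj C e₁) (cell⇒adj C e₂)
           | row-graph s′ {t} {t′} (y≢y′ ∘ cong κ) (cell⇒adj C e₃) (cell⇒adj C e₄)
      ...   | s₀ , t₀ , t₀′ , refl , refl , refl | s₀′ , _ , _ , refl , _ , _ =
        s₀ , s₀′ , t₀ , t₀′ , x≢x′ ∘ cong (ρ ∘ inj₁) , y≢y′ ∘ cong (κ ∘ inj₁) ,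
        (cell⇒adj C e₁ , cell⇒adj C e₂) , (cell⇒adj C e₃ , cell⇒adj C e₄)
      back : Rectangle (edges F) → Rectangle σ
      back (s , s′ , t , t′ , s≢s′ , t≢t′ , (e₁ , e₂) , (e₃ , e₄)) =
        _ , _ , _ , _ , s≢s′ ∘ inj₁-injective ∘ ρ-inj , t≢t′ ∘ inj₁-injective ∘ κ-inj ,
        (sound (inj₁ s) (inj₁ t) e₁ , sound (inj₁ s) (inj₁ t′) e₂) ,
        (sound (inj₁ s′) (inj₁ t) e₃ , sound (inj₁ s′) (inj₁ t′) e₄)

  -- Three invariants that disregard the copies of `E` and isolated vertices, and that together tell
  -- the five graphs apart. Their values on those graphs are found by evaluation.
  profile : Board m n → Bool × Bool × Bool
  profile B = does (twoInRow? B) , does (twoInCol? B) , does (rectangle? B)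

  profile-copy : ∀ {F} → Copy {m} {n} F i σ → profile σ ≡ profile (edges F)
  profile-copy {σ = σ} {F = F} C = cong₂ _,_
    (does-⇔ (twoInRow⇔ C) (twoInRow? σ) (twoInRow? (edges F)))
    (cong₂ _,_ (does-⇔ (twoInCol⇔ C) (twoInCol? σ) (twoInCol? (edges F)))
               (does-⇔ (rectangle⇔ C) (rectangle? σ) (rectangle? (edges F))))

  private
    decode : Bool × Bool × Bool → Kind
    decode (false , false , _)     = rook
    decode (true  , true  , false) = zg
    decode (true  , true  , true)  = sg
    decode (false , true  , _)     = wrg
    decode (true  , false , _)     = wcg

    decode-profile : ∀ k → decode (profile (edges (graph k))) ≡ k
    decode-profile rook = refl
    decode-profile zg   = refl
    decode-profile sg   = refl
    decode-profile wrg  = refl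
    decode-profile wcg  = refl

  -- This keeps a board from contributing to two coefficients at once.
  shape-unique : ∀ {k k′} → Shape k d σ → Shape k′ d σ → k ≡ k′
  shape-unique {k = k} {k′} (_ , _ , C) (_ , _ , C′) = trans (sym (decode-profile k))
    (trans (cong decode (trans (sym (profile-copy C)) (profile-copy C′))) (decode-profile k′))

open Profile public using (shape-unique)

-- Number of rank d matrices for each shape

module ShapeCount {order : ℕ} (F : FiniteField order) where

  open FiniteField F
  open Scaling F
  open Rank F
  private
    module R = CommutativeRing commutativeRing
    module RP = RingProperties R.ring
  open ≡-Reasoning

  private
    cells-length : (M : Matching {m} {n} d σ) → length (Matching.cells M) ≡ d
    cells-length M = length-tabulate (λ t → Matching.row M t , Matching.col M t)

  wider-rank : Copy {m} {n} ∅ i σ → {A : Matrix F m n} → support A ≡ σ → rank F A ≡ i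
  wider-rank C {A} = rank-frame C (frame rook) (λ ()) {A}

  count-rook : Copy {m} {n} ∅ i σ → N i σ ≡ w ℕ.^ i
  count-rook {i = i} {σ = σ} C = trans
    (count-rigid i σ (cells-forest M) (cells⊆ M) covered (λ {A} → wider-rank C {A}))
    (cong (w ℕ.^_) (cells-length M))
    where
    M = shape-matching rook C
    covered : ∀ {x y} → (x , y) ∈ᴮ σ → (x , y) ∈ˡ Matching.cells M
    covered e with cells-cover C (frame rook) e
    ... | inj₁ e∈ = e∈

  -- ZG, WRG and WCG have exactly one edge outside the frame matching.
  module _ (k : Kind) (C : Copy {m} {n} (graph k) i σ)
           {s : Fin (rows (graph k))} {t : Fin (cols (graph k))}
           (st∈ : (s , t) ∈ᴮ edges (graph k))
           (unframed : ∀ u → ¬ (Frame.p (frame k) u ≡ s × Frame.q (frame k) u ≡ t))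
           (only : ∀ s′ t′ → (s′ , t′) ∈ᴮ edges (graph k) →
                   (∀ u → ¬ (Frame.p (frame k) u ≡ s′ × Frame.q (frame k) u ≡ t′)) → s′ ≡ s × t′ ≡ t)
           (triangular : ∀ u v → (Frame.p (frame k) u , Frame.q (frame k) v) ∈ᴮ edges (graph k) → toℕ v ≤ toℕ u) where

    open Copy C

    count-tree : N (matchingNumber k ℕ.+ i) σ ≡ w ℕ.^ suc (matchingNumber k ℕ.+ i)
    count-tree = trans
      (count-rigid _ σ (extra-forest M (extra C (frame k) st∈ unframed)) (sound (inj₁ s) (inj₁ t) st∈ ∷ cells⊆ M) covered
        (λ {A} → rank-frame C (frame k) triangular {A}))
      (cong (λ l → w ℕ.^ suc l) (cells-length M))
      where
      M = shape-matching k C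
      covered : ∀ {x y} → (x , y) ∈ᴮ σ → (x , y) ∈ˡ (ρ (inj₁ s) , κ (inj₁ t)) ∷ Matching.cells M
      covered e with cells-cover C (frame k) e
      ... | inj₁ e∈ = there e∈
      ... | inj₂ (s′ , t′ , refl , refl , f , none) with only s′ t′ f none
      ...   | refl , refl = here refl

  count-zg : Copy {m} {n} ZG i σ → N (2 ℕ.+ i) σ ≡ w ℕ.^ (3 ℕ.+ i)
  count-zg C = count-tree zg C {suc zero} {zero} Vec.here (λ { _ (refl , ()) }) only triangular
    where
    only : ∀ s t → (s , t) ∈ᴮ edges ZG → (∀ u → ¬ (u ≡ s × u ≡ t)) → s ≡ suc zero × t ≡ zero
    only zero       zero       _            none = contradiction (refl , refl) (none zero)
    only (suc zero) zero       _            none = refl , refl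
    only (suc zero) (suc zero) _            none = contradiction (refl , refl) (none (suc zero))
    only zero       (suc zero) (Vec.there ()) none
    triangular : ∀ s t → (s , t) ∈ᴮ edges ZG → toℕ t ≤ toℕ s
    triangular _          zero       _              = z≤n
    triangular zero       (suc zero) (Vec.there ())
    triangular (suc zero) (suc zero) _              = s≤s z≤n

  count-wrg : Copy {m} {n} WRG i σ → N (1 ℕ.+ i) σ ≡ w ℕ.^ (2 ℕ.+ i)
  count-wrg C = count-tree wrg C {suc zero} {zero} Vec.here (λ { _ (() , _) }) only (λ { zero zero _ → z≤n })
    where
    only : ∀ s t → (s , t) ∈ᴮ edges WRG → (∀ u → ¬ (zero ≡ s × u ≡ t)) → s ≡ suc zero × t ≡ zero
    only zero       zero _ none = contradiction (refl , refl) (none zero)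
    only (suc zero) zero _ none = refl , refl

  count-wcg : Copy {m} {n} WCG i σ → N (1 ℕ.+ i) σ ≡ w ℕ.^ (2 ℕ.+ i)
  count-wcg C = count-tree wcg C {zero} {suc zero} (Vec.there Vec.here) (λ { _ (_ , ()) }) only (λ { zero zero _ → z≤n })
    where
    only : ∀ s t → (s , t) ∈ᴮ edges WCG → (∀ u → ¬ (u ≡ s × zero ≡ t)) → s ≡ zero × t ≡ suc zero
    only zero zero       _ none = contradiction (refl , refl) (none zero)
    only zero (suc zero) _ none = refl , refl

  sum-pair : (f : Fin k → Carrier) (s t : Fin k) → s ≢ t → (∀ x → x ≢ s → x ≢ t → f x ≡ 0#) → sum f ≡ f s +ᶠ f t
  sum-pair f zero    zero    s≢t _  = contradiction refl s≢t
  sum-pair f zero    (suc t) s≢t ≡0 = cong (f zero +ᶠ_)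
    (sum-single (f ∘ suc) t (λ x x≢t → ≡0 (suc x) (λ ()) (x≢t ∘ Fin.suc-injective)))
  sum-pair f (suc s) zero    s≢t ≡0 = trans (cong (f zero +ᶠ_)
    (sum-single (f ∘ suc) s (λ x x≢s → ≡0 (suc x) (x≢s ∘ Fin.suc-injective) (λ ())))) (R.+-comm _ _)
  sum-pair f (suc s) (suc t) s≢t ≡0 = trans (cong₂ _+ᶠ_ (≡0 zero (λ ()) (λ ()))
    (sum-pair (f ∘ suc) s t (s≢t ∘ cong suc)
      (λ x x≢s x≢t → ≡0 (suc x) (x≢s ∘ Fin.suc-injective) (x≢t ∘ Fin.suc-injective)))) (R.+-identityˡ _)

  *-cancelˡ : ∀ {x y z} → x ≢ 0# → x *ᶠ y ≡ x *ᶠ z → y ≡ z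
  *-cancelˡ {x} {y} {z} x≢0 eq = begin
    y                     ≡⟨ sym (cancel y) ⟩
    inv x≢0 *ᶠ (x *ᶠ y)   ≡⟨ cong (inv x≢0 *ᶠ_) eq ⟩
    inv x≢0 *ᶠ (x *ᶠ z)   ≡⟨ cancel z ⟩
    z                     ∎
    where
    cancel : ∀ y → inv x≢0 *ᶠ (x *ᶠ y) ≡ y
    cancel y = trans (sym (R.*-assoc _ _ _))
      (trans (cong (_*ᶠ y) (trans (R.*-comm _ _) (*-inv x≢0))) (R.*-identityˡ y))

  -- The 2 × 2 block of A is (1 b ; 1 1), so A has full rank unless b = 1.
  module SquareRank {m n i : ℕ} (A : Matrix F m n) (C : Copy SG i (support A)) where

    open Copy C
    open Matching (shape-matching sg C)

    r₀ = ρ (inj₁ zero)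
    r₁ = ρ (inj₁ (suc zero))
    c₀ = κ (inj₁ zero)
    c₁ = κ (inj₁ (suc zero))

    r₀≢r₁ : r₀ ≢ r₁
    r₀≢r₁ eq = contradiction (ρ-inj eq) λ ()

    block-col : ∀ {x} t → (x , κ (inj₁ t)) ∈ᴮ support A → x ≡ r₀ ⊎ x ≡ r₁
    block-col t e with complete _ _ e
    ... | inj₁ zero       , _      , refl , _ , _ = inj₁ refl
    ... | inj₁ (suc zero) , _      , refl , _ , _ = inj₂ refl
    ... | inj₂ _          , inj₂ _ , _    , κ≡ , _ = contradiction (κ-inj κ≡) λ ()

    block-row : ∀ {y} s → (ρ (inj₁ s) , y) ∈ᴮ support A → y ≡ c₀ ⊎ y ≡ c₁
    block-row s e with complete _ _ e
    ... | _      , inj₁ zero       , _  , refl , _ = inj₁ refl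
    ... | _      , inj₁ (suc zero) , _  , refl , _ = inj₂ refl
    ... | inj₂ _ , inj₂ _          , ρ≡ , _    , _ = contradiction (ρ-inj ρ≡) λ ()

    block-cell : ∀ s t → (ρ (inj₁ s) , κ (inj₁ t)) ∈ᴮ support A
    block-cell s t = sound (inj₁ s) (inj₁ t) (full s t)
      where
      full : ∀ s t → (s , t) ∈ᴮ edges SG
      full zero       zero       = Vec.here
      full zero       (suc zero) = Vec.there Vec.here
      full (suc zero) zero       = Vec.here
      full (suc zero) (suc zero) = Vec.there Vec.here

    rows-span : ∀ {x y} → (x , y) ∈ᴮ support A → ∃ λ t → row t ≡ x
    rows-span e with complete _ _ e
    ... | inj₁ zero       , _ , refl , _ = zero , refl
    ... | inj₁ (suc zero) , _ , refl , _ = suc zero , refl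
    ... | inj₂ s          , _ , refl , _ = suc (suc s) , refl

    -- Independent rows are nonzero, hence all of them occur among the `2 + i` rows of the matching;
    -- a set of that size has to contain every one of these.
    independent-full : ∀ S → IndependentRows F A S → ∣ S ∣ ≡ 2 ℕ.+ i → ∀ u → row u ∈ S
    independent-full S ind ∣S∣≡ u = decidable-stable (row u ∈? S) λ u∉S →
      ℕ.1+n≰n (subst (_≤ 1 ℕ.+ i) ∣S∣≡ (∣∣≤ S (row ∘ punchIn u) λ x∈S → cover u∉S x∈S (enum-surjective S x∈S)))
      where
      cover : row u ∉ S → ∀ {x} → x ∈ S → (∃ λ v → enum S v ≡ x) → ∃ λ t → row (punchIn u t) ≡ x
      cover u∉S x∈S (v , refl) with rows-span (proj₂ (proj₂ (independent-row≢0 A S ind)) v)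
      ... | t , eq = punchOut u≢t , trans (cong row (Fin.punchIn-punchOut u≢t)) eq
        where
        u≢t : u ≢ t
        u≢t refl = u∉S (subst (_∈ S) (sym eq) x∈S)

    module _ (a₀₀ : entry F A r₀ c₀ ≡ 1#) (a₁₁ : entry F A r₁ c₁ ≡ 1#) (a₁₀ : entry F A r₁ c₀ ≡ 1#) where

      private
        b = entry F A r₀ c₁

      full-rank : b ≢ 1# → rank F A ≡ 2 ℕ.+ i
      full-rank b≢1 = ℕ.≤-antisym (rank-≤-frame C (frame sg) {A} refl)
        (≤-rank-image A row row-inj λ c _ cA≡0 → vanish c cA≡0)
        where
        module _ (c : Vec Carrier m) (cA≡0 : ∀ y → sum (λ x → lookup c x *ᶠ entry F A x y) ≡ 0#) where

          block-sum : ∀ t → lookup c r₀ *ᶠ entry F A r₀ (κ (inj₁ t)) +ᶠ lookup c r₁ *ᶠ entry F A r₁ (κ (inj₁ t)) ≡ 0#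
          block-sum t = trans (sym (sum-pair (λ x → lookup c x *ᶠ entry F A x (κ (inj₁ t))) r₀ r₁ r₀≢r₁
            λ x x≢r₀ x≢r₁ → trans (cong (lookup c x *ᶠ_)
              (∉support⇒0 A (λ e → Sum.[ x≢r₀ , x≢r₁ ] (block-col t e)))) (R.zeroʳ _)))
            (cA≡0 (κ (inj₁ t)))

          c₁≡ : lookup c r₁ *ᶠ entry F A r₁ c₀ ≡ lookup c r₁ *ᶠ entry F A r₁ c₁
          c₁≡ = cong (lookup c r₁ *ᶠ_) (trans a₁₀ (sym a₁₁))

          vanish₀ : lookup c r₀ ≡ 0#
          -- The equations of the columns `c₀` and `c₁` have the same second term because `a₁₀` and
          -- `a₁₁` are equal. Cancelling it leaves the coefficient of `r₀` times `b` equal to that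
          -- coefficient times 1.
          vanish₀ = decidable-stable (lookup c r₀ ≟ 0#) λ c≢0 → b≢1 (trans
            (*-cancelˡ c≢0 (RP.+-cancelʳ (lookup c r₁ *ᶠ entry F A r₁ c₁) _ _
              (trans (block-sum (suc zero)) (trans (sym (block-sum zero)) (cong (lookup c r₀ *ᶠ entry F A r₀ c₀ +ᶠ_) c₁≡)))))
            a₀₀)

          vanish₁ : lookup c r₁ ≡ 0#
          vanish₁ = begin
            lookup c r₁                                                        ≡⟨ sym (R.*-identityʳ _) ⟩
            lookup c r₁ *ᶠ 1#                                                  ≡⟨ cong (lookup c r₁ *ᶠ_) (sym a₁₀) ⟩
            lookup c r₁ *ᶠ entry F A r₁ c₀                                     ≡⟨ sym (R.+-identityˡ _) ⟩
            0# +ᶠ lookup c r₁ *ᶠ entry F A r₁ c₀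
              ≡⟨ cong (_+ᶠ lookup c r₁ *ᶠ entry F A r₁ c₀) (sym (trans (cong (_*ᶠ entry F A r₀ c₀) vanish₀) (R.zeroˡ _))) ⟩
            lookup c r₀ *ᶠ entry F A r₀ c₀ +ᶠ lookup c r₁ *ᶠ entry F A r₁ c₀   ≡⟨ block-sum zero ⟩
            0#                                                                 ∎

          vanish₂ : ∀ s → lookup c (ρ (inj₂ s)) ≡ 0#
          vanish₂ s = *≡0⇒ (to (∈-support A _ _) (sound (inj₂ s) (inj₂ s) refl)) (trans (R.*-comm _ _)
            (trans (sym (sum-single (λ x → lookup c x *ᶠ entry F A x (κ (inj₂ s))) (ρ (inj₂ s))
                     λ x x≢ → trans (cong (lookup c x *ᶠ_) (∉support⇒0 A (x≢ ∘ same-edge))) (R.zeroʳ _)))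
                   (cA≡0 (κ (inj₂ s)))))
            where
            same-edge : ∀ {x} → (x , κ (inj₂ s)) ∈ᴮ support A → x ≡ ρ (inj₂ s)
            same-edge e with complete _ _ e
            ... | inj₁ _ , inj₁ _  , _    , κ≡ , _    = contradiction (κ-inj κ≡) λ ()
            ... | inj₂ _ , inj₂ s′ , refl , κ≡ , refl = cong ρ (κ-inj κ≡)

          vanish : ∀ t → lookup c (row t) ≡ 0#
          vanish zero          = vanish₀
          vanish (suc zero)    = vanish₁
          vanish (suc (suc s)) = vanish₂ s

      equal-rows : b ≡ 1# → ∀ y → entry F A r₀ y ≡ entry F A r₁ y
      equal-rows b≡1 y with (r₀ , y) ∈ᴮ? support A | (r₁ , y) ∈ᴮ? support A
      ... | no ∉₀ | no ∉₁ = trans (∉support⇒0 A ∉₀) (sym (∉support⇒0 A ∉₁))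
      ... | yes e | _     = on-block (block-row zero e)
        where
        on-block : y ≡ c₀ ⊎ y ≡ c₁ → entry F A r₀ y ≡ entry F A r₁ y
        on-block (inj₁ refl) = trans a₀₀ (sym a₁₀)
        on-block (inj₂ refl) = trans b≡1 (sym a₁₁)
      ... | no ∉₀ | yes e = contradiction (on-block (block-row (suc zero) e)) ∉₀
        where
        on-block : y ≡ c₀ ⊎ y ≡ c₁ → (r₀ , y) ∈ᴮ support A
        on-block (inj₁ refl) = block-cell zero zero
        on-block (inj₂ refl) = block-cell zero (suc zero)

      -- For `b ≡ 1#` the two rows of the block coincide, so the coefficients 1 and -1 on them form
      -- a relation.
      ¬both-independent : b ≡ 1# → ∀ S → IndependentRows F A S → r₀ ∈ S → r₁ ∉ S
      ¬both-independent b≡1 S ind r₀∈S r₁∈S = 1≢0 (trans (sym (trans (lookup∘tabulate f r₀) (f-eq₀ r₀ refl))) (ind c c∉ cA≡0 r₀))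
        where
        g f : Fin m → Carrier
        g x = if does (x Fin.≟ r₁) then -ᶠ 1# else 0#
        f x = if does (x Fin.≟ r₀) then 1# else g x
        f-eq₀ : ∀ x → x ≡ r₀ → f x ≡ 1#
        f-eq₀ x eq = cong (if_then 1# else g x) (dec-true (x Fin.≟ r₀) eq)
        f-eq₁ : ∀ x → x ≡ r₁ → f x ≡ -ᶠ 1#
        f-eq₁ x eq = trans (cong (if_then 1# else g x) (dec-false (x Fin.≟ r₀) λ eq′ → r₀≢r₁ (trans (sym eq′) eq)))
                           (cong (if_then -ᶠ 1# else 0#) (dec-true (x Fin.≟ r₁) eq))
        f-eq₂ : ∀ x → x ≢ r₀ → x ≢ r₁ → f x ≡ 0#
        f-eq₂ x x≢r₀ x≢r₁ = trans (cong (if_then 1# else g x) (dec-false (x Fin.≟ r₀) x≢r₀))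
                                  (cong (if_then -ᶠ 1# else 0#) (dec-false (x Fin.≟ r₁) x≢r₁))
        c = Vec.tabulate f
        c∉ : ∀ x → x ∉ S → lookup c x ≡ 0#
        c∉ x x∉S = trans (lookup∘tabulate f x) (f-eq₂ x (λ { refl → x∉S r₀∈S }) (λ { refl → x∉S r₁∈S }))
        times : ∀ x {z} → f x ≡ z → ∀ y → lookup c x *ᶠ entry F A x y ≡ z *ᶠ entry F A x y
        times x eq y = cong (_*ᶠ entry F A x y) (trans (lookup∘tabulate f x) eq)
        cA≡0 : ∀ y → sum (λ x → lookup c x *ᶠ entry F A x y) ≡ 0#
        cA≡0 y = begin
          sum (λ x → lookup c x *ᶠ entry F A x y)
            ≡⟨ sum-pair (λ x → lookup c x *ᶠ entry F A x y) r₀ r₁ r₀≢r₁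
                 (λ x x≢r₀ x≢r₁ → trans (times x (f-eq₂ x x≢r₀ x≢r₁) y) (R.zeroˡ _)) ⟩
          lookup c r₀ *ᶠ entry F A r₀ y +ᶠ lookup c r₁ *ᶠ entry F A r₁ y
            ≡⟨ cong₂ _+ᶠ_ (trans (times r₀ (f-eq₀ r₀ refl) y) (R.*-identityˡ _))
                          (trans (times r₁ (f-eq₁ r₁ refl) y) (RP.-1*x≈-x _)) ⟩
          entry F A r₀ y +ᶠ -ᶠ entry F A r₁ y
            ≡⟨ cong (_+ᶠ -ᶠ entry F A r₁ y) (equal-rows b≡1 y) ⟩
          entry F A r₁ y +ᶠ -ᶠ entry F A r₁ y
            ≡⟨ R.-‿inverseʳ _ ⟩
          0# ∎

      deficient-rank : b ≡ 1# → rank F A ≢ 2 ℕ.+ i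
      deficient-rank b≡1 rank≡ with rank-attained A
      ... | S , ind , ∣S∣≡ = ¬both-independent b≡1 S ind
        (independent-full S ind (trans ∣S∣≡ rank≡) zero) (independent-full S ind (trans ∣S∣≡ rank≡) (suc zero))

-- The free entry of the square

module SquareCount {order : ℕ} (F : FiniteField order) where

  open FiniteField F
  open Scaling F
  open Rank F
  open ShapeCount F

  neither? : Decidable (λ x → x ≢ 0# × x ≢ 1#)
  neither? x = nonzero? x ×-dec ¬? (x ≟ 1#)

  others : List Carrier
  others = filter neither? elements

  -- So `others` has q - 2 elements. For q = 2 it is empty, and a support with a square then carries
  -- no matrix of rank `2 + i`.
  suc-length-others : suc (length others) ≡ w
  suc-length-others = length-≡ {xs = 1# ∷ others} id id
    (All.tabulate (λ x∈ 1≡x → proj₂ (∈others x∈) (sym 1≡x)) ∷ Unique.filter⁺ neither? elements-unique)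
    (Unique.filter⁺ nonzero? elements-unique)
    (λ { (here refl) → ∈-filter⁺ nonzero? (elements-complete _) 1≢0
       ; (there x∈)  → ∈-filter⁺ nonzero? (elements-complete _) (proj₁ (∈others x∈)) })
    back (λ _ → refl) (λ _ → refl)
    where
    ∈others : ∀ {x} → x ∈ˡ others → x ≢ 0# × x ≢ 1#
    ∈others = proj₂ ∘ ∈-filter⁻ neither? {xs = elements}
    back : ∀ {x} → x ∈ˡ nonzeros → x ∈ˡ 1# ∷ others
    back {x} x∈ with x ≟ 1#
    ... | yes x≡1 = here x≡1
    ... | no  x≢1 = there (∈-filter⁺ neither? (elements-complete x) (proj₂ (∈-filter⁻ nonzero? {xs = elements} x∈) , x≢1))

  count-sg : Copy {m} {n} SG i σ → N (2 ℕ.+ i) σ ≡ w ℕ.^ (3 ℕ.+ i) ℕ.* length others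
  count-sg {m} {n} {i} {σ} C = trans
    (normalise-forest (extra-forest M (extra C (frame sg) {suc zero} {zero} Vec.here λ { _ (refl , ()) }))
                      (sound _ _ Vec.here ∷ cells⊆ M))
    (cong₂ (λ l k → w ℕ.^ suc l ℕ.* k) (length-tabulate (λ t → Matching.row M t , Matching.col M t)) by-entry)
    where
    open Count (2 ℕ.+ i) σ
    open Copy C
    M  = shape-matching sg C
    r₀ = ρ (inj₁ zero)
    r₁ = ρ (inj₁ (suc zero))
    c₀ = κ (inj₁ zero)
    c₁ = κ (inj₁ (suc zero))
    es = (r₁ , c₀) ∷ Matching.cells M

    es⊆σ : All (_∈ᴮ σ) es
    es⊆σ = sound _ _ Vec.here ∷ cells⊆ M

    e₀∈σ : (r₀ , c₁) ∈ᴮ σ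
    e₀∈σ = sound (inj₁ zero) (inj₁ (suc zero)) (Vec.there Vec.here)

    covered : ∀ {x y} → (x , y) ∈ᴮ σ → (x , y) ≢ (r₀ , c₁) → (x , y) ∈ˡ es
    covered e ≢e₀ with cells-cover C (frame sg) e
    ... | inj₁ e∈ = there e∈
    ... | inj₂ (zero     , suc zero , refl , refl , _) = contradiction refl ≢e₀
    ... | inj₂ (suc zero , zero     , refl , refl , _) = here refl
    ... | inj₂ (zero     , zero     , _ , _ , _ , none) = contradiction (refl , refl) (none zero)
    ... | inj₂ (suc zero , suc zero , _ , _ , _ , none) = contradiction (refl , refl) (none (suc zero))

    _≟ᶜ_ = ≡-dec Fin._≟_ Fin._≟_

    uncovered : All (_≢ (r₀ , c₁)) es
    uncovered = (λ eq → contradiction (ρ-inj (cong proj₁ eq)) λ ()) ∷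
      All.tabulate λ e∈ → λ { refl → contradiction e∈ ∉cells }
      where
      ∉cells : ¬ (r₀ , c₁) ∈ˡ Matching.cells M
      ∉cells e∈ with ∈-tabulate⁻ {f = λ t → Matching.row M t , Matching.col M t} e∈
      ... | t , eq = proj₂ (extra C (frame sg) {zero} {suc zero} (Vec.there Vec.here) λ { _ (refl , ()) })
        (t , sym (cong proj₁ eq) , sym (cong proj₂ eq))

    -- On normalised matrices `B` is the inverse of reading off the entry at `(r₀ , c₁)`.
    B : Carrier → Matrix F m n
    B b = matrix λ x y → if does ((x , y) ≟ᶜ (r₀ , c₁)) then b else entry F (indicator σ) x y

    entry-B-e₀ : ∀ b → entry F (B b) r₀ c₁ ≡ b
    entry-B-e₀ b = trans (entry-matrix _ r₀ c₁)
      (cong (if_then b else entry F (indicator σ) r₀ c₁) (dec-true ((r₀ , c₁) ≟ᶜ (r₀ , c₁)) refl))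

    entry-B : ∀ b {x y} → (x , y) ≢ (r₀ , c₁) → entry F (B b) x y ≡ entry F (indicator σ) x y
    entry-B b {x} {y} ≢e₀ = trans (entry-matrix _ x y)
      (cong (if_then b else entry F (indicator σ) x y) (dec-false ((x , y) ≟ᶜ (r₀ , c₁)) ≢e₀))

    ones-B : ∀ b → All (λ (x , y) → entry F (B b) x y ≡ 1#) es
    ones-B b = All.zipWith (λ (e , ≢e₀) → trans (entry-B b ≢e₀) (entry-indicator-∈ σ e)) (es⊆σ , uncovered)

    support-B : ∀ {b} → b ≢ 0# → support (B b) ≡ σ
    support-B {b} b≢0 = support-unique (B b)
      (λ x y e → nonzero e ((x , y) ≟ᶜ (r₀ , c₁)))
      (λ x y ∉ → trans (entry-B b (λ { refl → ∉ e₀∈σ })) (entry-indicator-∉ σ ∉))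
      where
      nonzero : ∀ {x y} → (x , y) ∈ᴮ σ → Dec ((x , y) ≡ (r₀ , c₁)) → entry F (B b) x y ≢ 0#
      nonzero e (yes refl) = b≢0 ∘ trans (sym (entry-B-e₀ b))
      nonzero e (no ≢e₀)   = 1≢0 ∘ trans (sym (trans (entry-B b ≢e₀) (entry-indicator-∈ σ e)))

    -- The list `es` begins with the extra cell, followed by the two frame cells of the square; its
    -- first three ones are therefore the entries of the block other than the free one.
    full : ∀ A → support A ≡ σ → All (λ (x , y) → entry F A x y ≡ 1#) es → entry F A r₀ c₁ ≢ 1# → rank F A ≡ 2 ℕ.+ i
    full A refl (a₁₀ ∷ a₀₀ ∷ a₁₁ ∷ _) = SquareRank.full-rank A C a₀₀ a₁₁ a₁₀

    deficient : ∀ A → support A ≡ σ → All (λ (x , y) → entry F A x y ≡ 1#) es → entry F A r₀ c₁ ≡ 1# → rank F A ≢ 2 ℕ.+ i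
    deficient A refl (a₁₀ ∷ a₀₀ ∷ a₁₁ ∷ _) = SquareRank.deficient-rank A C a₀₀ a₁₁ a₁₀

    B-entry : ∀ {A} → Normal es A → B (entry F A r₀ c₁) ≡ A
    B-entry {A} μ = matrix-ext (B (entry F A r₀ c₁)) A λ x y → eq x y ((x , y) ≟ᶜ (r₀ , c₁)) ((x , y) ∈ᴮ? σ)
      where
      eq : ∀ x y → Dec ((x , y) ≡ (r₀ , c₁)) → Dec ((x , y) ∈ᴮ σ) → entry F (B (entry F A r₀ c₁)) x y ≡ entry F A x y
      eq x y (yes refl) _       = entry-B-e₀ _
      eq x y (no ≢e₀)   (yes e) = trans (entry-B _ ≢e₀)
        (trans (entry-indicator-∈ σ e) (sym (All.lookup (ones μ) (covered e ≢e₀))))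
      eq x y (no ≢e₀)   (no ∉)  = trans (entry-B _ ≢e₀) (trans (entry-indicator-∉ σ ∉)
        (sym (∉support⇒0 A (∉ ∘ subst ((x , y) ∈ᴮ_) (support≡ μ)))))

    by-entry : length (normals es) ≡ length others
    by-entry = length-≡ (λ A → entry F A r₀ c₁) B (normals-unique es) (Unique.filter⁺ neither? elements-unique)
      (λ {A} A∈ → let μ = ∈⇒normal A∈ in ∈-filter⁺ neither? (elements-complete _)
        ( to (∈-support A r₀ c₁) (subst ((r₀ , c₁) ∈ᴮ_) (sym (support≡ μ)) e₀∈σ)
        , λ b≡1 → deficient A (support≡ μ) (ones μ) b≡1 (rank≡ μ)))
      (λ {b} b∈ → let (b≢0 , b≢1) = proj₂ (∈-filter⁻ neither? {xs = elements} b∈) in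
        normal⇒∈ (normal (full (B b) (support-B b≢0) (ones-B b) (b≢1 ∘ trans (sym (entry-B-e₀ b)))) (support-B b≢0) (ones-B b)))
      (λ A∈ → B-entry (∈⇒normal A∈))
      (λ {b} _ → entry-B-e₀ b)

-- Summation over supports

cellAt : (B : Board m n) → Fin (size B) → Cell m n
cellAt (S ∷ B) t = Sum.[ (λ s → zero , enum S s) , (λ s → suc (proj₁ (cellAt B s)) , proj₂ (cellAt B s)) ] (splitAt ∣ S ∣ t)

cellAt-∈ : (B : Board m n) → ∀ t → cellAt B t ∈ᴮ B
cellAt-∈ (S ∷ B) t with splitAt ∣ S ∣ t
... | inj₁ s = enum-∈ S s
... | inj₂ s = cellAt-∈ B s

cellAt-injective : (B : Board m n) → Injective _≡_ _≡_ (cellAt B)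
cellAt-injective (S ∷ B) {s} {t} eq = splitAt-injective ∣ S ∣ (go (splitAt ∣ S ∣ s) (splitAt ∣ S ∣ t) eq)
  where
  at : Fin ∣ S ∣ ⊎ Fin (size B) → Cell _ _
  at = Sum.[ (λ s → zero , enum S s) , (λ s → suc (proj₁ (cellAt B s)) , proj₂ (cellAt B s)) ]
  go : ∀ u v → at u ≡ at v → u ≡ v
  go (inj₁ u) (inj₁ v) eq = cong inj₁ (enum-injective S (cong proj₂ eq))
  go (inj₁ u) (inj₂ v) eq = contradiction (cong proj₁ eq) λ ()
  go (inj₂ u) (inj₁ v) eq = contradiction (cong proj₁ eq) λ ()
  go (inj₂ u) (inj₂ v) eq = cong inj₂ (cellAt-injective B
    (cong₂ _,_ (Fin.suc-injective (cong proj₁ eq)) (cong proj₂ eq)))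

cellAt-surjective : (B : Board m n) → ∀ {x y} → (x , y) ∈ᴮ B → ∃ λ t → cellAt B t ≡ (x , y)
cellAt-surjective (S ∷ B) {zero} y∈S with enum-surjective S y∈S
... | s , refl = s ↑ˡ size B ,
  cong Sum.[ (λ s → zero , enum S s) , (λ s → suc (proj₁ (cellAt B s)) , proj₂ (cellAt B s)) ] (Fin.splitAt-↑ˡ ∣ S ∣ s (size B))
cellAt-surjective (S ∷ B) {suc x} e with cellAt-surjective B e
... | s , refl = ∣ S ∣ ↑ʳ s ,
  cong Sum.[ (λ s → zero , enum S s) , (λ s → suc (proj₁ (cellAt B s)) , proj₂ (cellAt B s)) ] (Fin.splitAt-↑ʳ ∣ S ∣ (size B) s)

-- In a rook placement every cell is the only one in its row and column, hence a component `E`.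
-- Numbering the cells by `cellAt` supplies the index set `Fin d` of the copy; conversely the copy
-- is a second numbering, and comparing the two gives the size.
rook⇔copy : ∀ d (σ : Board m n) → (size σ ≡ d × NonAttacking σ) ⇔ Copy ∅ d σ
rook⇔copy {m} {n} d σ = mk⇔ into back
  where
  into : size σ ≡ d × NonAttacking σ → Copy ∅ d σ
  into (refl , nonAttacking) = record
    { ρ        = λ { (inj₂ t) → proj₁ (cellAt σ t) }
    ; κ        = λ { (inj₂ t) → proj₂ (cellAt σ t) }
    ; ρ-inj    = λ { {inj₂ s} {inj₂ t} eq → cong inj₂ (same λ ≢ → contradiction eq (proj₁ (attack s t ≢))) }
    ; κ-inj    = λ { {inj₂ s} {inj₂ t} eq → cong inj₂ (same λ ≢ → contradiction eq (proj₂ (attack s t ≢))) }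
    ; sound    = λ { (inj₂ s) (inj₂ .s) refl → cellAt-∈ σ s }
    ; complete = λ x y e → let (t , eq) = cellAt-surjective σ e in
        inj₂ t , inj₂ t , cong proj₁ eq , cong proj₂ eq , refl
    }
    where
    attack : ∀ s t → cellAt σ s ≢ cellAt σ t →
             proj₁ (cellAt σ s) ≢ proj₁ (cellAt σ t) × proj₂ (cellAt σ s) ≢ proj₂ (cellAt σ t)
    attack s t = nonAttacking _ _ _ _ (cellAt-∈ σ s) (cellAt-∈ σ t)
    same : ∀ {s t} → ¬ (cellAt σ s ≢ cellAt σ t) → s ≡ t
    same {s} {t} ¬≢ = cellAt-injective σ (decidable-stable (≡-dec Fin._≟_ Fin._≟_ (cellAt σ s) (cellAt σ t)) ¬≢)
  back : Copy ∅ d σ → size σ ≡ d × NonAttacking σ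
  back C = ℕ.≤-antisym size≤d d≤size , nonAttacking
    where
    open Copy C
    position : ∀ {x y} → (x , y) ∈ᴮ σ → ∃ λ t → (ρ (inj₂ t) , κ (inj₂ t)) ≡ (x , y)
    position {x} {y} e with complete x y e
    ... | inj₂ t , inj₂ .t , refl , refl , refl = t , refl
    d≤size : d ℕ.≤ size σ
    d≤size = Fin.injective⇒≤ {f = λ t → proj₁ (index t)} λ {s} {t} eq → inj₂-injective (ρ-inj
      (cong proj₁ (trans (sym (proj₂ (index s))) (trans (cong (cellAt σ) eq) (proj₂ (index t))))))
      where
      index = λ t → cellAt-surjective σ (sound (inj₂ t) (inj₂ t) refl)
    size≤d : size σ ℕ.≤ d
    size≤d = Fin.injective⇒≤ {f = λ t → proj₁ (position (cellAt-∈ σ t))} λ {s} {t} eq → cellAt-injective σ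
      (trans (sym (proj₂ (position (cellAt-∈ σ s))))
        (trans (cong (λ u → ρ (inj₂ u) , κ (inj₂ u)) eq) (proj₂ (position (cellAt-∈ σ t)))))
    nonAttacking : NonAttacking σ
    nonAttacking x y x′ y′ e e′ ≢ with position e | position e′
    ... | s , refl | t , refl =
      (λ ρ≡ → ≢ (cong (λ { (inj₂ u) → ρ (inj₂ u) , κ (inj₂ u) }) (ρ-inj ρ≡))) ,
      (λ κ≡ → ≢ (cong (λ { (inj₂ u) → ρ (inj₂ u) , κ (inj₂ u) }) (κ-inj κ≡)))

-- Shapes as contributions to the coefficients

rooks? : ∀ d (σ : Board m n) → Dec (size σ ≡ d × NonAttacking σ)
rooks? d σ = (size σ ℕ.≟ d) ×-dec nonAttacking? σ

abstract

  -- The contribution of a single board to `r[_,_]`, negative indices included; opaque for the same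
  -- reason as the Iverson bracket.
  isoHit : BiGraph → ℤ → Board m n → ℕ
  isoHit {m} {n} F (+ i)    σ = ⟦ G σ ≅? padded m n F i ⟧
  isoHit         F -[1+ _ ] σ = 0

  isoHit-+ : ∀ F {z} i (σ : Board m n) → z ≡ + i → isoHit F z σ ≡ ⟦ G σ ≅? padded m n F i ⟧
  isoHit-+ F i σ refl = refl

  isoHit-− : ∀ F i (σ : Board m n) → isoHit F -[1+ i ] σ ≡ 0
  isoHit-− F i σ = refl

-- What `σ` adds to the coefficient of its kind when it lies in `B`; whether it does is decided only
-- in the final summation.
hit : Kind → ℕ → Board m n → ℕ
hit rook d σ = ⟦ rooks? d σ ⟧
hit zg   d σ = isoHit ZG  (+ d - + 2) σ
hit sg   d σ = isoHit SG  (+ d - + 2) σ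
hit wrg  d σ = isoHit WRG (+ d - + 1) σ
hit wcg  d σ = isoHit WCG (+ d - + 1) σ

data HitSpec (k : Kind) (d : ℕ) (σ : Board m n) : Set where
  hits   : hit k d σ ≡ 1 → Shape k d σ → HitSpec k d σ
  misses : hit k d σ ≡ 0 → ¬ Shape k d σ → HitSpec k d σ

decideHit : ∀ {P : Set} k d (σ : Board m n) (p? : Dec P) → hit k d σ ≡ ⟦ p? ⟧ → P ⇔ Shape k d σ → HitSpec k d σ
decideHit k d σ (yes p) eq P⇔ = hits (trans eq (⟦⟧-yes (yes p) p)) (to P⇔ p)
decideHit k d σ (no ¬p) eq P⇔ = misses (trans eq (⟦⟧-no (no ¬p) ¬p)) (¬p ∘ from P⇔)

copy⇔shape : ∀ k i (σ : Board m n) → Copy (graph k) i σ ⇔ Shape k (matchingNumber k ℕ.+ i) σ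
copy⇔shape k i σ = mk⇔ (λ C → i , refl , C) λ (j , eq , C) →
  subst (λ i → Copy (graph k) i σ) (sym (ℕ.+-cancelˡ-≡ (matchingNumber k) i j eq)) C

iso⇔shape : ∀ k F → F ≡ graph k → ∀ i (σ : Board m n) →
            G σ ≅ padded m n F i ⇔ Shape k (matchingNumber k ℕ.+ i) σ
iso⇔shape k _ refl i σ = mk⇔ (to (copy⇔shape k i σ) ∘ to (≅padded⇔Copy (graph k) i σ))
                      (from (≅padded⇔Copy (graph k) i σ) ∘ from (copy⇔shape k i σ))

hitSpec : ∀ k d (σ : Board m n) → HitSpec k d σ
hitSpec rook d σ = decideHit rook d σ (rooks? d σ) refl
  (mk⇔ (to (copy⇔shape rook d σ) ∘ to (rook⇔copy d σ)) (from (rook⇔copy d σ) ∘ from (copy⇔shape rook d σ)))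
-- The index 0 - 2 evaluates to `-[1+ 1 ]`, where the contribution is 0 by convention; at the same
-- time 0 is not of the form `2 + i`, so no shape exists.
hitSpec zg  zero          σ = misses (isoHit-− ZG 1 σ) λ { (_ , () , _) }
hitSpec zg  (suc zero)    σ = misses (isoHit-− ZG 0 σ) λ { (_ , () , _) }
hitSpec {m} {n} zg  (suc (suc i)) σ = decideHit zg (2 ℕ.+ i) σ (G σ ≅? padded m n ZG i)
  (isoHit-+ ZG i σ refl) (iso⇔shape zg ZG refl i σ)
hitSpec sg  zero          σ = misses (isoHit-− SG 1 σ) λ { (_ , () , _) }
hitSpec sg  (suc zero)    σ = misses (isoHit-− SG 0 σ) λ { (_ , () , _) }
hitSpec {m} {n} sg  (suc (suc i)) σ = decideHit sg (2 ℕ.+ i) σ (G σ ≅? padded m n SG i)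
  (isoHit-+ SG i σ refl) (iso⇔shape sg SG refl i σ)
hitSpec wrg zero          σ = misses (isoHit-− WRG 0 σ) λ { (_ , () , _) }
hitSpec {m} {n} wrg (suc i)       σ = decideHit wrg (1 ℕ.+ i) σ (G σ ≅? padded m n WRG i)
  (isoHit-+ WRG i σ refl) (iso⇔shape wrg WRG refl i σ)
hitSpec wcg zero          σ = misses (isoHit-− WCG 0 σ) λ { (_ , () , _) }
hitSpec {m} {n} wcg (suc i)       σ = decideHit wcg (1 ℕ.+ i) σ (G σ ≅? padded m n WCG i)
  (isoHit-+ WCG i σ refl) (iso⇔shape wcg WCG refl i σ)

shape? : ∀ k d (σ : Board m n) → Dec (Shape k d σ)
shape? k d σ with hitSpec k d σ
... | hits _ s    = yes s
... | misses _ ¬s = no ¬s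

hit≡1 : ∀ {k} → Shape k d σ → hit k d σ ≡ 1
hit≡1 {d = d} {σ = σ} {k} s with hitSpec k d σ
... | hits eq _   = eq
... | misses _ ¬s = contradiction s ¬s

hit≡0 : ∀ k → ¬ Shape k d σ → hit k d σ ≡ 0
hit≡0 {d = d} {σ = σ} k ¬s with hitSpec k d σ
... | hits _ s    = contradiction s ¬s
... | misses eq _ = eq

anyShape? : ∀ d (σ : Board m n) → Dec (∃ λ k → Shape k d σ)
anyShape? d σ with shape? rook d σ | shape? zg d σ | shape? sg d σ | shape? wrg d σ | shape? wcg d σ
... | yes s | _ | _ | _ | _ = yes (rook , s)
... | _ | yes s | _ | _ | _ = yes (zg , s)
... | _ | _ | yes s | _ | _ = yes (sg , s)
... | _ | _ | _ | yes s | _ = yes (wrg , s)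
... | _ | _ | _ | _ | yes s = yes (wcg , s)
... | no ¬r | no ¬z | no ¬s | no ¬a | no ¬b = no λ where
  (rook , s) → ¬r s
  (zg   , s) → ¬z s
  (sg   , s) → ¬s s
  (wrg  , s) → ¬a s
  (wcg  , s) → ¬b s

-- The right side of the theorem times (q - 1)^d, with `t` collecting the error term modulo (q -
-- 1)^2. It is additive in `h` and `t` jointly, which reduces the board to its single supports.
estimate : ℤ → ℕ → (Kind → ℕ) → ℤ → ℤ
estimate W d h t = (+ h rook + W * (+ h zg - + h sg + + h wrg + + h wcg) + t * (W * W)) * W ^ d

estimate-cong : ∀ W d (h h′ : Kind → ℕ) t → (∀ k → h k ≡ h′ k) → estimate W d h t ≡ estimate W d h′ t
estimate-cong W d h h′ t eq rewrite eq rook | eq zg | eq sg | eq wrg | eq wcg = refl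

estimate-+ : ∀ W d (h h′ : Kind → ℕ) t t′ →
             estimate W d h t + estimate W d h′ t′ ≡ estimate W d (λ k → h k ℕ.+ h′ k) (t + t′)
estimate-+ W d h h′ t t′
  rewrite ℤ.pos-+ (h rook) (h′ rook) | ℤ.pos-+ (h zg) (h′ zg) | ℤ.pos-+ (h sg) (h′ sg)
        | ℤ.pos-+ (h wrg) (h′ wrg) | ℤ.pos-+ (h wcg) (h′ wcg) =
  solve 14 (λ W X r z s a b t r′ z′ s′ a′ b′ t′ →
      (r :+ W :* (z :- s :+ a :+ b) :+ t :* (W :* W)) :* X :+ (r′ :+ W :* (z′ :- s′ :+ a′ :+ b′) :+ t′ :* (W :* W)) :* X
      := ((r :+ r′) :+ W :* ((z :+ z′) :- (s :+ s′) :+ (a :+ a′) :+ (b :+ b′)) :+ (t :+ t′) :* (W :* W)) :* X)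
    refl W (W ^ d) (+ h rook) (+ h zg) (+ h sg) (+ h wrg) (+ h wcg) t (+ h′ rook) (+ h′ zg) (+ h′ sg) (+ h′ wrg) (+ h′ wcg) t′
  where open +-*-Solver

pos-^ : ∀ w k → + (w ℕ.^ k) ≡ (+ w) ^ k
pos-^ w zero    = refl
pos-^ w (suc k) = trans (ℤ.pos-* w (w ℕ.^ k)) (cong (+ w *_) (pos-^ w k))

δ : Kind → Kind → ℕ
δ rook rook = 1
δ zg   zg   = 1
δ sg   sg   = 1
δ wrg  wrg  = 1
δ wcg  wcg  = 1
δ _    _    = 0

other-hit≡0 : ∀ {k} k′ → Shape k d σ → k ≢ k′ → hit k′ d σ ≡ 0
other-hit≡0 {k = k} k′ s k≢k′ = hit≡0 k′ λ s′ → k≢k′ (shape-unique {k = k} {k′} s s′)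

hit≡δ : ∀ k → Shape k d σ → ∀ k′ → hit k′ d σ ≡ δ k k′
hit≡δ rook s = λ where
  rook → hit≡1 {k = rook} s
  zg   → other-hit≡0 {k = rook} zg s λ ()
  sg   → other-hit≡0 {k = rook} sg s λ ()
  wrg  → other-hit≡0 {k = rook} wrg s λ ()
  wcg  → other-hit≡0 {k = rook} wcg s λ ()
hit≡δ zg s = λ where
  rook → other-hit≡0 {k = zg} rook s λ ()
  zg   → hit≡1 {k = zg} s
  sg   → other-hit≡0 {k = zg} sg s λ ()
  wrg  → other-hit≡0 {k = zg} wrg s λ ()
  wcg  → other-hit≡0 {k = zg} wcg s λ ()
hit≡δ sg s = λ where
  rook → other-hit≡0 {k = sg} rook s λ ()
  zg   → other-hit≡0 {k = sg} zg s λ ()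
  sg   → hit≡1 {k = sg} s
  wrg  → other-hit≡0 {k = sg} wrg s λ ()
  wcg  → other-hit≡0 {k = sg} wcg s λ ()
hit≡δ wrg s = λ where
  rook → other-hit≡0 {k = wrg} rook s λ ()
  zg   → other-hit≡0 {k = wrg} zg s λ ()
  sg   → other-hit≡0 {k = wrg} sg s λ ()
  wrg  → hit≡1 {k = wrg} s
  wcg  → other-hit≡0 {k = wrg} wcg s λ ()
hit≡δ wcg s = λ where
  rook → other-hit≡0 {k = wcg} rook s λ ()
  zg   → other-hit≡0 {k = wcg} zg s λ ()
  sg   → other-hit≡0 {k = wcg} sg s λ ()
  wrg  → other-hit≡0 {k = wcg} wrg s λ ()
  wcg  → hit≡1 {k = wcg} s

-- From one support to the whole board

module Assembly {order : ℕ} (F : FiniteField order) where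

  open FiniteField F using (elements; Carrier)
  open Scaling F
  open Rank F
  open ShapeCount F
  open SquareCount F
  open ≡-Reasoning

  W : ℤ
  W = + w

  count-shape : ∀ k → Shape k d σ → ∃ λ t → + N d σ ≡ estimate W d (δ k) t
  count-shape rook (i , refl , C) = + 0 , trans (cong +_ (count-rook C)) (trans (pos-^ w i)
    (solve 2 (λ W X → X := (con (+ 1) :+ W :* (con (+ 0) :- con (+ 0) :+ con (+ 0) :+ con (+ 0)) :+ con (+ 0) :* (W :* W)) :* X) refl W (W ^ i)))
    where open +-*-Solver
  count-shape zg (i , refl , C) = + 0 , trans (cong +_ (count-zg C)) (trans (pos-^ w (3 ℕ.+ i))
    (solve 2 (λ W X → W :* X := (con (+ 0) :+ W :* (con (+ 1) :- con (+ 0) :+ con (+ 0) :+ con (+ 0)) :+ con (+ 0) :* (W :* W)) :* X) refl W (W ^ (2 ℕ.+ i))))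
    where open +-*-Solver
  count-shape wrg (i , refl , C) = + 0 , trans (cong +_ (count-wrg C)) (trans (pos-^ w (2 ℕ.+ i))
    (solve 2 (λ W X → W :* X := (con (+ 0) :+ W :* (con (+ 0) :- con (+ 0) :+ con (+ 1) :+ con (+ 0)) :+ con (+ 0) :* (W :* W)) :* X) refl W (W ^ (1 ℕ.+ i))))
    where open +-*-Solver
  count-shape wcg (i , refl , C) = + 0 , trans (cong +_ (count-wcg C)) (trans (pos-^ w (2 ℕ.+ i))
    (solve 2 (λ W X → W :* X := (con (+ 0) :+ W :* (con (+ 0) :- con (+ 0) :+ con (+ 0) :+ con (+ 1)) :+ con (+ 0) :* (W :* W)) :* X) refl W (W ^ (1 ℕ.+ i))))
    where open +-*-Solver
  -- With V = q - 2 and W = 1 + V, the factor W V equals -W + W^2. This is the origin of the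
  -- negative sign of `SG` and of the error term `t` = 1.
  count-shape {σ = σ} sg (i , refl , C) = + 1 , (begin
    + N (2 ℕ.+ i) σ
      ≡⟨ cong +_ (count-sg C) ⟩
    + (w ℕ.^ (3 ℕ.+ i) ℕ.* length others)
      ≡⟨ ℤ.pos-* (w ℕ.^ (3 ℕ.+ i)) (length others) ⟩
    + (w ℕ.^ (3 ℕ.+ i)) * + length others
      ≡⟨ cong (_* + length others) (pos-^ w (3 ℕ.+ i)) ⟩
    W ^ (3 ℕ.+ i) * + length others
      ≡⟨ cong (λ v → v ^ (3 ℕ.+ i) * + length others) W≡ ⟩
    (1ℤ + V) * (1ℤ + V) ^ (2 ℕ.+ i) * V
      ≡⟨ solve 2 (λ V X → (con 1ℤ :+ V) :* X :* V :=
           (con (+ 0) :+ (con 1ℤ :+ V) :* (con (+ 0) :- con (+ 1) :+ con (+ 0) :+ con (+ 0)) :+ con (+ 1) :* ((con 1ℤ :+ V) :* (con 1ℤ :+ V))) :* X)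
           refl V ((1ℤ + V) ^ (2 ℕ.+ i)) ⟩
    estimate (1ℤ + V) (2 ℕ.+ i) (δ sg) (+ 1)
      ≡⟨ cong (λ v → estimate v (2 ℕ.+ i) (δ sg) (+ 1)) (sym W≡) ⟩
    estimate W (2 ℕ.+ i) (δ sg) (+ 1) ∎)
    where
    open +-*-Solver
    V = + length others
    W≡ : W ≡ 1ℤ + V
    W≡ = cong +_ (sym suc-length-others)

  -- Either nothing is counted, and `t` is 0, or one counted matrix already provides the matching
  -- that the classification starts from. Of its outcomes only a large forest is then compatible
  -- with the absence of a shape and with rank `d`.
  count-shapeless : (¬ ∃ λ k → Shape k d σ) → ∃ λ t → + N d σ ≡ estimate W d (λ _ → 0) t
  count-shapeless {d = d} {σ = σ} none = go (normals []) refl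
    where
    open Count d σ
    zero-estimate : ∀ t → t * (W * (W * W ^ d)) ≡ estimate W d (λ _ → 0) t
    zero-estimate t = solve 3 (λ t W X → t :* (W :* (W :* X)) :=
      (con (+ 0) :+ W :* (con (+ 0) :- con (+ 0) :+ con (+ 0) :+ con (+ 0)) :+ t :* (W :* W)) :* X) refl t W (W ^ d)
      where open +-*-Solver
    divisible : Classification d σ → ∀ {A} → Normal [] A → ∃ λ t → + length (normals []) ≡ estimate W d (λ _ → 0) t
    divisible (shape k s) _     = contradiction (k , s) none
    divisible (wider C) {A} μ   = contradiction (trans (sym (wider-rank C {A} (support≡ μ))) (rank≡ μ)) ℕ.1+n≢n
    divisible (large {es} forest es⊆σ length≡) _ = + length (normals es) , (begin
      + length (normals [])                               ≡⟨ cong +_ (normalise-forest forest es⊆σ) ⟩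
      + (w ℕ.^ length es ℕ.* length (normals es))         ≡⟨ cong (λ l → + (w ℕ.^ l ℕ.* length (normals es))) length≡ ⟩
      + (w ℕ.^ (2 ℕ.+ d) ℕ.* length (normals es))         ≡⟨ ℤ.pos-* (w ℕ.^ (2 ℕ.+ d)) (length (normals es)) ⟩
      + (w ℕ.^ (2 ℕ.+ d)) * + length (normals es)         ≡⟨ cong (_* + length (normals es)) (pos-^ w (2 ℕ.+ d)) ⟩
      W ^ (2 ℕ.+ d) * + length (normals es)               ≡⟨ ℤ.*-comm (W ^ (2 ℕ.+ d)) (+ length (normals es)) ⟩
      + length (normals es) * W ^ (2 ℕ.+ d)               ≡⟨ zero-estimate (+ length (normals es)) ⟩
      estimate W d (λ _ → 0) (+ length (normals es))      ∎)

    normal-matching : ∀ {A} → Normal [] A → Matching d σ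
    normal-matching {A} μ = subst₂ Matching (rank≡ μ) (support≡ μ) (rank-matching A)

    go : ∀ As → normals [] ≡ As → ∃ λ t → + length (normals []) ≡ estimate W d (λ _ → 0) t
    go [] eq = + 0 , trans (cong (+_ ∘ length) eq) (trans (sym (ℤ.*-zeroˡ (W * (W * W ^ d)))) (zero-estimate (+ 0)))
    go (A ∷ As) eq = divisible (classify (normal-matching μ)) μ
      where
      μ : Normal [] A
      μ = ∈⇒normal (subst (A ∈ˡ_) (sym eq) (here refl))

  count-estimate : ∀ d (σ : Board m n) → ∃ λ t → + N d σ ≡ estimate W d (λ k → hit k d σ) t
  count-estimate d σ with anyShape? d σ
  ... | yes (k , s) = let (t , eq) = count-shape k s in
    t , trans eq (estimate-cong W d (δ k) (λ k → hit k d σ) t (sym ∘ hit≡δ k s))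
  ... | no none = let (t , eq) = count-shapeless none in
    t , trans eq (estimate-cong W d (λ _ → 0) (λ k → hit k d σ) t (λ k → sym (hit≡0 k (λ s → none (k , s)))))

  module _ {m n : ℕ} (d : ℕ) (B : Board m n) where

    -- The number `r[_,_]` with the list of boards as a variable, so that the summation can go by
    -- induction on the list.
    isoCount : BiGraph → ℤ → List (Board m n) → ℕ
    isoCount H (+ i)    L = length (filter (λ σ → (σ ⊆ᴮ? B) ×-dec (G σ ≅? padded m n H i)) L)
    isoCount H -[1+ _ ] L = 0

    count : Kind → List (Board m n) → ℕ
    count rook L = length (filter (λ σ → (σ ⊆ᴮ? B) ×-dec rooks? d σ) L)
    count zg   L = isoCount ZG  (+ d - + 2) L
    count sg   L = isoCount SG  (+ d - + 2) L
    count wrg  L = isoCount WRG (+ d - + 1) L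
    count wcg  L = isoCount WCG (+ d - + 1) L

    r≡isoCount : ∀ H z → r[ H , z ] B ≡ isoCount H z (boards m n)
    r≡isoCount H (+ _)    = refl
    r≡isoCount H -[1+ _ ] = refl

    module _ {P : Board m n → Set} (P? : Decidable P) where

      filter-⊆ : ∀ {σ} → σ ⊆ᴮ B → ∀ L →
                 length (filter (λ σ → (σ ⊆ᴮ? B) ×-dec P? σ) (σ ∷ L)) ≡
                 ⟦ P? σ ⟧ ℕ.+ length (filter (λ σ → (σ ⊆ᴮ? B) ×-dec P? σ) L)
      filter-⊆ {σ} σ⊆B L = trans (length-filter-∷ (λ σ → (σ ⊆ᴮ? B) ×-dec P? σ) σ L)
        (cong (ℕ._+ length (filter (λ σ → (σ ⊆ᴮ? B) ×-dec P? σ) L))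
              (⟦⟧-cong (mk⇔ proj₂ (σ⊆B ,_)) ((σ ⊆ᴮ? B) ×-dec P? σ) (P? σ)))

      filter-⊈ : ∀ {σ} → ¬ σ ⊆ᴮ B → ∀ L →
                 length (filter (λ σ → (σ ⊆ᴮ? B) ×-dec P? σ) (σ ∷ L)) ≡
                 length (filter (λ σ → (σ ⊆ᴮ? B) ×-dec P? σ) L)
      filter-⊈ {σ} σ⊈B L = trans (length-filter-∷ (λ σ → (σ ⊆ᴮ? B) ×-dec P? σ) σ L)
        (cong (ℕ._+ length (filter (λ σ → (σ ⊆ᴮ? B) ×-dec P? σ) L))
              (⟦⟧-no ((σ ⊆ᴮ? B) ×-dec P? σ) (σ⊈B ∘ proj₁)))

    isoCount-⊆ : ∀ H z {σ} → σ ⊆ᴮ B → ∀ L → isoCount H z (σ ∷ L) ≡ isoHit H z σ ℕ.+ isoCount H z L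
    isoCount-⊆ H (+ i)    {σ} σ⊆B L = trans (filter-⊆ (λ σ → G σ ≅? padded m n H i) σ⊆B L)
      (cong (ℕ._+ isoCount H (+ i) L) (sym (isoHit-+ H i σ refl)))
    isoCount-⊆ H -[1+ i ] {σ} σ⊆B L = cong (ℕ._+ 0) (sym (isoHit-− H i σ))

    isoCount-⊈ : ∀ H z {σ} → ¬ σ ⊆ᴮ B → ∀ L → isoCount H z (σ ∷ L) ≡ isoCount H z L
    isoCount-⊈ H (+ i)    σ⊈B L = filter-⊈ (λ σ → G σ ≅? padded m n H i) σ⊈B L
    isoCount-⊈ H -[1+ _ ] σ⊈B L = refl

    count-⊆ : ∀ k {σ} → σ ⊆ᴮ B → ∀ L → count k (σ ∷ L) ≡ hit k d σ ℕ.+ count k L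
    count-⊆ rook σ⊆B L = filter-⊆ (rooks? d) σ⊆B L
    count-⊆ zg   σ⊆B L = isoCount-⊆ ZG  (+ d - + 2) σ⊆B L
    count-⊆ sg   σ⊆B L = isoCount-⊆ SG  (+ d - + 2) σ⊆B L
    count-⊆ wrg  σ⊆B L = isoCount-⊆ WRG (+ d - + 1) σ⊆B L
    count-⊆ wcg  σ⊆B L = isoCount-⊆ WCG (+ d - + 1) σ⊆B L

    count-⊈ : ∀ k {σ} → ¬ σ ⊆ᴮ B → ∀ L → count k (σ ∷ L) ≡ count k L
    count-⊈ rook σ⊈B L = filter-⊈ (rooks? d) σ⊈B L
    count-⊈ zg   σ⊈B L = isoCount-⊈ ZG  (+ d - + 2) σ⊈B L
    count-⊈ sg   σ⊈B L = isoCount-⊈ SG  (+ d - + 2) σ⊈B L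
    count-⊈ wrg  σ⊈B L = isoCount-⊈ WRG (+ d - + 1) σ⊈B L
    count-⊈ wcg  σ⊈B L = isoCount-⊈ WCG (+ d - + 1) σ⊈B L

    abstract

      ranked : List (Matrix F m n)
      ranked = filter (λ A → (rank F A ℕ.≟ d) ×-dec supportedIn? F B A) (matrices F m n)

      ranked-length : length ranked ≡ 𝔪 F d B
      ranked-length = refl

      ranked-unique : Unique ranked
      ranked-unique = Unique.filter⁺ _ (matrices-unique m n)

      ∈-ranked : ∀ A → A ∈ˡ ranked ⇔ (rank F A ≡ d × SupportedIn F B A)
      ∈-ranked A = mk⇔ (proj₂ ∘ ∈-filter⁻ (λ A → (rank F A ℕ.≟ d) ×-dec supportedIn? F B A) {xs = matrices F m n})
        (∈-filter⁺ (λ A → (rank F A ℕ.≟ d) ×-dec supportedIn? F B A) (matrices-complete m n A))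

    fibre : Board m n → List (Matrix F m n)
    fibre σ = filter (λ A → support A ≟ᴮ σ) ranked

    ∈-fibre⁻ : ∀ {σ A} → A ∈ˡ fibre σ → (rank F A ≡ d × SupportedIn F B A) × support A ≡ σ
    ∈-fibre⁻ {σ} {A} A∈ with ∈-filter⁻ (λ A → support A ≟ᴮ σ) {xs = ranked} A∈
    ... | A∈ranked , sup = to (∈-ranked A) A∈ranked , sup

    -- Once the support is exactly `σ` and `σ` lies in `B`, the condition of being supported in `B`
    -- is automatic, and the fibre is what `Count` counts for the empty forest.
    fibre-⊆ : ∀ {σ} → σ ⊆ᴮ B → length (fibre σ) ≡ N d σ
    fibre-⊆ {σ} σ⊆B = length-≡ id id (Unique.filter⁺ (λ A → support A ≟ᴮ σ) ranked-unique) (normals-unique [])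
      (λ A∈ → let ((rk , _) , sup) = ∈-fibre⁻ A∈ in normal⇒∈ (normal rk sup []))
      (λ {A} A∈ → let μ = ∈⇒normal A∈ in ∈-filter⁺ (λ A → support A ≟ᴮ σ)
        (from (∈-ranked A) (rank≡ μ , λ x y ≢0 → σ⊆B x y (subst ((x , y) ∈ᴮ_) (support≡ μ) (from (∈-support A x y) ≢0))))
        (support≡ μ))
      (λ _ → refl) (λ _ → refl)
      where open Count d σ

    fibre-⊈ : ∀ {σ} → ¬ σ ⊆ᴮ B → length (fibre σ) ≡ 0
    fibre-⊈ {σ} σ⊈B = length-empty (fibre σ) λ {A} A∈ → let ((_ , sup⊆B) , sup) = ∈-fibre⁻ A∈ in
      σ⊈B (λ x y e → sup⊆B x y (to (∈-support A x y) (subst ((x , y) ∈ᴮ_) (sym sup) e)))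

    sum-estimate : ∀ L → ∃ λ t → + ℕ.sum (map (length ∘ fibre) L) ≡ estimate W d (λ k → count k L) t
    sum-estimate [] = + 0 , trans zero-estimate (estimate-cong W d (λ _ → 0) (λ k → count k []) (+ 0) (λ k → sym (count-[] k)))
      where
      open +-*-Solver
      zero-estimate : + 0 ≡ estimate W d (λ _ → 0) (+ 0)
      zero-estimate = solve 2 (λ W X → con (+ 0) :=
        (con (+ 0) :+ W :* (con (+ 0) :- con (+ 0) :+ con (+ 0) :+ con (+ 0)) :+ con (+ 0) :* (W :* W)) :* X) refl W (W ^ d)
      isoCount-[] : ∀ H z → isoCount H z [] ≡ 0
      isoCount-[] H (+ _)    = refl
      isoCount-[] H -[1+ _ ] = refl
      count-[] : ∀ k → count k [] ≡ 0
      count-[] rook = refl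
      count-[] zg   = isoCount-[] ZG  (+ d - + 2)
      count-[] sg   = isoCount-[] SG  (+ d - + 2)
      count-[] wrg  = isoCount-[] WRG (+ d - + 1)
      count-[] wcg  = isoCount-[] WCG (+ d - + 1)
    sum-estimate (σ ∷ L) = step (σ ⊆ᴮ? B) (sum-estimate L)
      where
      rest : ℕ
      rest = ℕ.sum (map (length ∘ fibre) L)
      step : Dec (σ ⊆ᴮ B) → (∃ λ t → + rest ≡ estimate W d (λ k → count k L) t) →
             ∃ λ t → + (length (fibre σ) ℕ.+ rest) ≡ estimate W d (λ k → count k (σ ∷ L)) t
      step (no σ⊈B)  (t , eq) = t , trans (cong (λ l → + (l ℕ.+ rest)) (fibre-⊈ σ⊈B))
        (trans eq (estimate-cong W d (λ k → count k L) (λ k → count k (σ ∷ L)) t (λ k → sym (count-⊈ k σ⊈B L))))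
      step (yes σ⊆B) (t , eq) = let (t′ , eq′) = count-estimate d σ in t′ + t , (begin
        + (length (fibre σ) ℕ.+ rest)
          ≡⟨ ℤ.pos-+ (length (fibre σ)) rest ⟩
        + length (fibre σ) + + rest
          ≡⟨ cong₂ _+_ (trans (cong +_ (fibre-⊆ σ⊆B)) eq′) eq ⟩
        estimate W d (λ k → hit k d σ) t′ + estimate W d (λ k → count k L) t
          ≡⟨ estimate-+ W d (λ k → hit k d σ) (λ k → count k L) t′ t ⟩
        estimate W d (λ k → hit k d σ ℕ.+ count k L) (t′ + t)
          ≡⟨ estimate-cong W d (λ k → hit k d σ ℕ.+ count k L) (λ k → count k (σ ∷ L)) (t′ + t) (λ k → sym (count-⊆ k σ⊆B L)) ⟩
        estimate W d (λ k → count k (σ ∷ L)) (t′ + t) ∎)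

    𝔪-estimate : ∃ λ t → + 𝔪 F d B ≡ estimate W d (λ k → count k (boards m n)) t
    𝔪-estimate = let (t , eq) = sum-estimate (boards m n) in t , trans
      (cong +_ (trans (sym ranked-length) (length-by-fibres _≟ᴮ_ support ranked (boards-unique m n) (boards-complete m n)))) eq

theorem3p10 : (m n : ℕ) (B : Board m n) (d : ℕ) (q : ℕ) → IsPrimePower q → (F : FiniteField q) →
    ∃ λ (M : ℤ) → IsM F d B M ×
    M ≡ + rookNumber d B
    + (+ q - 1ℤ) * (+ r[ ZG , + d - + 2 ] B - + r[ SG , + d - + 2 ] B
    + + r[ WRG , + d - + 1 ] B + + r[ WCG , + d - + 1 ] B)
    [mod (+ q - 1ℤ) ^ 2 ]
theorem3p10 m n B d q _ F = M , trans (proj₂ (𝔪-estimate d B)) (cong (λ v → M * v ^ d) W≡) ,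
  subst₂ (λ v x → M ≡ x [mod v ^ 2 ]) W≡ R≡ (∣⇒∣ᵤ (divides t (solve 3 (λ R t W →
    (R :+ t :* (W :* W)) :- R := t :* (W :* (W :* con 1ℤ))) refl (R W) t W)))
  where
  open Assembly F
  open Rank F using (w)
  open Scaling F using (suc-length-nonzeros)
  open +-*-Solver
  L = boards m n
  t = proj₁ (𝔪-estimate d B)
  R : ℤ → ℤ
  R v = + rookNumber d B + v * (+ count d B zg L - + count d B sg L + + count d B wrg L + + count d B wcg L)
  -- The witness is the cofactor of W^d in `estimate`, so the quotient by (q - 1)^d is exhibited
  -- instead of being divided out; `t` is then the quotient in the congruence.
  M = R W + t * (W * W)
  W≡ : W ≡ + q - 1ℤ
  W≡ = cong (λ q → + q - 1ℤ) suc-length-nonzeros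
  R≡ : R W ≡ + rookNumber d B
    + (+ q - 1ℤ) * (+ r[ ZG , + d - + 2 ] B - + r[ SG , + d - + 2 ] B
    + + r[ WRG , + d - + 1 ] B + + r[ WCG , + d - + 1 ] B)
  R≡ rewrite r≡isoCount d B ZG (+ d - + 2) | r≡isoCount d B SG (+ d - + 2)
           | r≡isoCount d B WRG (+ d - + 1) | r≡isoCount d B WCG (+ d - + 1) = cong R W≡
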